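{- Let $\mathcal{D}=(D,<,\approx)$ be a constraint system in which $D$ is an infinite set, $<$ is a strict total order on $D$, $\approx$ is equality, and $\mathcal{D}$ is dense and open. Then the satisfiability problem for $\mathrm{CLRV}^{\mathrm{XF}}(\mathcal{D})$ is decidable: there is an algorithm which, given a $\mathrm{CLRV}^{\mathrm{XF}}(\mathcal{D})$ formula $\phi$, decides whether there is a model $\sigma$ with $\sigma,0\models\phi$. In particular, satisfiability for $\mathrm{CLRV}^{\mathrm{XF}}((\mathbb{R},<,\approx))$ is decidable.
   Context: $\mathcal{D}$ is dense if for all $d<d''$ in $D$ there is $d'$ with $d<d'<d''$. It is open if for every $d'\in D$ there are $d,d''\in D$ with $d<d'<d''$. The set of variables is $V=V_{\mathrm{local}}\uplus V_{\mathrm{remote}}$, a disjoint union of local and remote variables. $\mathrm{CLRV}^{\mathrm{XF}}(\mathcal{D})$ formulas are given by the grammar $\phi ::= x_{loc}\approx \mathbf{X}^i y_{loc} \mid x_{loc}< \mathbf{X}^i y_{loc} \mid x_{rem}\approx \mathbf{X}^i y_{rem} \mid x_{rem}\approx \mathbf{XF}\, y_{rem} \mid \phi\wedge\phi \mid \neg\phi \mid \mathbf{X}\phi \mid \phi\mathbf{U}\phi \mid \mathbf{X}^{ -1}\phi \mid \phi\mathbf{S}\phi$. Here $x_{loc},y_{loc}\in V_{\mathrm{local}}$, $x_{rem},y_{rem}\in V_{\mathrm{remote}}$ and $i\in\mathbb{N}$. A model is an infinite sequence $\sigma=\sigma(0)\sigma(1)\cdots$ of maps $V\to D$. The satisfaction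 relation at position $i\ge 0$ is as follows. - $\sigma,i\models x\approx\mathbf{X}^j y$ iff $\sigma(i)(x)=\sigma(i+j)(y)$. - $\sigma,i\models x<\mathbf{X}^j y$ iff $\sigma(i)(x)<\sigma(i+j)(y)$. - $\sigma,i\models x\approx\mathbf{XF}y$ iff there is $j>i$ with $\sigma(i)(x)=\sigma(j)(y)$. - Boolean connectives are as usual. - $\sigma,i\models\mathbf{X}\phi$ iff $\sigma,i+1\models\phi$. - $\sigma,i\models\phi\mathbf{U}\phi'$ iff there is $j\ge i$ with $\sigma,j\models\phi'$ and $\sigma,l\models\phi$ for all $i\le l<j$. - $\sigma,i\models\mathbf{X}^{ -1}\phi$ iff $i\ge1$ and $\sigma,i-1\models\phi$. - $\sigma,i\models\phi\mathbf{S}\phi'$ iff there is $j\le i$ with $\sigma,j\models\phi'$ and $\sigma,l\models\phi$ for all $j<l\le i$. $\phi$ is satisfiable iff some model $\sigma$ has $\sigma,0\models\phi$. -}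

module Defs where

open import Level using (Level; suc; _⊔_; 0ℓ)
open import Data.Nat using (ℕ; _+_; _∸_; _≤_; _<_)
open import Data.List using (List)
open import Data.List.Relation.Unary.All using (All)
open import Data.Product using (∃-syntax; _×_)
open import Data.Rational using (ℚ) renaming (_<_ to _<ℚ_)
open import Data.Sum using (_⊎_; inj₁; inj₂)
open import Function.Bundles using (_⇔_)
open import Relation.Binary.Core using (Rel)
open import Relation.Binary.Definitions using (Dense)
open import Relation.Binary.Structures using (IsStrictPartialOrder)
open import Relation.Nullary using (¬_)

private
  variable
    a ℓ : Level

-- Equality is a setoid equality, so that ℝ below is an instance; a set with
-- propositional equality is the case _≈_ = _≡_.
record ConstraintSystem (a ℓ : Level) : Set (suc (a ⊔ ℓ)) where
  field
    Carrier : Set a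
    _≈_     : Rel Carrier ℓ
    _≺_     : Rel Carrier ℓ

module _ (𝒟 : ConstraintSystem a ℓ) where
  open ConstraintSystem 𝒟

  -- `connected` is the contrapositive form of "x ≉ y implies x ≺ y or y ≺ x".
  -- It is implied by the library's `Trichotomous _≈_ _≺_` and equivalent to it
  -- classically, but, unlike a decision procedure for trichotomy, it is
  -- available constructively for the real numbers.
  record IsStrictlyTotallyOrdered : Set (a ⊔ ℓ) where
    field
      isStrictPartialOrder : IsStrictPartialOrder _≈_ _≺_
      connected            : ∀ {x y} → ¬ (x ≺ y) → ¬ (y ≺ x) → x ≈ y

  -- No finite list exhausts the carrier.
  IsInfinite : Set (a ⊔ ℓ)
  IsInfinite = (xs : List Carrier) → ∃[ d ] All (λ x → ¬ (d ≈ x)) xs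

  IsDense : Set (a ⊔ ℓ)
  IsDense = Dense _≺_

  IsOpen : Set (a ⊔ ℓ)
  IsOpen = ∀ d′ → ∃[ d ] ∃[ d″ ] (d ≺ d′ × d′ ≺ d″)

-- L and R are the sets of local and of remote variables.
data Formula (L R : Set) : Set where
  _≈loc𝐗^[_]_ : L → ℕ → L → Formula L R
  _<loc𝐗^[_]_ : L → ℕ → L → Formula L R
  _≈rem𝐗^[_]_ : R → ℕ → R → Formula L R
  _≈rem𝐗𝐅_    : R → R → Formula L R
  _∧ᶠ_        : Formula L R → Formula L R → Formula L R
  ¬ᶠ_         : Formula L R → Formula L R
  𝐗_          : Formula L R → Formula L R
  _𝐔_         : Formula L R → Formula L R → Formula L R
  𝐗⁻¹_        : Formula L R → Formula L R
  _𝐒_         : Formula L R → Formula L R → Formula L R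

module _ (𝒟 : ConstraintSystem a ℓ) {L R : Set} where
  open ConstraintSystem 𝒟

  Model : Set a
  Model = ℕ → L ⊎ R → Carrier

  infix 4 _,_⊨_

  _,_⊨_ : Model → ℕ → Formula L R → Set ℓ
  σ , i ⊨ (x ≈loc𝐗^[ j ] y) = σ i (inj₁ x) ≈ σ (i + j) (inj₁ y)
  σ , i ⊨ (x <loc𝐗^[ j ] y) = σ i (inj₁ x) ≺ σ (i + j) (inj₁ y)
  σ , i ⊨ (x ≈rem𝐗^[ j ] y) = σ i (inj₂ x) ≈ σ (i + j) (inj₂ y)
  σ , i ⊨ (x ≈rem𝐗𝐅 y)      = ∃[ j ] (i < j × σ i (inj₂ x) ≈ σ j (inj₂ y))
  σ , i ⊨ (φ ∧ᶠ ψ)          = (σ , i ⊨ φ) × (σ , i ⊨ ψ)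
  σ , i ⊨ (¬ᶠ φ)            = ¬ (σ , i ⊨ φ)
  σ , i ⊨ (𝐗 φ)             = σ , i + 1 ⊨ φ
  σ , i ⊨ (φ 𝐔 ψ)           = ∃[ j ] (i ≤ j × (σ , j ⊨ ψ) × (∀ l → i ≤ l → l < j → σ , l ⊨ φ))
  σ , i ⊨ (𝐗⁻¹ φ)           = 1 ≤ i × (σ , i ∸ 1 ⊨ φ)
  σ , i ⊨ (φ 𝐒 ψ)           = ∃[ j ] (j ≤ i × (σ , j ⊨ ψ) × (∀ l → j < l → l ≤ i → σ , l ⊨ φ))

  Satisfiable : Formula L R → Set (a ⊔ ℓ)
  Satisfiable φ = ∃[ σ ] (σ , 0 ⊨ φ)

-- Two-sided Dedekind cuts. `Rounded` also says that Lower is downward closed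
-- and Upper upward closed.
record ℝ : Set₁ where
  field
    Lower Upper    : ℚ → Set
    lowerInhabited : ∃[ q ] Lower q
    upperInhabited : ∃[ q ] Upper q
    lowerRounded   : ∀ q → Lower q ⇔ (∃[ r ] (q <ℚ r × Lower r))
    upperRounded   : ∀ q → Upper q ⇔ (∃[ r ] (r <ℚ q × Upper r))
    disjoint       : ∀ q → ¬ (Lower q × Upper q)
    located        : ∀ q r → q <ℚ r → Lower q ⊎ Upper r

open ℝ

_≈ℝ_ : Rel ℝ 0ℓ
x ≈ℝ y = ∀ q → (Lower x q ⇔ Lower y q) × (Upper x q ⇔ Upper y q)

_<ℝ_ : Rel ℝ 0ℓ
x <ℝ y = ∃[ q ] (Upper x q × Lower y q)

ℝ-constraintSystem : ConstraintSystem (suc 0ℓ) 0ℓ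
ℝ-constraintSystem = record { Carrier = ℝ ; _≈_ = _≈ℝ_ ; _≺_ = _<ℝ_ }

{-# OPTIONS --safe #-}

-- Local and remote variables never interact, so their valuations are built separately.
-- For the local ones only the order type of the values in a window i, …, i + k matters
-- (k bounds the offsets of the formula): since the order is dense and open, every
-- sequence of order types that agree on overlapping windows is realised, step by step.
--
-- A remote value is described at time i by the places where it occurs in the window and
-- by the set of variables carrying it after the window.  A configuration is the multiset
-- of the descriptions of all values seen so far together with a truth assignment to the
-- subformulas.  A value outside the window ("parked") may always stay idle, and in place
-- of a parked value a fresh one can be used; hence having fewer parked values is better,
-- the transition system is well-structured (Dickson's lemma), and reachability of
-- downward closed sets is decidable.
--
-- In a model some pair of a control state and a set P of descriptions occurs infinitely
-- often, and from there every pending promise of a value described in P is kept on a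
-- finite path back to that situation.  Conversely such loops, run in the order of a queue
-- of promises, form a model.  Refuting satisfiability needs classical logic only under a
-- double negation: the infinite run is never chosen, just finite parts of it.

module Submission where

open import Defs
open import Level using (Level)
open import Data.Bool using (Bool; true; false; not; _∧_; _∨_)
import Data.Bool.Properties as Bool
open import Data.Empty using (⊥; ⊥-elim)
open import Data.Fin using (Fin; zero; suc; toℕ; fromℕ; fromℕ<; inject₁; combine; remQuot)
import Data.Fin.Properties as Fin
open import Data.Fin.Properties using (all?; any?; injective⇒≤; remQuot-combine; toℕ-fromℕ; toℕ-fromℕ<; toℕ-inject₁; toℕ<n)
open import Data.Fin.Relation.Unary.Top using (view; ‵fromℕ; ‵inject₁)
open import Data.List as List using (List; []; _∷_; _++_; allFin; cartesianProduct; cartesianProductWith; filter; length; map; upTo; zip)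
open import Data.List.Membership.Propositional using (_∈_; _∉_; find; lose)
open import Data.List.Membership.Propositional.Properties using (∈-++⁺ˡ; ∈-++⁺ʳ; ∈-++⁻; ∈-allFin; ∈-cartesianProduct⁺; ∈-cartesianProduct⁻; ∈-cartesianProductWith⁺; ∈-cartesianProductWith⁻; ∈-filter⁺; ∈-filter⁻; ∈-lookup; ∈-map⁺; ∈-map⁻; ∈-upTo⁺; ∈-upTo⁻; ∈-∃++)
open import Data.List.Properties using (++-assoc; ++-identityʳ; length-++; length-map; length-tabulate; length-upTo)
open import Data.List.Relation.Binary.Permutation.Propositional using (_↭_; prep; swap; ↭-refl; ↭-reflexive; ↭-sym; ↭-trans; module PermutationReasoning)
import Data.List.Relation.Binary.Permutation.Propositional as Perm
open import Data.List.Relation.Binary.Permutation.Propositional.Properties using (++-comm; All-resp-↭; Any-resp-↭; shift; ∈-resp-↭)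
import Data.List.Relation.Binary.Permutation.Propositional.Properties as Perm
open import Data.List.Relation.Binary.Pointwise using (Pointwise; []; _∷_; Pointwise-length)
import Data.List.Relation.Binary.Pointwise as Pointwise
open import Data.List.Relation.Unary.All as All using (All; []; _∷_)
import Data.List.Relation.Unary.All.Properties as All
open import Data.List.Relation.Unary.AllPairs using (AllPairs; []; _∷_)
import Data.List.Relation.Unary.AllPairs.Properties as AllPairs
open import Data.List.Relation.Unary.Any as Any using (Any; here; there)
import Data.List.Relation.Unary.Any.Properties as Any
open import Data.List.Relation.Unary.Unique.Propositional using (Unique)
import Data.List.Relation.Unary.Unique.Propositional.Properties as Unique
open import Data.Nat using (ℕ; zero; suc; _+_; _*_; _∸_; _⊔_; _≤_; _<_; _≤?_; z≤n; s≤s)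
open import Data.Nat.Properties
open import Data.Product using (∃; ∃-syntax; Σ; _×_; _,_; proj₁; proj₂; uncurry)
open import Data.Product.Properties using (≡-dec)
open import Data.Rational using (ℚ; 0ℚ; 1ℚ; -_) renaming (_<_ to _<ℚ_; _+_ to _+ℚ_)
import Data.Rational.Properties as ℚ
open import Data.Sum using (_⊎_; inj₁; inj₂; [_,_]′)
open import Data.Unit using (⊤; tt)
open import Data.Vec using (Vec; []; _∷_; lookup)
import Data.Vec.Properties as Vec
open import Function using (_∘_; _on_; const; id)
open import Function.Bundles using (mk⇔; module Equivalence)
open import Function.Construct.Composition using (_⇔-∘_)
open import Function.Construct.Identity using (⇔-id)
open import Function.Construct.Symmetry using (⇔-sym)
open import Relation.Binary.Definitions using (DecidableEquality; tri<; tri≈; tri>)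
open import Relation.Binary.PropositionalEquality
open import Relation.Binary.Structures using (IsStrictPartialOrder)
open import Relation.Nullary using (¬_; Dec; yes; no; does; proof; contradiction; ¬¬-excluded-middle; Reflects; ofʸ; ofⁿ)
open import Relation.Nullary.Decidable using (_×-dec_; _⊎-dec_; _→-dec_; decidable-stable; does-⇔; map′)
open import Relation.Nullary.Reflects using (_×-reflects_; _⊎-reflects_; ¬-reflects)
open import Relation.Unary using (Decidable)

-- Almost-full relations

-- Multisets make the order almost full but forget which value is which, while a promise belongs to
-- one value. Hence a configuration singles out a followed value, each loop keeps one promise of it,
-- and values get numbers only when loops are strung together. Loops must then start from any
-- configuration reached on return, not just from the one for which they were found, as parked
-- values may have accumulated. If P lists a valid configuration, any other valid one with statuses
-- from P differs from it only by parked values, since a position of the window belongs to exactly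
-- one value; the surplus idles while the loop is replayed. So finitely many configurations, one for
-- each choice of followed status, decide whether P is good. Almost-full relations serve as
-- well-quasi-orders in inductive form: the search for a path recurses on the proof and needs no
-- bound on path lengths. Acceptance becomes decidable outright, so a model need only yield it under
-- a double negation, which already refutes satisfiability when the search fails.

data AF {X : Set} : (X → X → Set) → Set₁ where
  now   : ∀ {R} → (∀ x y → R x y) → AF R
  later : ∀ {R} → (∀ x → AF (λ y z → R y z ⊎ R x y)) → AF R

module _ {X : Set} where

  af-mono : {R S : X → X → Set} → (∀ {x y} → R x y → S x y) → AF R → AF S
  af-mono R⊆S (now all)   = now λ x y → R⊆S (all x y)
  af-mono R⊆S (later af) =
    later λ x → af-mono [ inj₁ ∘ R⊆S , inj₂ ∘ R⊆S ]′ (af x)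

  af-comap : {Y : Set} {R : X → X → Set} (f : Y → X) → AF R → AF (R on f)
  af-comap f (now all)  = now λ x y → all (f x) (f y)
  af-comap f (later af) = later λ x → af-comap f (af (f x))

  private
    -- Ramsey's argument, by induction on the arity of `A` and `B`. Fixing an element `x` adds to a
    -- binary relation a disjunct with one free argument, and to a unary one a disjunct with none.
    -- Shrinking either almost-full proof gives two relations, which are then combined at the arity
    -- below; `C` collects what has been settled.
    af-∩-nullary : {R S C : X → X → Set} {A B : Set} → AF R → AF S →
      (∀ {x y} → R x y → C x y ⊎ A) → (∀ {x y} → S x y → C x y ⊎ B) →
      AF (λ x y → C x y ⊎ A × B)
    af-∩-nullary (now all) q R⊆ S⊆ = af-mono (λ {x} {y} Sxy → 
      [ inj₁ , (λ b → [ inj₁ , (λ a → inj₂ (a , b)) ]′ (R⊆ (all x y))) ]′ (S⊆ Sxy)) q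
    af-∩-nullary {C = C} {A} {B} (later p) q R⊆ S⊆ = later λ x → af-mono
      [ [ inj₁ ∘ inj₁ , inj₂ ∘ inj₁ ]′ , inj₁ ∘ inj₂ ]′
      (af-∩-nullary {C = λ y z → C y z ⊎ C x y} (p x) q
        [ [ inj₁ ∘ inj₁ , inj₂ ]′ ∘ R⊆ , [ inj₁ ∘ inj₂ , inj₂ ]′ ∘ R⊆ ]′
        ([ inj₁ ∘ inj₁ , inj₂ ]′ ∘ S⊆))

    af-∩-unary : {R S C : X → X → Set} {A B : X → Set} → AF R → AF S →
      (∀ {x y} → R x y → C x y ⊎ A x) → (∀ {x y} → S x y → C x y ⊎ B x) →
      AF (λ x y → C x y ⊎ A x × B x)
    af-∩-unary (now all) q R⊆ S⊆ = af-mono (λ {x} {y} Sxy →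
      [ inj₁ , (λ b → [ inj₁ , (λ a → inj₂ (a , b)) ]′ (R⊆ (all x y))) ]′ (S⊆ Sxy)) q
    af-∩-unary p@(later _) (now all) R⊆ S⊆ = af-mono (λ {x} {y} Rxy →
      [ inj₁ , (λ a → [ inj₁ , (λ b → inj₂ (a , b)) ]′ (S⊆ (all x y))) ]′ (R⊆ Rxy)) p
    af-∩-unary {C = C} {A} {B} p@(later p′) q@(later q′) R⊆ S⊆ = later λ x → af-mono
      [ [ [ inj₁ ∘ inj₁ , inj₂ ∘ inj₁ ]′ , inj₁ ∘ inj₂ ]′ , inj₂ ∘ inj₂ ]′
      (af-∩-nullary {C = λ y z → (C y z ⊎ C x y) ⊎ A y × B y} {A x} {B x}
        (af-∩-unary {C = λ y z → (C y z ⊎ C x y) ⊎ A x} {A} {B} (p′ x) q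
          [ [ inj₁ ∘ inj₁ ∘ inj₁ , inj₂ ]′ ∘ R⊆ , [ inj₁ ∘ inj₁ ∘ inj₂ , inj₁ ∘ inj₂ ]′ ∘ R⊆ ]′
          ([ inj₁ ∘ inj₁ ∘ inj₁ , inj₂ ]′ ∘ S⊆))
        (af-∩-unary {C = λ y z → (C y z ⊎ C x y) ⊎ B x} {A} {B} p (q′ x)
          ([ inj₁ ∘ inj₁ ∘ inj₁ , inj₂ ]′ ∘ R⊆)
          [ [ inj₁ ∘ inj₁ ∘ inj₁ , inj₂ ]′ ∘ S⊆ , [ inj₁ ∘ inj₁ ∘ inj₂ , inj₁ ∘ inj₂ ]′ ∘ S⊆ ]′)
        [ [ inj₁ ∘ inj₁ , inj₂ ]′ , inj₁ ∘ inj₂ ]′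
        [ [ inj₁ ∘ inj₁ , inj₂ ]′ , inj₁ ∘ inj₂ ]′)

    af-∩-binary : {R S C A B : X → X → Set} → AF R → AF S →
      (∀ {x y} → R x y → C x y ⊎ A x y) → (∀ {x y} → S x y → C x y ⊎ B x y) →
      AF (λ x y → C x y ⊎ A x y × B x y)
    af-∩-binary (now all) q R⊆ S⊆ = af-mono (λ {x} {y} Sxy →
      [ inj₁ , (λ b → [ inj₁ , (λ a → inj₂ (a , b)) ]′ (R⊆ (all x y))) ]′ (S⊆ Sxy)) q
    af-∩-binary p@(later _) (now all) R⊆ S⊆ = af-mono (λ {x} {y} Rxy →
      [ inj₁ , (λ a → [ inj₁ , (λ b → inj₂ (a , b)) ]′ (S⊆ (all x y))) ]′ (R⊆ Rxy)) p
    af-∩-binary {C = C} {A} {B} p@(later p′) q@(later q′) R⊆ S⊆ = later λ x → af-mono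
      [ [ [ inj₁ ∘ inj₁ , inj₂ ∘ inj₁ ]′ , inj₁ ∘ inj₂ ]′ , inj₂ ∘ inj₂ ]′
      (af-∩-unary {C = λ y z → (C y z ⊎ C x y) ⊎ A y z × B y z} {A x} {B x}
        (af-∩-binary {C = λ y z → (C y z ⊎ C x y) ⊎ A x y} {A} {B} (p′ x) q
          [ [ inj₁ ∘ inj₁ ∘ inj₁ , inj₂ ]′ ∘ R⊆ , [ inj₁ ∘ inj₁ ∘ inj₂ , inj₁ ∘ inj₂ ]′ ∘ R⊆ ]′
          ([ inj₁ ∘ inj₁ ∘ inj₁ , inj₂ ]′ ∘ S⊆))
        (af-∩-binary {C = λ y z → (C y z ⊎ C x y) ⊎ B x y} {A} {B} p (q′ x)
          ([ inj₁ ∘ inj₁ ∘ inj₁ , inj₂ ]′ ∘ R⊆)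
          [ [ inj₁ ∘ inj₁ ∘ inj₁ , inj₂ ]′ ∘ S⊆ , [ inj₁ ∘ inj₁ ∘ inj₂ , inj₁ ∘ inj₂ ]′ ∘ S⊆ ]′)
        [ [ inj₁ ∘ inj₁ , inj₂ ]′ , inj₁ ∘ inj₂ ]′
        [ [ inj₁ ∘ inj₁ , inj₂ ]′ , inj₁ ∘ inj₂ ]′)

  af-∩ : {R S : X → X → Set} → AF R → AF S → AF (λ x y → R x y × S x y)
  af-∩ p q = af-mono [ (λ ()) , id ]′ (af-∩-binary {C = λ _ _ → ⊥} p q inj₂ inj₂)

  af-⋂ : {I : Set} {R : I → X → X → Set} (is : List I) → (∀ i → AF (R i)) →
    AF (λ x y → All (λ i → R i x y) is)
  af-⋂ []       af = now λ _ _ → []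
  af-⋂ (i ∷ is) af = af-mono (uncurry _∷_) (af-∩ (af i) (af-⋂ is af))

  -- Once `x` is fixed, a later copy of `x` is related to everything by reflexivity, so `x` can be
  -- struck from `xs`. The bound `n` carries the recursion, because `us ++ vs` is no sublist in the
  -- structural sense.
  af-⊇ : {R : X → X → Set} (n : ℕ) (xs : List X) → length xs ≤ n →
    (∀ x → R x x) → (∀ {x} → x ∉ xs → ∀ y → R x y) → DecidableEquality X → AF R
  af-⊇ n [] _ _ ∉⇒R _ = now λ x → ∉⇒R λ ()
  af-⊇ {R} (suc n) xs@(_ ∷ _) ≤n rf ∉⇒R _≟_ = later step
    where
    step : ∀ x → AF (λ y z → R y z ⊎ R x y)
    step x with Any.any? (x ≟_) xs
    ... | no x∉xs = now λ y _ → inj₂ (∉⇒R x∉xs y)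
    ... | yes x∈xs with us , vs , eq ← ∈-∃++ x∈xs =
      af-⊇ n (us ++ vs) ≤n′ (inj₁ ∘ rf) ∉⇒R′ _≟_
      where
      ≤n′ : length (us ++ vs) ≤ n
      ≤n′ = ≤-pred (≤-trans (≤-reflexive (begin
        suc (length (us ++ vs))        ≡⟨ cong suc (length-++ us) ⟩
        suc (length us + length vs)    ≡⟨ +-suc (length us) (length vs) ⟨
        length us + suc (length vs)    ≡⟨ length-++ us ⟨
        length (us ++ x ∷ vs)          ≡⟨ cong length eq ⟨
        length xs                      ∎)) ≤n)
        where open ≡-Reasoning
      ∉⇒R′ : ∀ {y} → y ∉ us ++ vs → ∀ z → R y z ⊎ R x y
      ∉⇒R′ {y} y∉ z with x ≟ y
      ... | yes refl = inj₂ (rf x)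
      ... | no x≢y = inj₁ (∉⇒R (λ y∈ → y∉ (drop (∈-++⁻ us (subst (y ∈_) eq y∈)))) z)
        where
        drop : y ∈ us ⊎ y ∈ x ∷ vs → y ∈ us ++ vs
        drop (inj₁ p)         = ∈-++⁺ˡ p
        drop (inj₂ (here p))  = contradiction (sym p) x≢y
        drop (inj₂ (there p)) = ∈-++⁺ʳ us p

af-≤ : AF _≤_
af-≤ = later λ x → af-≤-from x x ≤-refl
  where
  af-≤-from : ∀ n x → x ≤ n → AF (λ y z → y ≤ z ⊎ x ≤ y)
  af-≤-from n zero _ = now λ _ _ → inj₂ z≤n
  af-≤-from (suc n) (suc x) (s≤s x≤n) = later step
    where
    step : ∀ y → AF (λ z w → (z ≤ w ⊎ suc x ≤ z) ⊎ (y ≤ z ⊎ suc x ≤ y))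
    step y with suc x ≤? y
    ... | yes x<y = now λ _ _ → inj₂ (inj₂ x<y)
    ... | no  x≮y = af-mono [ inj₁ ∘ inj₁ , inj₂ ∘ inj₁ ]′
                      (af-≤-from n y (≤-trans (≤-pred (≰⇒> x≮y)) x≤n))

-- Finite types

record Finite (A : Set) : Set where
  field
    elems    : List A
    complete : ∀ a → a ∈ elems
open Finite

Bool-finite : Finite Bool
Bool-finite = record
  { elems = true ∷ false ∷ []
  ; complete = λ { true → here refl ; false → there (here refl) } }

×-finite : {A B : Set} → Finite A → Finite B → Finite (A × B)
×-finite fa fb = record
  { elems = cartesianProductWith _,_ (elems fa) (elems fb)
  ; complete = λ (a , b) → ∈-cartesianProductWith⁺ _,_ (complete fa a) (complete fb b) }

Vec-finite : {A : Set} → Finite A → ∀ n → Finite (Vec A n)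
Vec-finite fa zero = record { elems = [] ∷ [] ; complete = λ { [] → here refl } }
Vec-finite fa (suc n) = record
  { elems = cartesianProductWith _∷_ (elems fa) (elems (Vec-finite fa n))
  ; complete = λ { (a ∷ v) → ∈-cartesianProductWith⁺ _∷_ (complete fa a) (complete (Vec-finite fa n) v) } }

module _ {A : Set} (fa : Finite A) where

  lists≤ : ℕ → List (List A)
  lists≤ zero    = [] ∷ []
  lists≤ (suc n) = [] ∷ cartesianProductWith _∷_ (elems fa) (lists≤ n)

  ∈-lists≤ : ∀ {n} xs → length xs ≤ n → xs ∈ lists≤ n
  ∈-lists≤ {zero}  []       _         = here refl
  ∈-lists≤ {suc n} []       _         = here refl
  ∈-lists≤ {suc n} (x ∷ xs) (s≤s len) =
    there (∈-cartesianProductWith⁺ _∷_ (complete fa x) (∈-lists≤ xs len))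

  ∃? : ∀ {p} {P : A → Set p} → (∀ a → Dec (P a)) → Dec (∃ P)
  ∃? P? = map′ Any.satisfied (λ (a , Pa) → lose (complete fa a) Pa) (Any.any? P? (elems fa))

  ∃≤? : ∀ {p} {P : List A → Set p} n → (∀ {xs} → P xs → length xs ≤ n) →
    (∀ xs → Dec (P xs)) → Dec (∃ P)
  ∃≤? n bound P? =
    map′ Any.satisfied (λ (xs , Pxs) → lose (∈-lists≤ xs (bound Pxs)) Pxs) (Any.any? P? (lists≤ n))

  af-≡ : DecidableEquality A → AF {A} _≡_
  af-≡ = af-⊇ (length (elems fa)) (elems fa) ≤-refl (λ _ → refl)
    (λ a∉ → contradiction (complete fa _) a∉)

-- Reachability in well-structured transition systems

module Reachability {X : Set} (_⟶_ : X → X → Set) where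

  Reach : ∀ {p} → (X → Set p) → ℕ → X → Set p
  Reach A zero    x = A x
  Reach A (suc n) x = ∃[ y ] x ⟶ y × Reach A n y

  module Search
    (∃⟶? : ∀ x {P : X → Set} → (∀ y → Dec (P y)) → Dec (∃[ y ] x ⟶ y × P y))
    (_≼_ : X → X → Set) (≼-af : AF _≼_)
    (simulate : ∀ {x y y′} → x ≼ y → y ⟶ y′ → ∃[ x′ ] x ⟶ x′ × x′ ≼ y′)
    where

    Closed : (X → Set) → Set
    Closed A = ∀ {x y} → x ≼ y → A y → A x

    module _ {A : X → Set} (A? : ∀ x → Dec (A x)) (A-closed : Closed A) where

      Reach-closed : ∀ n → Closed (Reach A n)
      Reach-closed zero    x≼y Ay = A-closed x≼y Ay
      Reach-closed (suc n) x≼y (y′ , y⟶y′ , r) with x′ , x⟶x′ , x′≼y′ ← simulate x≼y y⟶y′ =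
        x′ , x⟶x′ , Reach-closed n x′≼y′ r

      Reach? : ∀ n x → Dec (Reach A n x)
      Reach? zero    x = A? x
      Reach? (suc n) x = ∃⟶? x (Reach? n)

      Minimal : ℕ → X → Set
      Minimal n x = Reach A n x × (∀ {m} → m < n → ¬ Reach A m x)

      minimal : ∀ n x → Reach A n x → ∃[ m ] Minimal m x
      minimal n x r = go n 0 (λ ()) (subst (λ m → Reach A m x) (sym (+-identityʳ n)) r)
        where
        go : ∀ d m → (∀ {m′} → m′ < m → ¬ Reach A m′ x) → Reach A (d + m) x → ∃[ m ] Minimal m x
        go zero    m none r = m , r , none
        go (suc d) m none r with Reach? m x
        ... | yes r′ = m , r′ , none
        ... | no ¬r = go d (suc m) (none′ ∘ m<1+n⇒m<n∨m≡n) (subst (λ j → Reach A j x) (sym (+-suc d m)) r)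
          where
          none′ : ∀ {m′} → m′ < m ⊎ m′ ≡ m → ¬ Reach A m′ x
          none′ (inj₁ lt)   = none lt
          none′ (inj₂ refl) = ¬r

      -- A shortest path meets no pair of a relation that respects shortest paths;
      -- ≼ is such a relation because smaller states reach A at least as fast.
      Respects : (X → X → Set) → ℕ → Set
      Respects D n = ∀ {m m′ x y} → m ≤ n → Minimal m x → m′ < m → Reach A m′ y → ¬ D x y

      -- The recursion is on the proof that `D` is almost full: passing from `x` to a successor adds
      -- the disjunct `D x y`, and once `D` is total a shortest path cannot go on. The negative
      -- answer is conditional on `Respects` because the accumulated `D` refers to the states
      -- already visited.
      search : ∀ {D} → AF D → ∀ x →
        (∃[ n ] Reach A n x) ⊎ (∀ n → Respects D n → ¬ Minimal n x)
      search (now all) x with A? x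
      ... | yes Ax = inj₁ (0 , Ax)
      ... | no ¬Ax = inj₂ λ where
        zero    _    (Ax , _)              → ¬Ax Ax
        (suc n) resp mx@((y , _ , ry) , _) → resp ≤-refl mx ≤-refl ry (all x y)
      search {D} (later af) x with A? x
      ... | yes Ax = inj₁ (0 , Ax)
      ... | no ¬Ax = conclude (∃⟶? x found?)
        where
        -- The negative outcome of `search` is weaker than unreachability, so the predicate handed
        -- to `∃⟶?` is the success of the recursive call itself.
        Found : X → Set
        Found y = ∃ λ r → search (af x) y ≡ inj₁ r
        found? : ∀ y → Dec (Found y)
        found? y with search (af x) y
        ... | inj₁ r = yes (r , refl)
        ... | inj₂ _ = no λ ()
        conclude : Dec (∃[ y ] x ⟶ y × Found y) →
          (∃[ n ] Reach A n x) ⊎ (∀ n → Respects D n → ¬ Minimal n x)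
        conclude (yes (y , x⟶y , (n , r) , _)) = inj₁ (suc n , y , x⟶y , r)
        conclude (no ¬found) = inj₂ refute
          where
          refute : ∀ n → Respects D n → ¬ Minimal n x
          refute zero    _    (Ax , _) = ¬Ax Ax
          refute (suc n) resp mx@((y , x⟶y , ry) , none) with search (af x) y in eq
          ... | inj₁ found = ¬found (y , x⟶y , found , eq)
          ... | inj₂ ref   = ref n resp′ (ry , λ m<n r → none (s≤s m<n) (y , x⟶y , r))
            where
            resp′ : Respects (λ y z → D y z ⊎ D x y) n
            resp′ m≤n my m′<m rz (inj₁ Dyz) = resp (m≤n⇒m≤1+n m≤n) my m′<m rz Dyz
            resp′ m≤n my m′<m rz (inj₂ Dxy) = resp ≤-refl mx (s≤s m≤n) (proj₁ my) Dxy

      reachable? : ∀ x → Dec (∃[ n ] Reach A n x)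
      reachable? x with search ≼-af x
      ... | inj₁ r = yes r
      ... | inj₂ refute = no λ (n , r) → let m , mx = minimal n x r in
        refute m (λ { {m′ = m′} _ (_ , none) m′<m ry x≼y → none m′<m (Reach-closed m′ x≼y ry) }) mx

-- Sub-multisets

module _ {A : Set} where

  _⊑_ : List A → List A → Set
  xs ⊑ ys = ∃[ e ] xs ++ e ↭ ys

  ∈⇒↭ : ∀ {x} {xs : List A} → x ∈ xs → ∃[ ys ] x ∷ ys ↭ xs
  ∈⇒↭ {x} x∈xs with us , vs , refl ← ∈-∃++ x∈xs = us ++ vs , ↭-sym (shift x us vs)

  Unique⇒⊑ : ∀ {xs ys : List A} → Unique xs → (∀ {x} → x ∈ xs → x ∈ ys) → xs ⊑ ys
  Unique⇒⊑ {[]} {ys} _ _ = ys , ↭-refl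
  Unique⇒⊑ {x ∷ xs} {ys} (x∉xs ∷ uniq) ⊆ with zs , p ← ∈⇒↭ (⊆ (here refl)) =
    let e , q = Unique⇒⊑ uniq ⊆′ in e , ↭-trans (prep x q) p
    where
    ⊆′ : ∀ {y} → y ∈ xs → y ∈ zs
    ⊆′ y∈xs with ∈-resp-↭ (↭-sym p) (⊆ (there y∈xs))
    ... | here refl = contradiction refl (All.lookup x∉xs y∈xs)
    ... | there y∈zs = y∈zs

  Pointwise-↭ : ∀ {B : Set} {R : A → B → Set} {xs ys zs} → xs ↭ ys → Pointwise R xs zs →
    ∃[ ws ] Pointwise R ys ws × ws ↭ zs
  Pointwise-↭ Perm.refl ps = _ , ps , ↭-refl
  Pointwise-↭ (prep x p) (r ∷ ps) with _ , qs , q ← Pointwise-↭ p ps = _ , r ∷ qs , prep _ q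
  Pointwise-↭ (swap x y p) (r ∷ r′ ∷ ps) with _ , qs , q ← Pointwise-↭ p ps =
    _ , r′ ∷ r ∷ qs , swap _ _ q
  Pointwise-↭ (Perm.trans p p′) ps with _ , qs , q ← Pointwise-↭ p ps
    with _ , qs′ , q′ ← Pointwise-↭ p′ qs = _ , qs′ , ↭-trans q′ q

  picks : List A → List (A × List A)
  picks []       = []
  picks (x ∷ xs) = (x , xs) ∷ map (λ (y , ys) → y , x ∷ ys) (picks xs)

module _ {A : Set} (_≟_ : DecidableEquality A) where

  private
    same : A → A → ℕ
    same a b with a ≟ b
    ... | yes _ = 1
    ... | no  _ = 0

  count : A → List A → ℕ
  count a []       = 0
  count a (x ∷ xs) = same a x + count a xs

  count-↭ : ∀ a {xs ys} → xs ↭ ys → count a xs ≡ count a ys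
  count-↭ a Perm.refl = refl
  count-↭ a (prep x p) = cong (same a x +_) (count-↭ a p)
  count-↭ a (swap {xs} {ys} x y p) = begin
    same a x + (same a y + count a xs) ≡⟨ +-assoc (same a x) _ _ ⟨
    same a x + same a y + count a xs   ≡⟨ cong₂ _+_ (+-comm (same a x) _) (count-↭ a p) ⟩
    same a y + same a x + count a ys   ≡⟨ +-assoc (same a y) _ _ ⟩
    same a y + (same a x + count a ys) ∎
    where open ≡-Reasoning
  count-↭ a (Perm.trans p q) = trans (count-↭ a p) (count-↭ a q)

  count>0⇒∈ : ∀ {a} xs → 1 ≤ count a xs → a ∈ xs
  count>0⇒∈ {a} (x ∷ xs) le with a ≟ x
  ... | yes refl = here refl
  ... | no _     = there (count>0⇒∈ xs le)

  count-here : ∀ x xs → 1 ≤ count x (x ∷ xs)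
  count-here x xs with x ≟ x
  ... | yes _ = s≤s z≤n
  ... | no ¬p = contradiction refl ¬p

  count⇒⊑ : ∀ xs ys → (∀ a → count a xs ≤ count a ys) → xs ⊑ ys
  count⇒⊑ [] ys _ = ys , ↭-refl
  count⇒⊑ (x ∷ xs) ys le with zs , p ← ∈⇒↭ (count>0⇒∈ ys (≤-trans (count-here x xs) (le x))) =
    let e , q = count⇒⊑ xs zs (λ a → +-cancelˡ-≤ (same a x) _ _
                  (≤-trans (le a) (≤-reflexive (sym (count-↭ a p)))))
    in e , ↭-trans (prep x q) p

  -- Dickson's lemma: a multiset over a finite type is a vector of multiplicities, compared
  -- componentwise.
  af-⊑ : Finite A → AF {List A} _⊑_
  af-⊑ fa = af-mono
    (λ {xs} {ys} le → count⇒⊑ xs ys λ a → All.lookup le (Finite.complete fa a))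
    (af-⋂ {R = λ a xs ys → count a xs ≤ count a ys} (Finite.elems fa)
      (λ a → af-comap (count a) af-≤))

-- Classical reasoning under double negation

private variable
  ℓ ℓ′ ℓ″ : Level

¬¬_ : Set ℓ → Set ℓ
¬¬ A = ¬ ¬ A

infix 1 ¬¬_

return : {A : Set ℓ} → A → ¬¬ A
return x k = k x

_>>=_ : {A : Set ℓ} {B : Set ℓ′} → ¬¬ A → (A → ¬¬ B) → ¬¬ B
(m >>= f) k = m λ x → f x k

_<$>_ : {A : Set ℓ} {B : Set ℓ′} → (A → B) → ¬¬ A → ¬¬ B
(f <$> m) k = m (k ∘ f)

classify : (P : Set ℓ″) → ¬¬ Dec P
classify P = ¬¬-excluded-middle

¬¬-Vec : ∀ {n} {A : Set ℓ} {P : Fin n → A → Set ℓ″} → (∀ i → ¬¬ ∃ (P i)) →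
  ¬¬ ∃ λ (v : Vec A n) → ∀ i → P i (lookup v i)
¬¬-Vec {n = zero}  f = return ([] , λ ())
¬¬-Vec {n = suc n} f = do
  x , p₀ ← f zero
  v , ps ← ¬¬-Vec (f ∘ suc)
  return (x ∷ v , λ { zero → p₀ ; (suc i) → ps i })

¬¬-All : {A : Set ℓ} {P : A → Set ℓ″} {xs : List A} → All (λ x → ¬¬ P x) xs → ¬¬ All P xs
¬¬-All []       = return []
¬¬-All (m ∷ ms) = do
  x  ← m
  xs ← ¬¬-All ms
  return (x ∷ xs)

-- The relations of a constraint system are neither decidable nor stable, so a bit can record truth
-- only up to double negation. Bits with equivalent meanings are nevertheless equal as booleans,
-- which is how decidable facts about a model are obtained outright.
Records : Bool → Set ℓ″ → Set ℓ″
Records true  P = ¬¬ P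
Records false P = ¬ P

record? : (P : Set ℓ″) → ¬¬ ∃ λ b → Records b P
record? P = decide <$> classify P
  where
  decide : Dec P → ∃ λ b → Records b P
  decide (yes x) = true , return x
  decide (no ¬x) = false , ¬x

module _ {P : Set ℓ} {Q : Set ℓ′} where

  records-≡ : ∀ {x y} → Records x P → Records y Q → (P → ¬¬ Q) → (Q → ¬¬ P) → x ≡ y
  records-≡ {true}  {true}  _ _ _ _ = refl
  records-≡ {false} {false} _ _ _ _ = refl
  records-≡ {true}  {false} p ¬q f _ = ⊥-elim ((p >>= f) ¬q)
  records-≡ {false} {true}  ¬p q _ g = ⊥-elim ((q >>= g) ¬p)

  records-map : ∀ {x} → Records x P → (P → ¬¬ Q) → (Q → ¬¬ P) → Records x Q
  records-map {true}  p f _ = p >>= f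
  records-map {false} ¬p _ g q = g q ¬p

  records-∧ : ∀ {x y} → Records x P → Records y Q → Records (x ∧ y) (P × Q)
  records-∧ {true}  {true}  p q = do x ← p ; y ← q ; return (x , y)
  records-∧ {true}  {false} _ ¬q (_ , q) = ¬q q
  records-∧ {false} ¬p _ (p , _) = ¬p p

  records-∨ : ∀ {x y} → Records x P → Records y Q → Records (x ∨ y) (P ⊎ Q)
  records-∨ {true}  p _ = inj₁ <$> p
  records-∨ {false} {true} _ q = inj₂ <$> q
  records-∨ {false} {false} ¬p ¬q = [ ¬p , ¬q ]′

  records-does : ∀ {x} → Records x P → (Q? : Dec Q) → (P → ¬¬ Q) → (Q → ¬¬ P) → x ≡ does Q?
  records-does r (yes q) f g = records-≡ r (return q) f g
  records-does r (no ¬q) f g = records-≡ r ¬q f g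

records-¬ : ∀ {x} {P : Set ℓ″} → Records x P → Records (not x) (¬ P)
records-¬ {x = true}  p = p
records-¬ {x = false} ¬p = return ¬p

records⇒true : ∀ {x} {P : Set ℓ″} → Records x P → ¬¬ P → x ≡ true
records⇒true {x = true}  _ _ = refl
records⇒true {x = false} ¬p p = ⊥-elim (p ¬p)

records⇒false : ∀ {x} {P : Set ℓ″} → Records x P → ¬ P → x ≡ false
records⇒false {x = true}  p ¬p = ⊥-elim (p ¬p)
records⇒false {x = false} _ _ = refl

records-true : ∀ {x} {P : Set ℓ″} → Records x P → x ≡ true → ¬¬ P
records-true r refl = r

Cofinal : (ℕ → Set ℓ″) → Set ℓ″
Cofinal A = ∀ n → ¬¬ ∃[ i ] n ≤ i × A i

-- Otherwise every entry has a bound beyond which it no longer applies; the sum of these bounds is a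
-- time at which no entry applies.
infinite-pigeonhole : {C : Set} {A : ℕ → C → Set ℓ″} (cs : List C) →
  (∀ i → ¬¬ Any (A i) cs) → ¬¬ ∃ λ c → Cofinal (λ i → A i c)
infinite-pigeonhole {A = A} cs total none = contra id
  where
  bounded : ∀ cs → ¬¬ ∃[ n ] All (λ c → ∀ i → n ≤ i → ¬ A i c) cs
  bounded [] = return (0 , [])
  bounded (c ∷ cs) = do
    n , below ← bounded cs
    yes (m , none-c) ← classify (∃[ m ] ∀ i → m ≤ i → ¬ A i c)
      where no unbounded → λ _ → none (c , λ m k → unbounded (m , λ i m≤i Aic → k (i , m≤i , Aic)))
    return (n + m ,
      (λ i le → none-c i (m+n≤o⇒n≤o n le)) ∷ All.map (λ f i le → f i (m+n≤o⇒m≤o n le)) below)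
  contra : ¬¬ ⊥
  contra = do
    n , below ← bounded cs
    any ← total n
    let c , c∈cs , Anc = find any
    return (All.lookup below c∈cs n ≤-refl Anc)

-- Linear temporal logic

data LTL (At : Set) : Set where
  atom              : At → LTL At
  neg next prev     : LTL At → LTL At
  and until since   : LTL At → LTL At → LTL At

module _ {At : Set} where

  Sem : (ℕ → At → Set ℓ) → ℕ → LTL At → Set ℓ
  Sem V i (atom a)    = V i a
  Sem V i (neg φ)     = ¬ Sem V i φ
  Sem V i (next φ)    = Sem V (suc i) φ
  Sem V i (prev φ)    = 1 ≤ i × Sem V (i ∸ 1) φ
  Sem V i (and φ ψ)   = Sem V i φ × Sem V i ψ
  Sem V i (until φ ψ) = ∃[ j ] (i ≤ j × Sem V j ψ × (∀ l → i ≤ l → l < j → Sem V l φ))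
  Sem V i (since φ ψ) = ∃[ j ] (j ≤ i × Sem V j ψ × (∀ l → j < l → l ≤ i → Sem V l φ))

  module _ (V : ℕ → At → Set ℓ) (φ ψ : LTL At) where

    until-unfold : ∀ {i} → Sem V i (until φ ψ) → Sem V i ψ ⊎ (Sem V i φ × Sem V (suc i) (until φ ψ))
    until-unfold (j , i≤j , Sψ , Sφ) with m≤n⇒m<n∨m≡n i≤j
    ... | inj₂ refl = inj₁ Sψ
    ... | inj₁ i<j  = inj₂ (Sφ _ ≤-refl i<j , j , i<j , Sψ , λ l i<l → Sφ l (<⇒≤ i<l))

    until-fold : ∀ {i} → Sem V i ψ ⊎ (Sem V i φ × Sem V (suc i) (until φ ψ)) → Sem V i (until φ ψ)
    until-fold (inj₁ Sψ) = _ , ≤-refl , Sψ , λ l i≤l l<i → contradiction i≤l (<⇒≱ l<i)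
    until-fold {i} (inj₂ (Sφi , j , i<j , Sψ , Sφ)) = j , <⇒≤ i<j , Sψ , Sφ′
      where
      Sφ′ : ∀ l → i ≤ l → l < j → Sem V l φ
      Sφ′ l i≤l l<j with m≤n⇒m<n∨m≡n i≤l
      ... | inj₁ i<l  = Sφ l i<l l<j
      ... | inj₂ refl = Sφi

    since-unfold : ∀ {i} → Sem V (suc i) (since φ ψ) → Sem V (suc i) ψ ⊎ (Sem V (suc i) φ × Sem V i (since φ ψ))
    since-unfold (j , j≤1+i , Sψ , Sφ) with m≤n⇒m<n∨m≡n j≤1+i
    ... | inj₂ refl = inj₁ Sψ
    ... | inj₁ j<1+i = inj₂ (Sφ _ j<1+i ≤-refl , j , ≤-pred j<1+i , Sψ , λ l j<l l≤i → Sφ l j<l (m≤n⇒m≤1+n l≤i))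

    since-fold : ∀ {i} → Sem V (suc i) ψ ⊎ (Sem V (suc i) φ × Sem V i (since φ ψ)) → Sem V (suc i) (since φ ψ)
    since-fold (inj₁ Sψ) = _ , ≤-refl , Sψ , λ l i<l l≤i → contradiction i<l (≤⇒≯ l≤i)
    since-fold {i} (inj₂ (Sφi , j , j≤i , Sψ , Sφ)) = j , m≤n⇒m≤1+n j≤i , Sψ , Sφ′
      where
      Sφ′ : ∀ l → j < l → l ≤ suc i → Sem V l φ
      Sφ′ l j<l l≤1+i with m≤n⇒m<n∨m≡n l≤1+i
      ... | inj₁ l<1+i = Sφ l j<l (≤-pred l<1+i)
      ... | inj₂ refl  = Sφi

    since-zero : Sem V 0 (since φ ψ) → Sem V 0 ψ
    since-zero (.0 , z≤n , Sψ , _) = Sψ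

    since-zero⁻ : Sem V 0 ψ → Sem V 0 (since φ ψ)
    since-zero⁻ Sψ = 0 , z≤n , Sψ , λ { (suc l) _ () }

  -- One truth value for every atom and temporal operator of the formula.
  Bits : LTL At → Set
  Bits (atom a)    = Bool
  Bits (neg φ)     = Bits φ
  Bits (next φ)    = Bool × Bits φ
  Bits (prev φ)    = Bool × Bits φ
  Bits (and φ ψ)   = Bits φ × Bits ψ
  Bits (until φ ψ) = Bool × Bits φ × Bits ψ
  Bits (since φ ψ) = Bool × Bits φ × Bits ψ

  val : ∀ φ → Bits φ → Bool
  val (atom a)    b       = b
  val (neg φ)     t       = not (val φ t)
  val (next φ)    (b , _) = b
  val (prev φ)    (b , _) = b
  val (and φ ψ)   (t , u) = val φ t ∧ val ψ u
  val (until φ ψ) (b , _) = b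
  val (since φ ψ) (b , _) = b

  Initial : ∀ φ → Bits φ → Set
  Initial (atom a)    _           = ⊤
  Initial (neg φ)     t           = Initial φ t
  Initial (next φ)    (_ , t)     = Initial φ t
  Initial (prev φ)    (b , t)     = b ≡ false × Initial φ t
  Initial (and φ ψ)   (t , u)     = Initial φ t × Initial ψ u
  Initial (until φ ψ) (_ , t , u) = Initial φ t × Initial ψ u
  Initial (since φ ψ) (b , t , u) = b ≡ val ψ u × Initial φ t × Initial ψ u

  -- The one-step expansion laws: a future operator has its bit determined by the next moment, a
  -- past operator by the preceding one.
  Succ : ∀ φ → Bits φ → Bits φ → Set
  Succ (atom a)    _           _              = ⊤
  Succ (neg φ)     t           t′             = Succ φ t t′
  Succ (next φ)    (b , t)     (_ , t′)       = b ≡ val φ t′ × Succ φ t t′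
  Succ (prev φ)    (_ , t)     (b′ , t′)      = b′ ≡ val φ t × Succ φ t t′
  Succ (and φ ψ)   (t , u)     (t′ , u′)      = Succ φ t t′ × Succ ψ u u′
  Succ (until φ ψ) (b , t , u) (b′ , t′ , u′) = b ≡ (val ψ u ∨ (val φ t ∧ b′)) × Succ φ t t′ × Succ ψ u u′
  Succ (since φ ψ) (b , t , u) (b′ , t′ , u′) = b′ ≡ (val ψ u′ ∨ (val φ t′ ∧ b)) × Succ φ t t′ × Succ ψ u u′

  Atoms : (At → Bool → Set ℓ) → ∀ φ → Bits φ → Set ℓ
  Atoms Q (atom a)    b           = Q a b
  Atoms Q (neg φ)     t           = Atoms Q φ t
  Atoms Q (next φ)    (_ , t)     = Atoms Q φ t
  Atoms Q (prev φ)    (_ , t)     = Atoms Q φ t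
  Atoms Q (and φ ψ)   (t , u)     = Atoms Q φ t × Atoms Q ψ u
  Atoms Q (until φ ψ) (_ , t , u) = Atoms Q φ t × Atoms Q ψ u
  Atoms Q (since φ ψ) (_ , t , u) = Atoms Q φ t × Atoms Q ψ u

  -- The conditions to be met infinitely often: an until that stays true is fulfilled.
  fairness : ∀ φ → List (Bits φ → Bool)
  fairness (atom a)    = []
  fairness (neg φ)     = fairness φ
  fairness (next φ)    = map (_∘ proj₂) (fairness φ)
  fairness (prev φ)    = map (_∘ proj₂) (fairness φ)
  fairness (and φ ψ)   = map (_∘ proj₁) (fairness φ) ++ map (_∘ proj₂) (fairness ψ)
  fairness (until φ ψ) = (λ (b , t , u) → not b ∨ val ψ u) ∷
    map (λ f (b , t , u) → f t) (fairness φ) ++ map (λ f (b , t , u) → f u) (fairness ψ)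
  fairness (since φ ψ) =
    map (λ f (b , t , u) → f t) (fairness φ) ++ map (λ f (b , t , u) → f u) (fairness ψ)

  Bits-finite : ∀ φ → Finite (Bits φ)
  Bits-finite (atom a)    = Bool-finite
  Bits-finite (neg φ)     = Bits-finite φ
  Bits-finite (next φ)    = ×-finite Bool-finite (Bits-finite φ)
  Bits-finite (prev φ)    = ×-finite Bool-finite (Bits-finite φ)
  Bits-finite (and φ ψ)   = ×-finite (Bits-finite φ) (Bits-finite ψ)
  Bits-finite (until φ ψ) = ×-finite Bool-finite (×-finite (Bits-finite φ) (Bits-finite ψ))
  Bits-finite (since φ ψ) = ×-finite Bool-finite (×-finite (Bits-finite φ) (Bits-finite ψ))

  Bits-≟ : ∀ φ → DecidableEquality (Bits φ)
  Bits-≟ (atom a)    = Bool._≟_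
  Bits-≟ (neg φ)     = Bits-≟ φ
  Bits-≟ (next φ)    = ≡-dec Bool._≟_ (Bits-≟ φ)
  Bits-≟ (prev φ)    = ≡-dec Bool._≟_ (Bits-≟ φ)
  Bits-≟ (and φ ψ)   = ≡-dec (Bits-≟ φ) (Bits-≟ ψ)
  Bits-≟ (until φ ψ) = ≡-dec Bool._≟_ (≡-dec (Bits-≟ φ) (Bits-≟ ψ))
  Bits-≟ (since φ ψ) = ≡-dec Bool._≟_ (≡-dec (Bits-≟ φ) (Bits-≟ ψ))

  Initial? : ∀ φ t → Dec (Initial φ t)
  Initial? (atom a)    _           = yes tt
  Initial? (neg φ)     t           = Initial? φ t
  Initial? (next φ)    (_ , t)     = Initial? φ t
  Initial? (prev φ)    (b , t)     = (b Bool.≟ false) ×-dec Initial? φ t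
  Initial? (and φ ψ)   (t , u)     = Initial? φ t ×-dec Initial? ψ u
  Initial? (until φ ψ) (_ , t , u) = Initial? φ t ×-dec Initial? ψ u
  Initial? (since φ ψ) (b , t , u) = (b Bool.≟ val ψ u) ×-dec (Initial? φ t ×-dec Initial? ψ u)

  Succ? : ∀ φ t t′ → Dec (Succ φ t t′)
  Succ? (atom a)    _           _              = yes tt
  Succ? (neg φ)     t           t′             = Succ? φ t t′
  Succ? (next φ)    (b , t)     (_ , t′)       = (b Bool.≟ val φ t′) ×-dec Succ? φ t t′
  Succ? (prev φ)    (_ , t)     (b′ , t′)      = (b′ Bool.≟ val φ t) ×-dec Succ? φ t t′
  Succ? (and φ ψ)   (t , u)     (t′ , u′)      = Succ? φ t t′ ×-dec Succ? ψ u u′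
  Succ? (until φ ψ) (b , t , u) (b′ , t′ , u′) =
    (b Bool.≟ (val ψ u ∨ (val φ t ∧ b′))) ×-dec (Succ? φ t t′ ×-dec Succ? ψ u u′)
  Succ? (since φ ψ) (b , t , u) (b′ , t′ , u′) =
    (b′ Bool.≟ (val ψ u′ ∨ (val φ t′ ∧ b))) ×-dec (Succ? φ t t′ ×-dec Succ? ψ u u′)

  Atoms? : {Q : At → Bool → Set ℓ} → (∀ a b → Dec (Q a b)) → ∀ φ t → Dec (Atoms Q φ t)
  Atoms? Q? (atom a)    b           = Q? a b
  Atoms? Q? (neg φ)     t           = Atoms? Q? φ t
  Atoms? Q? (next φ)    (_ , t)     = Atoms? Q? φ t
  Atoms? Q? (prev φ)    (_ , t)     = Atoms? Q? φ t
  Atoms? Q? (and φ ψ)   (t , u)     = Atoms? Q? φ t ×-dec Atoms? Q? ψ u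
  Atoms? Q? (until φ ψ) (_ , t , u) = Atoms? Q? φ t ×-dec Atoms? Q? ψ u
  Atoms? Q? (since φ ψ) (_ , t , u) = Atoms? Q? φ t ×-dec Atoms? Q? ψ u

  Atoms-map : {Q : At → Bool → Set ℓ} {Q′ : At → Bool → Set ℓ′} →
    (∀ a {b} → Q a b → Q′ a b) → ∀ φ t → Atoms Q φ t → Atoms Q′ φ t
  Atoms-map f (atom a)    _           h       = f a h
  Atoms-map f (neg φ)     t           h       = Atoms-map f φ t h
  Atoms-map f (next φ)    (_ , t)     h       = Atoms-map f φ t h
  Atoms-map f (prev φ)    (_ , t)     h       = Atoms-map f φ t h
  Atoms-map f (and φ ψ)   (t , u)     (h , k) = Atoms-map f φ t h , Atoms-map f ψ u k
  Atoms-map f (until φ ψ) (_ , t , u) (h , k) = Atoms-map f φ t h , Atoms-map f ψ u k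
  Atoms-map f (since φ ψ) (_ , t , u) (h , k) = Atoms-map f φ t h , Atoms-map f ψ u k

reflects-map : {P : Set ℓ} {Q : Set ℓ′} → (P → Q) → (Q → P) → ∀ {b} → Reflects P b → Reflects Q b
reflects-map f g (ofʸ p)  = ofʸ (f p)
reflects-map f g (ofⁿ ¬p) = ofⁿ (¬p ∘ g)

reflects-true : {P : Set ℓ} → ∀ {b} → Reflects P b → b ≡ true → P
reflects-true (ofʸ p) refl = p

reflects⇒true : {P : Set ℓ} → ∀ {b} → Reflects P b → P → b ≡ true
reflects⇒true (ofʸ _)  _ = refl
reflects⇒true (ofⁿ ¬p) p = contradiction p ¬p

module _ {At : Set} where

  FairRun : (φ : LTL At) → (ℕ → Bits φ) → Set
  FairRun φ t = All (λ f → ∀ i → ∃[ j ] i ≤ j × f (t j) ≡ true) (fairness φ)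

module _ {At : Set} (V : ℕ → At → Set ℓ) where

  -- `Initial` and `Succ` settle every operator except until, whose expansion law is also solved by
  -- a bit that stays true forever without fulfilment; `FairRun` excludes that solution.
  truth : ∀ φ (t : ℕ → Bits φ) → Initial φ (t 0) → (∀ i → Succ φ (t i) (t (suc i))) →
    (∀ i → Atoms (λ a b → Reflects (V i a) b) φ (t i)) → FairRun φ t →
    ∀ i → Reflects (Sem V i φ) (val φ (t i))
  truth (atom a) t ini suc′ at fair i = at i
  truth (neg φ) t ini suc′ at fair i = ¬-reflects (truth φ t ini suc′ at fair i)
  truth (next φ) t ini suc′ at fair i rewrite proj₁ (suc′ i) =
    truth φ (proj₂ ∘ t) ini (proj₂ ∘ suc′) at (All.map⁻ fair) (suc i)
  truth (prev φ) t ini suc′ at fair zero rewrite proj₁ ini = ofⁿ λ ()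
  truth (prev φ) t ini suc′ at fair (suc i) rewrite proj₁ (suc′ i) =
    reflects-map (s≤s z≤n ,_) proj₂
      (truth φ (proj₂ ∘ t) (proj₂ ini) (proj₂ ∘ suc′) at (All.map⁻ fair) i)
  truth (and φ ψ) t ini suc′ at fair i =
    truth φ (proj₁ ∘ t) (proj₁ ini) (proj₁ ∘ suc′) (proj₁ ∘ at) (All.map⁻ (All.++⁻ˡ _ fair)) i
    ×-reflects
    truth ψ (proj₂ ∘ t) (proj₂ ini) (proj₂ ∘ suc′) (proj₂ ∘ at) (All.map⁻ (All.++⁻ʳ _ fair)) i
  truth (since φ ψ) t ini suc′ at fair = go
    where
    rφ = truth φ (proj₁ ∘ proj₂ ∘ t) (proj₁ (proj₂ ini)) (proj₁ ∘ proj₂ ∘ suc′) (proj₁ ∘ at) (All.map⁻ (All.++⁻ˡ _ fair))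
    rψ = truth ψ (proj₂ ∘ proj₂ ∘ t) (proj₂ (proj₂ ini)) (proj₂ ∘ proj₂ ∘ suc′) (proj₂ ∘ at) (All.map⁻ (All.++⁻ʳ _ fair))
    go : ∀ i → Reflects (Sem V i (since φ ψ)) (proj₁ (t i))
    go zero    rewrite proj₁ ini = reflects-map (since-zero⁻ V φ ψ) (since-zero V φ ψ) (rψ 0)
    go (suc i) rewrite proj₁ (suc′ i) =
      reflects-map (since-fold V φ ψ) (since-unfold V φ ψ) (rψ (suc i) ⊎-reflects (rφ (suc i) ×-reflects go i))
  truth (until φ ψ) t ini suc′ at (fair₀ ∷ fair) = go
    where
    rφ = truth φ (proj₁ ∘ proj₂ ∘ t) (proj₁ ini) (proj₁ ∘ proj₂ ∘ suc′) (proj₁ ∘ at) (All.map⁻ (All.++⁻ˡ _ fair))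
    rψ = truth ψ (proj₂ ∘ proj₂ ∘ t) (proj₂ ini) (proj₂ ∘ proj₂ ∘ suc′) (proj₂ ∘ at) (All.map⁻ (All.++⁻ʳ _ fair))
    Fair : ℕ → Set
    Fair j = (not (proj₁ (t j)) ∨ val ψ (proj₂ (proj₂ (t j)))) ≡ true
    -- Here `d` is the distance to a fair moment. A true bit is passed on until `ψ` holds, which
    -- happens at that moment at the latest.
    fulfilled : ∀ d i → Fair (d + i) → proj₁ (t i) ≡ true → Sem V i (until φ ψ)
    fulfilled zero i f b rewrite b = (until-fold V φ ψ) (inj₁ (reflects-true (rψ i) f))
    fulfilled (suc d) i f b with trans (sym (proj₁ (suc′ i))) b
    ... | b′ with val ψ (proj₂ (proj₂ (t i))) in eqψ | val φ (proj₁ (proj₂ (t i))) in eqφ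
    ... | true  | _    = (until-fold V φ ψ) (inj₁ (reflects-true (rψ i) eqψ))
    ... | false | true = (until-fold V φ ψ) (inj₂ (reflects-true (rφ i) eqφ ,
      fulfilled d (suc i) (subst Fair (sym (+-suc d i)) f) b′))
    -- A false bit is passed on as long as `φ` holds, so it would still be false where `ψ` holds.
    refuted : ∀ d i → proj₁ (t i) ≡ false → Sem V (d + i) ψ →
      (∀ l → i ≤ l → l < d + i → Sem V l φ) → ⊥
    refuted d i b Sψ Sφ with trans (sym (proj₁ (suc′ i))) b
    ... | b′ with val ψ (proj₂ (proj₂ (t i))) in eqψ | val φ (proj₁ (proj₂ (t i))) in eqφ
    refuted zero i b Sψ Sφ | b′ | false | _ with () ← trans (sym eqψ) (reflects⇒true (rψ i) Sψ)
    refuted (suc d) i b Sψ Sφ | b′ | false | true =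
      refuted d (suc i) b′ (subst (λ j → Sem V j ψ) (sym (+-suc d i)) Sψ)
        (λ l i<l l< → Sφ l (<⇒≤ i<l) (subst (l <_) (+-suc d i) l<))
    refuted (suc d) i b Sψ Sφ | b′ | false | false
      with () ← trans (sym eqφ) (reflects⇒true (rφ i) (Sφ i ≤-refl (s≤s (m≤n+m i d))))
    go : ∀ i → Reflects (Sem V i (until φ ψ)) (proj₁ (t i))
    go i with proj₁ (t i) in b
    ... | true with j , i≤j , f ← fair₀ i =
      ofʸ (fulfilled (j ∸ i) i (subst Fair (sym (m∸n+n≡m i≤j)) f) b)
    ... | false = ofⁿ λ (j , i≤j , Sψ , Sφ) →
      refuted (j ∸ i) i b (subst (λ j → Sem V j ψ) (sym (m∸n+n≡m i≤j)) Sψ)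
        (λ l i≤l l< → Sφ l i≤l (subst (l <_) (m∸n+n≡m i≤j) l<))

  Truth : ℕ → ∀ φ → Bits φ → Set ℓ
  Truth i (atom a)            b           = Records b (V i a)
  Truth i (neg φ)             t           = Truth i φ t
  Truth i ξ@(next φ)    (b , t)     = Records b (Sem V i ξ) × Truth i φ t
  Truth i ξ@(prev φ)    (b , t)     = Records b (Sem V i ξ) × Truth i φ t
  Truth i (and φ ψ)           (t , u)     = Truth i φ t × Truth i ψ u
  Truth i ξ@(until φ ψ) (b , t , u) = Records b (Sem V i ξ) × Truth i φ t × Truth i ψ u
  Truth i ξ@(since φ ψ) (b , t , u) = Records b (Sem V i ξ) × Truth i φ t × Truth i ψ u

  Truth-val : ∀ {i} φ t → Truth i φ t → Records (val φ t) (Sem V i φ)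
  Truth-val (atom a)    t h       = h
  Truth-val (neg φ)     t h       = records-¬ (Truth-val φ t h)
  Truth-val (next φ)    t (h , _) = h
  Truth-val (prev φ)    t (h , _) = h
  Truth-val (and φ ψ)   (t , u) (h , k) = records-∧ (Truth-val φ t h) (Truth-val ψ u k)
  Truth-val (until φ ψ) t (h , _) = h
  Truth-val (since φ ψ) t (h , _) = h

  Truth-Atoms : ∀ {i} φ t → Truth i φ t → Atoms (λ a b → Records b (V i a)) φ t
  Truth-Atoms (atom a)    t h                     = h
  Truth-Atoms (neg φ)     t h                     = Truth-Atoms φ t h
  Truth-Atoms (next φ)    (_ , t) (_ , h)         = Truth-Atoms φ t h
  Truth-Atoms (prev φ)    (_ , t) (_ , h)         = Truth-Atoms φ t h
  Truth-Atoms (and φ ψ)   (t , u) (h , k)         = Truth-Atoms φ t h , Truth-Atoms ψ u k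
  Truth-Atoms (until φ ψ) (_ , t , u) (_ , h , k) = Truth-Atoms φ t h , Truth-Atoms ψ u k
  Truth-Atoms (since φ ψ) (_ , t , u) (_ , h , k) = Truth-Atoms φ t h , Truth-Atoms ψ u k

  Truth-exists : ∀ i φ → ¬¬ ∃ (Truth i φ)
  Truth-exists i (atom a) = record? (V i a)
  Truth-exists i (neg φ)  = Truth-exists i φ
  Truth-exists i ξ@(next φ) = do
    b , r ← record? (Sem V i ξ)
    t , h ← Truth-exists i φ
    return ((b , t) , r , h)
  Truth-exists i ξ@(prev φ) = do
    b , r ← record? (Sem V i ξ)
    t , h ← Truth-exists i φ
    return ((b , t) , r , h)
  Truth-exists i (and φ ψ) = do
    t , h ← Truth-exists i φ
    u , k ← Truth-exists i ψ
    return ((t , u) , h , k)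
  Truth-exists i ξ@(until φ ψ) = do
    b , r ← record? (Sem V i ξ)
    t , h ← Truth-exists i φ
    u , k ← Truth-exists i ψ
    return ((b , t , u) , r , h , k)
  Truth-exists i ξ@(since φ ψ) = do
    b , r ← record? (Sem V i ξ)
    t , h ← Truth-exists i φ
    u , k ← Truth-exists i ψ
    return ((b , t , u) , r , h , k)

  Truth-Initial : ∀ φ t → Truth 0 φ t → Initial φ t
  Truth-Initial (atom a)    t h                     = tt
  Truth-Initial (neg φ)     t h                     = Truth-Initial φ t h
  Truth-Initial (next φ)    (_ , t) (_ , h)         = Truth-Initial φ t h
  Truth-Initial (prev φ)    (_ , t) (r , h)         = records⇒false r (λ ()) , Truth-Initial φ t h
  Truth-Initial (and φ ψ)   (t , u) (h , k)         = Truth-Initial φ t h , Truth-Initial ψ u k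
  Truth-Initial (until φ ψ) (_ , t , u) (_ , h , k) = Truth-Initial φ t h , Truth-Initial ψ u k
  Truth-Initial (since φ ψ) (_ , t , u) (r , h , k) =
    records-≡ r (Truth-val ψ u k) (return ∘ (since-zero V φ ψ)) (return ∘ (since-zero⁻ V φ ψ)) ,
    Truth-Initial φ t h , Truth-Initial ψ u k

  Truth-Succ : ∀ {i} φ t t′ → Truth i φ t → Truth (suc i) φ t′ → Succ φ t t′
  Truth-Succ (atom a) t t′ h h′ = tt
  Truth-Succ (neg φ)  t t′ h h′ = Truth-Succ φ t t′ h h′
  Truth-Succ (next φ) (_ , t) (_ , t′) (r , h) (_ , h′) =
    records-≡ r (Truth-val φ t′ h′) return return , Truth-Succ φ t t′ h h′
  Truth-Succ (prev φ) (_ , t) (_ , t′) (_ , h) (r , h′) =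
    records-≡ r (Truth-val φ t h) (return ∘ proj₂) (λ s → return (s≤s z≤n , s)) , Truth-Succ φ t t′ h h′
  Truth-Succ (and φ ψ) (t , u) (t′ , u′) (h , k) (h′ , k′) =
    Truth-Succ φ t t′ h h′ , Truth-Succ ψ u u′ k k′
  Truth-Succ (until φ ψ) (_ , t , u) (_ , t′ , u′) (r , h , k) (r′ , h′ , k′) =
    records-≡ r (records-∨ (Truth-val ψ u k) (records-∧ (Truth-val φ t h) r′))
      (return ∘ (until-unfold V φ ψ)) (return ∘ (until-fold V φ ψ)) ,
    Truth-Succ φ t t′ h h′ , Truth-Succ ψ u u′ k k′
  Truth-Succ (since φ ψ) (_ , t , u) (_ , t′ , u′) (r , h , k) (r′ , h′ , k′) =
    records-≡ r′ (records-∨ (Truth-val ψ u′ k′) (records-∧ (Truth-val φ t′ h′) r))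
      (return ∘ (since-unfold V φ ψ)) (return ∘ (since-fold V φ ψ)) ,
    Truth-Succ φ t t′ h h′ , Truth-Succ ψ u u′ k k′

  -- If an until holds at `i`, the moment that fulfils it is fair; if not, `i` itself is fair, since
  -- the bit is false there. Conditions of subformulas are merely pulled back along projections.
  Truth-fair : ∀ φ → All (λ f → Cofinal λ j → ∀ t → Truth j φ t → f t ≡ true) (fairness φ)
  Truth-fair (atom a)  = []
  Truth-fair (neg φ)   = Truth-fair φ
  Truth-fair (next φ)  = All.map⁺ (All.map (λ fair i → (λ (j , i≤j , h) → j , i≤j , λ (_ , t) (_ , k) → h t k) <$> fair i) (Truth-fair φ))
  Truth-fair (prev φ)  = All.map⁺ (All.map (λ fair i → (λ (j , i≤j , h) → j , i≤j , λ (_ , t) (_ , k) → h t k) <$> fair i) (Truth-fair φ))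
  Truth-fair (and φ ψ) = All.++⁺
    (All.map⁺ (All.map (λ fair i → (λ (j , i≤j , h) → j , i≤j , λ (t , _) (k , _) → h t k) <$> fair i) (Truth-fair φ)))
    (All.map⁺ (All.map (λ fair i → (λ (j , i≤j , h) → j , i≤j , λ (_ , t) (_ , k) → h t k) <$> fair i) (Truth-fair ψ)))
  Truth-fair (since φ ψ) = All.++⁺
    (All.map⁺ (All.map (λ fair i → (λ (j , i≤j , h) → j , i≤j , λ (_ , t , _) (_ , k , _) → h t k) <$> fair i) (Truth-fair φ)))
    (All.map⁺ (All.map (λ fair i → (λ (j , i≤j , h) → j , i≤j , λ (_ , _ , t) (_ , _ , k) → h t k) <$> fair i) (Truth-fair ψ)))
  Truth-fair ξ@(until φ ψ) = fulfilled ∷ All.++⁺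
    (All.map⁺ (All.map (λ fair i → (λ (j , i≤j , h) → j , i≤j , λ (_ , t , _) (_ , k , _) → h t k) <$> fair i) (Truth-fair φ)))
    (All.map⁺ (All.map (λ fair i → (λ (j , i≤j , h) → j , i≤j , λ (_ , _ , t) (_ , _ , k) → h t k) <$> fair i) (Truth-fair ψ)))
    where
    fulfilled : Cofinal λ j → ∀ t → Truth j ξ t → (not (proj₁ t) ∨ val ψ (proj₂ (proj₂ t))) ≡ true
    fulfilled i = do
      yes (j , i≤j , Sψ , _) ← classify (Sem V i ξ)
        where no ¬S → return (i , ≤-refl , λ (b , t , u) (r , _) →
                cong (λ c → not c ∨ val ψ u) (records⇒false r ¬S))
      return (j , i≤j , λ (b , t , u) (_ , _ , k) →
        trans (cong (not b ∨_) (records⇒true (Truth-val ψ u k) (return Sψ))) (Bool.∨-zeroʳ (not b)))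

-- Local variables: order types of windows

module Windows (l k : ℕ) where

  size : ℕ
  size = suc l * suc k

  Position : Set
  Position = Fin size

  pos : Fin (suc l) → Fin (suc k) → Position
  pos = combine

  OrderType : Set
  OrderType = Vec (Vec Bool size) size

  lt : OrderType → Position → Position → Bool
  lt M p q = lookup (lookup M p) q

  -- The strict part of a total preorder. Equality of values is not stored: it is incomparability,
  -- which `lt-cotrans` makes transitive and which `connected` turns into `≈`.
  record StrictWeak (M : OrderType) : Set where
    constructor strictWeak
    field
      lt-irrefl  : ∀ p → lt M p p ≡ false
      lt-trans   : ∀ p q r → lt M p q ≡ true → lt M q r ≡ true → lt M p r ≡ true
      lt-cotrans : ∀ p q r → lt M p r ≡ true → lt M p q ≡ true ⊎ lt M q r ≡ true

  open StrictWeak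

  StrictWeak? : ∀ M → Dec (StrictWeak M)
  StrictWeak? M with
    all? (λ p → lt M p p Bool.≟ false)
    | all? (λ p → all? λ q → all? λ r → (lt M p q Bool.≟ true) →-dec ((lt M q r Bool.≟ true) →-dec (lt M p r Bool.≟ true)))
    | all? (λ p → all? λ q → all? λ r → (lt M p r Bool.≟ true) →-dec ((lt M p q Bool.≟ true) ⊎-dec (lt M q r Bool.≟ true)))
  ... | no ¬p | _ | _ = no (¬p ∘ lt-irrefl)
  ... | yes _ | no ¬p | _ = no (¬p ∘ lt-trans)
  ... | yes _ | yes _ | no ¬p = no (¬p ∘ lt-cotrans)
  ... | yes p | yes q | yes r = yes (strictWeak p q r)

  Shift : OrderType → OrderType → Set
  Shift M M′ = ∀ x y (j j′ : Fin k) →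
    lt M′ (pos x (inject₁ j)) (pos y (inject₁ j′)) ≡ lt M (pos x (suc j)) (pos y (suc j′))

  Shift? : ∀ M M′ → Dec (Shift M M′)
  Shift? M M′ = all? λ x → all? λ y → all? λ j → all? λ j′ → _ Bool.≟ _

maximal : ∀ {n} (_<ᵇ_ : Fin n → Fin n → Bool) → (∀ p → (p <ᵇ p) ≡ false) →
  (∀ p q r → (p <ᵇ q) ≡ true → (q <ᵇ r) ≡ true → (p <ᵇ r) ≡ true) →
  ∀ p ps → ∃[ m ] m ∈ p ∷ ps × (∀ {q} → q ∈ p ∷ ps → (m <ᵇ q) ≡ false)
maximal _<ᵇ_ irr tr p [] = p , here refl , λ { (here refl) → irr p }
maximal _<ᵇ_ irr tr p (p′ ∷ ps) with m , m∈ , max ← maximal _<ᵇ_ irr tr p′ ps with m <ᵇ p in eq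
... | false = m , there m∈ , λ { (here refl) → eq ; (there q∈) → max q∈ }
... | true = p , here refl , λ where
  (here refl) → irr p
  (there {x = _} {xs = _} q∈) → Bool.¬-not λ p<q →
    contradiction (trans (sym (tr m p _ eq p<q)) (max q∈)) λ ()

window-index : ∀ {i t k} → i < t → ¬ (i + k < t) → ∃[ j ] i + suc (toℕ {k} j) ≡ t
window-index {i} {t} {k} i<t near = fromℕ< lt ,
  trans (cong (λ n → i + suc n) (toℕ-fromℕ< lt)) shape
  where
  shape : i + suc (t ∸ suc i) ≡ t
  shape = trans (+-suc i _) (trans (+-comm (suc i) (t ∸ suc i)) (m∸n+n≡m i<t))
  lt : t ∸ suc i < k
  lt = +-cancelˡ-≤ i _ _ (≤-trans (≤-reflexive shape) (≮⇒≥ near))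

-- the successor of j, except that the last index is kept
next-index : ∀ {k} → Fin (suc k) → Fin (suc k)
next-index {zero}  zero    = zero
next-index {suc k} zero    = suc zero
next-index {suc k} (suc j) = suc (next-index j)

next-index-inject₁ : ∀ {k} (j : Fin k) → next-index (inject₁ j) ≡ suc j
next-index-inject₁ {suc k} zero = refl
next-index-inject₁ {suc (suc k)} (suc j) = cong suc (next-index-inject₁ j)

-- Realising and recording order types in a constraint system

module LocalModel {a ℓ : Level} (𝒟 : ConstraintSystem a ℓ) (d₀ : ConstraintSystem.Carrier 𝒟)
  (sto : IsStrictlyTotallyOrdered 𝒟) (dense : IsDense 𝒟) (isOpen : IsOpen 𝒟) (l k : ℕ) where
  open ConstraintSystem 𝒟 renaming (Carrier to D)
  open IsStrictlyTotallyOrdered sto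
  open IsStrictPartialOrder isStrictPartialOrder
    using (module Eq; <-respˡ-≈; <-respʳ-≈) renaming (trans to ≺-trans; irrefl to ≺-irrefl)
  open Windows l k

  module Extension {M : OrderType} (sw : StrictWeak M) where
    open StrictWeak sw

    equal : Position → Position → Set
    equal p q = lt M p q ≡ false × lt M q p ≡ false

    Compatible : List Position → (Position → D) → Set ℓ
    Compatible ps g = ∀ {p q} → p ∈ ps → q ∈ ps →
      (lt M p q ≡ true → g p ≺ g q) × (equal p q → g p ≈ g q)

    Fits : List Position → (Position → D) → Position → D → Set ℓ
    Fits ps g p d = ∀ {q} → q ∈ ps →
      (lt M q p ≡ true → g q ≺ d) × (lt M p q ≡ true → d ≺ g q) × (equal p q → d ≈ g q)

    equal-trans : ∀ {p q r} → equal p q → equal q r → lt M p r ≡ false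
    equal-trans {p} {q} {r} (pq , _) (qr , _) = Bool.¬-not λ pr →
      [ (λ t → contradiction (trans (sym t) pq) λ ()) , (λ t → contradiction (trans (sym t) qr) λ ()) ]′
      (lt-cotrans p q r pr)

    lt-equal : ∀ {p q r} → lt M p q ≡ true → equal q r → lt M p r ≡ true
    lt-equal {p} {q} {r} pq (_ , rq) with lt-cotrans p r q pq
    ... | inj₁ t = t
    ... | inj₂ t = contradiction (trans (sym t) rq) λ ()

    equal-lt : ∀ {p q r} → equal p q → lt M q r ≡ true → lt M p r ≡ true
    equal-lt {p} {q} {r} (_ , qp) qr with lt-cotrans q p r qr
    ... | inj₂ t = t
    ... | inj₁ t = contradiction (trans (sym t) qp) λ ()

    module _ {ps : List Position} {g : Position → D} (compat : Compatible ps g) (p : Position) where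

      lows highs : List Position
      lows  = filter (λ q → lt M q p Bool.≟ true) ps
      highs = filter (λ q → lt M p q Bool.≟ true) ps

      Above Below : D → Set ℓ
      Above d = ∀ {q} → q ∈ lows → g q ≺ d
      Below d = ∀ {q} → q ∈ highs → d ≺ g q

      above : ∀ {m d} → m ∈ lows → (∀ {q} → q ∈ lows → lt M m q ≡ false) → g m ≺ d → Above d
      above {m} m∈ max m≺d {q} q∈ with ∈-filter⁻ (λ q → lt M q p Bool.≟ true) {xs = ps} m∈
                                     | ∈-filter⁻ (λ q → lt M q p Bool.≟ true) {xs = ps} q∈ | lt M q m in eq
      ... | m∈ps , _ | q∈ps , _ | true = ≺-trans (proj₁ (compat q∈ps m∈ps) eq) m≺d
      ... | m∈ps , _ | q∈ps , _ | false =
        <-respˡ-≈ (proj₂ (compat m∈ps q∈ps) (max q∈ , eq)) m≺d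

      below : ∀ {m d} → m ∈ highs → (∀ {q} → q ∈ highs → lt M q m ≡ false) → d ≺ g m → Below d
      below {m} m∈ min d≺m {q} q∈ with ∈-filter⁻ (λ q → lt M p q Bool.≟ true) {xs = ps} m∈
                                     | ∈-filter⁻ (λ q → lt M p q Bool.≟ true) {xs = ps} q∈ | lt M m q in eq
      ... | m∈ps , _ | q∈ps , _ | true = ≺-trans d≺m (proj₁ (compat m∈ps q∈ps) eq)
      ... | m∈ps , _ | q∈ps , _ | false =
        <-respʳ-≈ (proj₂ (compat m∈ps q∈ps) (eq , min q∈)) d≺m

      -- Values on both sides call for density, applied to the largest low and the smallest high
      -- value; values on one side call for openness. The two lists come with equations so that
      -- matching on them leaves the filters `lows` and `highs` in the conclusion.
      between : ∀ ls hs → lows ≡ ls → highs ≡ hs → ∃[ d ] Above d × Below d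
      between [] [] eqˡ eqʰ = d₀ , (λ q∈ → contradiction (subst (_ ∈_) eqˡ q∈) λ ()) , (λ q∈ → contradiction (subst (_ ∈_) eqʰ q∈) λ ())
      between (u ∷ us) [] eqˡ eqʰ with m , m∈ , max ← maximal (lt M) lt-irrefl lt-trans u us
        with _ , d , _ , m≺d ← isOpen (g m) =
        d , above (subst (m ∈_) (sym eqˡ) m∈) (λ q∈ → max (subst (_ ∈_) eqˡ q∈)) m≺d ,
        λ q∈ → contradiction (subst (_ ∈_) eqʰ q∈) λ ()
      between [] (v ∷ vs) eqˡ eqʰ with m , m∈ , min ← maximal (λ p q → lt M q p) lt-irrefl (λ p q r s t → lt-trans r q p t s) v vs
        with d , _ , d≺m , _ ← isOpen (g m) =
        d , (λ q∈ → contradiction (subst (_ ∈_) eqˡ q∈) λ ()) ,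
        below (subst (m ∈_) (sym eqʰ) m∈) (λ q∈ → min (subst (_ ∈_) eqʰ q∈)) d≺m
      between (u ∷ us) (v ∷ vs) eqˡ eqʰ with m , m∈ , max ← maximal (lt M) lt-irrefl lt-trans u us
        with n , n∈ , min ← maximal (λ p q → lt M q p) lt-irrefl (λ p q r s t → lt-trans r q p t s) v vs
        with m∈ps , m<p ← ∈-filter⁻ (λ q → lt M q p Bool.≟ true) {xs = ps} (subst (m ∈_) (sym eqˡ) m∈)
        with n∈ps , p<n ← ∈-filter⁻ (λ q → lt M p q Bool.≟ true) {xs = ps} (subst (n ∈_) (sym eqʰ) n∈)
        with d , m≺d , d≺n ← dense (proj₁ (compat m∈ps n∈ps) (lt-trans m p n m<p p<n)) =
        d , above (subst (m ∈_) (sym eqˡ) m∈) (λ q∈ → max (subst (_ ∈_) eqˡ q∈)) m≺d ,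
        below (subst (n ∈_) (sym eqʰ) n∈) (λ q∈ → min (subst (_ ∈_) eqʰ q∈)) d≺n

      -- A position tied with an old one has to copy its value; any other lies strictly between its
      -- low and its high neighbours.
      fit : ∃ (Fits ps g p)
      fit with Any.any? (λ q → (lt M p q Bool.≟ false) ×-dec (lt M q p Bool.≟ false)) ps
      ... | yes any with r , r∈ , eq@(pr , rp) ← find any = g r , λ {q} q∈ →
          (λ q<p → proj₁ (compat q∈ r∈) (lt-equal q<p eq)) ,
          (λ p<q → proj₁ (compat r∈ q∈) (equal-lt (rp , pr) p<q)) ,
          (λ e@(pq , qp) → proj₂ (compat r∈ q∈) (equal-trans (rp , pr) e , equal-trans (qp , pq) eq))
      ... | no none with d , ab , be ← between lows highs refl refl = d , λ {q} q∈ →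
          (λ q<p → ab (∈-filter⁺ (λ q → lt M q p Bool.≟ true) q∈ q<p)) ,
          (λ p<q → be (∈-filter⁺ (λ q → lt M p q Bool.≟ true) q∈ p<q)) ,
          (λ e → contradiction (lose q∈ e) none)

    extend : ∀ {ps g} p → Compatible ps g →
      ∃[ g′ ] (∀ {q} → q ∈ ps → g′ q ≡ g q) × Compatible (p ∷ ps) g′
    extend {ps} {g} p compat with Any.any? (p Fin.≟_) ps
    ... | yes p∈ = g , (λ _ → refl) , λ q∈ r∈ → compat (tidy q∈) (tidy r∈)
      where
      tidy : ∀ {q} → q ∈ p ∷ ps → q ∈ ps
      tidy (here refl) = p∈
      tidy (there q∈)  = q∈
    ... | no p∉ with d , fits ← fit compat p = g′ , old , compat′
      where
      g′ : Position → D
      g′ q with q Fin.≟ p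
      ... | yes _ = d
      ... | no  _ = g q
      old : ∀ {q} → q ∈ ps → g′ q ≡ g q
      old {q} q∈ with q Fin.≟ p
      ... | yes refl = contradiction q∈ p∉
      ... | no _ = refl
      new : g′ p ≡ d
      new with p Fin.≟ p
      ... | yes _ = refl
      ... | no ¬p = contradiction refl ¬p
      compat′ : Compatible (p ∷ ps) g′
      compat′ (here refl) (here refl) =
        (λ t → contradiction (trans (sym t) (lt-irrefl p)) λ ()) , λ _ → Eq.refl
      compat′ (here refl) (there q∈) rewrite new | old q∈ = proj₂ (fits q∈)
      compat′ (there q∈) (here refl) rewrite new | old q∈ =
        proj₁ (fits q∈) , λ (qp , pq) → Eq.sym (proj₂ (proj₂ (fits q∈)) (pq , qp))
      compat′ (there q∈) (there r∈) rewrite old q∈ | old r∈ = compat q∈ r∈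

    extend-all : ∀ {ps g} qs → Compatible ps g →
      ∃[ g′ ] (∀ {q} → q ∈ ps → g′ q ≡ g q) × Compatible (qs ++ ps) g′
    extend-all [] compat = _ , (λ _ → refl) , compat
    extend-all (q ∷ qs) compat with g′ , old , compat′ ← extend-all qs compat
                               with g″ , old′ , compat″ ← extend q compat′ =
      g″ , (λ q∈ → trans (old′ (∈-++⁺ʳ qs q∈)) (old q∈)) , compat″

  open Extension using (Compatible; equal; extend-all)

  -- The overlap with the preceding window. These positions have their values already, and only the
  -- last column of the new window remains to be chosen.
  kept : List Position
  kept = cartesianProductWith (λ x j → pos x (inject₁ j)) (allFin (suc l)) (allFin k)

  shifted : (Position → D) → Position → D
  shifted g p = let x , j = remQuot {suc l} (suc k) p in g (pos x (next-index j))

  shifted-inject₁ : ∀ g x j → shifted g (pos x (inject₁ j)) ≡ g (pos x (suc j))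
  shifted-inject₁ g x j = trans
    (cong (λ (x , j) → g (pos x (next-index j))) (remQuot-combine x (inject₁ j)))
    (cong (g ∘ pos x) (next-index-inject₁ j))

  module Realisation (M : ℕ → OrderType) (sw : ∀ i → StrictWeak (M i))
    (shift : ∀ i → Shift (M i) (M (suc i))) where

    Realises : ℕ → (Position → D) → Set ℓ
    Realises i g = ∀ p q → (lt (M i) p q ≡ true → g p ≺ g q) × (equal (sw i) p q → g p ≈ g q)

    kept-compatible : ∀ i g → Realises i g → Compatible (sw (suc i)) kept (shifted g)
    kept-compatible i g real p∈ q∈
      with x , j , _ , _ , refl ← ∈-cartesianProductWith⁻ (λ x j → pos x (inject₁ j)) (allFin (suc l)) (allFin k) p∈
         | y , j′ , _ , _ , refl ← ∈-cartesianProductWith⁻ (λ x j → pos x (inject₁ j)) (allFin (suc l)) (allFin k) q∈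
      rewrite shift i x y j j′ | shift i y x j′ j | shifted-inject₁ g x j | shifted-inject₁ g y j′ =
      real (pos x (suc j)) (pos y (suc j′))

    advance : ∀ i g → Realises i g →
      ∃[ g′ ] Realises (suc i) g′ × (∀ x j → g′ (pos x (inject₁ j)) ≡ g (pos x (suc j)))
    advance i g real with g′ , old , compat ← extend-all (sw (suc i)) (allFin size) (kept-compatible i g real) =
      g′ , (λ p q → compat (∈-++⁺ˡ (∈-allFin p)) (∈-++⁺ˡ (∈-allFin q))) ,
      λ x j → trans (old (∈-cartesianProductWith⁺ (λ x j → pos x (inject₁ j)) (∈-allFin x) (∈-allFin j))) (shifted-inject₁ g x j)

    assignment : ∀ i → ∃ (Realises i)
    assignment zero with g , _ , compat ← extend-all (sw 0) {[]} {λ _ → d₀} (allFin size) (λ ()) =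
      g , λ p q → compat (∈-++⁺ˡ (∈-allFin p)) (∈-++⁺ˡ (∈-allFin q))
    assignment (suc i) = let g , real = assignment i ; g′ , real′ , _ = advance i g real in g′ , real′

    value : ℕ → Fin (suc l) → D
    value i x = proj₁ (assignment i) (pos x zero)

    -- Consecutive assignments agree on the overlap, so an entry at any offset is traced to the
    -- window that begins at its time. The recursion runs on `n` because `inject₁ j` is not
    -- structurally smaller than `suc j`.
    window : ∀ n i x (j : Fin (suc k)) → toℕ j ≡ n → proj₁ (assignment i) (pos x j) ≡ value (i + toℕ j) x
    window _ i x zero _ rewrite +-identityʳ i = refl
    window (suc n) i x (suc j) refl = begin
      proj₁ (assignment i) (pos x (suc j))           ≡⟨ proj₂ (proj₂ (advance i _ (proj₂ (assignment i)))) x j ⟨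
      proj₁ (assignment (suc i)) (pos x (inject₁ j)) ≡⟨ window n (suc i) x (inject₁ j) (toℕ-inject₁ j) ⟩
      value (suc i + toℕ (inject₁ j)) x              ≡⟨ cong (λ m → value m x) (trans (cong (suc i +_) (toℕ-inject₁ j)) (sym (+-suc i _))) ⟩
      value (i + suc (toℕ j)) x                      ∎
      where open ≡-Reasoning

    module _ (i : ℕ) (x y : Fin (suc l)) (j : Fin (suc k)) where

      private
        w : Position → D
        w = proj₁ (assignment i)
        p q : Position
        p = pos x zero
        q = pos y j

      w-≺ : Reflects (w p ≺ w q) (lt (M i) p q)
      w-≺ with lt (M i) p q in pq | lt (M i) q p in qp
      ... | true  | _     = ofʸ (proj₁ (proj₂ (assignment i) p q) pq)
      ... | false | true  = ofⁿ λ p≺q → ≺-irrefl Eq.refl (≺-trans p≺q (proj₁ (proj₂ (assignment i) q p) qp))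
      ... | false | false = ofⁿ (≺-irrefl (proj₂ (proj₂ (assignment i) p q) (pq , qp)))

      value-≺ : Reflects (value i x ≺ value (i + toℕ j) y) (lt (M i) p q)
      value-≺ = subst (λ d → Reflects (w p ≺ d) (lt (M i) p q)) (window _ i y j refl) w-≺

      value-≈ : equal (sw i) p q → value i x ≈ value (i + toℕ j) y
      value-≈ e = subst (w p ≈_) (window _ i y j refl) (proj₂ (proj₂ (assignment i) p q) e)

      value-≈⁻ : value i x ≈ value (i + toℕ j) y → equal (sw i) p q
      value-≈⁻ v≈ = Bool.¬-not (λ t → ≺-irrefl p≈q (proj₁ (proj₂ (assignment i) p q) t)) ,
                    Bool.¬-not (λ t → ≺-irrefl (Eq.sym p≈q) (proj₁ (proj₂ (assignment i) q p) t))
        where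
        p≈q : w p ≈ w q
        p≈q = subst (w p ≈_) (sym (window _ i y j refl)) v≈

  module Abstraction (u : ℕ → Fin (suc l) → D) where

    at : ℕ → Position → D
    at i p = let x , j = remQuot {suc l} (suc k) p in u (i + toℕ j) x

    at-pos : ∀ i x j → at i (pos x j) ≡ u (i + toℕ j) x
    at-pos i x j = cong (λ (x , j) → u (i + toℕ j) x) (remQuot-combine x j)

    IsOrderType : ℕ → OrderType → Set ℓ
    IsOrderType i M = ∀ p q → Records (lt M p q) (at i p ≺ at i q)

    orderType : ∀ i → ¬¬ ∃ (IsOrderType i)
    orderType i = ¬¬-Vec λ p → ¬¬-Vec λ q → record? (at i p ≺ at i q)

    -- Trichotomy, available only in this form: `connected` needs both refutations before it yields
    -- `≈`.
    compare : ∀ x y → ¬¬ (x ≺ y ⊎ x ≈ y ⊎ y ≺ x)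
    compare x y = do
      no x⊀y ← classify (x ≺ y) where yes x≺y → return (inj₁ x≺y)
      no y⊀x ← classify (y ≺ x) where yes y≺x → return (inj₂ (inj₂ y≺x))
      return (inj₂ (inj₁ (connected x⊀y y⊀x)))

    isStrictWeak : ∀ {i M} → IsOrderType i M → StrictWeak M
    isStrictWeak {i} {M} is = strictWeak
      (λ p → records⇒false (is p p) (≺-irrefl Eq.refl))
      (λ p q r pq qr → records⇒true (is p r) do
        p≺q ← records-true (is p q) pq
        q≺r ← records-true (is q r) qr
        return (≺-trans p≺q q≺r))
      cotrans
      where
      cotrans : ∀ p q r → lt M p r ≡ true → lt M p q ≡ true ⊎ lt M q r ≡ true
      cotrans p q r pr with lt M p q in pq | lt M q r in qr | is p q | is q r
      ... | true  | _     | _  | _  = inj₁ refl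
      ... | false | true  | _  | _  = inj₂ refl
      ... | false | false | ¬pq | ¬qr = ⊥-elim (contra id)
        where
        contra : ¬¬ ⊥
        contra = do
          p≺r ← records-true (is p r) pr
          inj₂ c ← compare (at i p) (at i q) where inj₁ p≺q → return (¬pq p≺q)
          return ([ (λ p≈q → ¬qr (<-respˡ-≈ p≈q p≺r)) , (λ q≺p → ¬qr (≺-trans q≺p p≺r)) ]′ c)

    isShift : ∀ {i M M′} → IsOrderType i M → IsOrderType (suc i) M′ → Shift M M′
    isShift {i} is is′ x y j j′ = records-≡
      (is′ (pos x (inject₁ j)) (pos y (inject₁ j′))) (is (pos x (suc j)) (pos y (suc j′)))
      (return ∘ subst₂ _≺_ (same x j) (same y j′))
      (return ∘ subst₂ _≺_ (sym (same x j)) (sym (same y j′)))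
      where
      same : ∀ x j → at (suc i) (pos x (inject₁ j)) ≡ at i (pos x (suc j))
      same x j = trans (at-pos (suc i) x (inject₁ j)) (trans
        (cong (λ n → u n x) (trans (cong (suc i +_) (toℕ-inject₁ j)) (sym (+-suc i _))))
        (sym (at-pos i x (suc j))))

    module _ {i} M (is : IsOrderType i M) (x y : Fin (suc l)) (j : Fin (suc k)) where

      private
        p q : Position
        p = pos x zero
        q = pos y j
        at-p : at i p ≡ u i x
        at-p = trans (at-pos i x zero) (cong (λ n → u n x) (+-identityʳ i))

      records-≺ : Records (lt M p q) (u i x ≺ u (i + toℕ j) y)
      records-≺ = subst₂ (λ d e → Records (lt M p q) (d ≺ e)) at-p (at-pos i y j) (is p q)

      records-≻ : Records (lt M q p) (u (i + toℕ j) y ≺ u i x)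
      records-≻ = subst₂ (λ d e → Records (lt M q p) (d ≺ e)) (at-pos i y j) at-p (is q p)

      ≈⇒equal : u i x ≈ u (i + toℕ j) y → lt M p q ≡ false × lt M q p ≡ false
      ≈⇒equal x≈y = records⇒false records-≺ (≺-irrefl x≈y) , records⇒false records-≻ (≺-irrefl (Eq.sym x≈y))

      equal⇒≈ : lt M p q ≡ false × lt M q p ≡ false → u i x ≈ u (i + toℕ j) y
      equal⇒≈ (pq , qp) = connected
        (λ x≺y → contradiction (trans (sym pq) (records⇒true records-≺ (return x≺y))) λ ())
        (λ y≺x → contradiction (trans (sym qp) (records⇒true records-≻ (return y≺x))) λ ())

data Atom (l r k : ℕ) : Set where
  loc≈ loc< : Fin (suc l) → Fin (suc k) → Fin (suc l) → Atom l r k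
  rem≈      : Fin (suc r) → Fin (suc k) → Fin (suc r) → Atom l r k
  remF      : Fin (suc r) → Fin (suc r) → Atom l r k

-- Remote variables: statuses of values

module Statuses (r k : ℕ) where

  -- At time i, a value is described by the variables carrying it at the times
  -- i, …, i + k, and by the set of those carrying it at some time after i + k.
  Stat : Set
  Stat = Vec (Vec Bool (suc r)) (suc k) × Vec Bool (suc r)

  occ : Stat → Fin (suc k) → Fin (suc r) → Bool
  occ (K , _) j x = lookup (lookup K j) x

  fut : Stat → Fin (suc r) → Bool
  fut (_ , H) y = lookup H y

  top : Fin (suc k)
  top = fromℕ k

  -- When the window moves on, exactly one time leaves the future part and becomes the `top` of the
  -- new window; hence the law for `fut`.
  Next : Stat → Stat → Set
  Next s s′ = (∀ (j : Fin k) x → occ s′ (inject₁ j) x ≡ occ s (suc j) x) ×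
              (∀ y → fut s y ≡ (occ s′ top y ∨ fut s′ y))

  Parked : Stat → Set
  Parked s = ∀ j x → occ s j x ≡ false

  Later : Stat → Fin (suc r) → Set
  Later s y = fut s y ≡ true ⊎ ∃[ j ] occ s (suc j) y ≡ true

  Stat-finite : Finite Stat
  Stat-finite = ×-finite (Vec-finite (Vec-finite Bool-finite _) _) (Vec-finite Bool-finite _)

  _≟ˢ_ : DecidableEquality Stat
  _≟ˢ_ = ≡-dec (Vec.≡-dec (Vec.≡-dec Bool._≟_)) (Vec.≡-dec Bool._≟_)

  Next? : ∀ s s′ → Dec (Next s s′)
  Next? s s′ = all? (λ j → all? λ x → _ Bool.≟ _) ×-dec all? (λ y → _ Bool.≟ _)

  Parked? : ∀ s → Dec (Parked s)
  Parked? s = all? λ j → all? λ x → _ Bool.≟ _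

  Later? : ∀ s y → Dec (Later s y)
  Later? s y = (_ Bool.≟ _) ⊎-dec any? λ j → _ Bool.≟ _

  -- Nothing occurs in the window, and whatever `fut` promises is merely postponed.
  idle : ∀ s → Parked s → Next s s
  idle s parked = (λ j x → trans (parked (inject₁ j) x) (sym (parked (suc j) x))) ,
                λ y → cong (_∨ fut s y) (sym (parked top y))

  bit : Bool → ℕ
  bit true  = 1
  bit false = 0

  cnt : Fin (suc k) → Fin (suc r) → List Stat → ℕ
  cnt j x []      = 0
  cnt j x (s ∷ c) = bit (occ s j x) + cnt j x c

  Valid : List Stat → Set
  Valid c = ∀ j x → cnt j x c ≡ 1

  Valid? : ∀ c → Dec (Valid c)
  Valid? c = all? λ j → all? λ x → _ ≟ _

  module _ (j : Fin (suc k)) (x : Fin (suc r)) where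

    cnt-++ : ∀ c d → cnt j x (c ++ d) ≡ cnt j x c + cnt j x d
    cnt-++ []      d = refl
    cnt-++ (s ∷ c) d = trans (cong (bit (occ s j x) +_) (cnt-++ c d)) (sym (+-assoc (bit (occ s j x)) _ _))

    cnt-↭ : ∀ {c d} → c ↭ d → cnt j x c ≡ cnt j x d
    cnt-↭ Perm.refl = refl
    cnt-↭ (prep s p) = cong (bit (occ s j x) +_) (cnt-↭ p)
    cnt-↭ (swap {c} {d} s u p) = begin
      b s + (b u + cnt j x c) ≡⟨ +-assoc (b s) _ _ ⟨
      b s + b u + cnt j x c   ≡⟨ cong₂ _+_ (+-comm (b s) _) (cnt-↭ p) ⟩
      b u + b s + cnt j x d   ≡⟨ +-assoc (b u) _ _ ⟩
      b u + (b s + cnt j x d) ∎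
      where
      open ≡-Reasoning
      b : Stat → ℕ
      b s = bit (occ s j x)
    cnt-↭ (Perm.trans p q) = trans (cnt-↭ p) (cnt-↭ q)

    cnt-parked : ∀ {c} → All Parked c → cnt j x c ≡ 0
    cnt-parked []       = refl
    cnt-parked (p ∷ ps) = cong₂ _+_ (cong bit (p j x)) (cnt-parked ps)

    cnt≥1 : ∀ {c s} → s ∈ c → occ s j x ≡ true → 1 ≤ cnt j x c
    cnt≥1 (here refl) o rewrite o = s≤s z≤n
    cnt≥1 (there s∈)  o = m≤n⇒m≤o+n _ (cnt≥1 s∈ o)

    cnt≥1⇒∈ : ∀ c → 1 ≤ cnt j x c → ∃[ s ] s ∈ c × occ s j x ≡ true
    cnt≥1⇒∈ (s ∷ c) le with occ s j x in eq
    ... | true  = s , here refl , eq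
    ... | false with u , u∈ , o ← cnt≥1⇒∈ c le = u , there u∈ , o

    cnt≤1⇒lookup-≡ : ∀ c → cnt j x c ≤ 1 → ∀ m n → occ (List.lookup c m) j x ≡ true →
      occ (List.lookup c n) j x ≡ true → m ≡ n
    cnt≤1⇒lookup-≡ (s ∷ c) le zero zero _ _ = refl
    cnt≤1⇒lookup-≡ (s ∷ c) le zero (suc n) o o′ rewrite o =
      contradiction (cnt≥1 {c} (∈-lookup n) o′) (<⇒≱ le)
    cnt≤1⇒lookup-≡ (s ∷ c) le (suc m) zero o o′ rewrite o′ =
      contradiction (cnt≥1 {c} (∈-lookup m) o) (<⇒≱ le)
    cnt≤1⇒lookup-≡ (s ∷ c) le (suc m) (suc n) o o′ =
      cong suc (cnt≤1⇒lookup-≡ c (m+n≤o⇒n≤o (bit (occ s j x)) le) m n o o′)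

  cnt≡0⇒parked : ∀ c → (∀ j x → cnt j x c ≡ 0) → All Parked c
  cnt≡0⇒parked []      _  = []
  cnt≡0⇒parked (s ∷ c) eq =
    (λ j x → bit≡0 (m+n≡0⇒m≡0 _ (eq j x))) ∷
    cnt≡0⇒parked c (λ j x → m+n≡0⇒n≡0 (bit (occ s j x)) (eq j x))
    where
    bit≡0 : ∀ {b} → bit b ≡ 0 → b ≡ false
    bit≡0 {false} _ = refl

  cnt-extras : ∀ {c e d u} → All Parked e → All Parked u → c ++ e ↭ d ++ u → ∀ j x → cnt j x c ≡ cnt j x d
  cnt-extras {c} {e} {d} {u} pe pu p j x = begin
    cnt j x c             ≡⟨ +-identityʳ _ ⟨
    cnt j x c + 0         ≡⟨ cong (cnt j x c +_) (cnt-parked j x pe) ⟨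
    cnt j x c + cnt j x e ≡⟨ cnt-++ j x c e ⟨
    cnt j x (c ++ e)      ≡⟨ cnt-↭ j x p ⟩
    cnt j x (d ++ u)      ≡⟨ cnt-++ j x d u ⟩
    cnt j x d + cnt j x u ≡⟨ cong (cnt j x d +_) (cnt-parked j x pu) ⟩
    cnt j x d + 0         ≡⟨ +-identityʳ _ ⟩
    cnt j x d             ∎
    where open ≡-Reasoning

  -- An occurrence in `e` would be a second one at a position that `c` already fills.
  extras-parked : ∀ {c e d u} → Valid c → Valid d → All Parked u → c ++ e ↭ d ++ u → All Parked e
  extras-parked {c} {e} {d} {u} vc vd pu p = cnt≡0⇒parked e λ j x → +-cancelˡ-≡ 1 _ _ (begin
    1 + cnt j x e         ≡⟨ cong (_+ cnt j x e) (vc j x) ⟨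
    cnt j x c + cnt j x e ≡⟨ cnt-++ j x c e ⟨
    cnt j x (c ++ e)      ≡⟨ cnt-↭ j x p ⟩
    cnt j x (d ++ u)      ≡⟨ cnt-++ j x d u ⟩
    cnt j x d + cnt j x u ≡⟨ cong₂ _+_ (vd j x) (cnt-parked j x pu) ⟩
    1 + 0                 ∎)
    where open ≡-Reasoning

  Entering : Stat → Set
  Entering s = ∃[ x ] occ s top x ≡ true

  -- Choosing a variable carried at `top` is injective on the entries. This is the origin of the
  -- constant `suc r`: at most one entering value for each remote variable.
  entering-length : ∀ c → All Entering c → (∀ x → cnt top x c ≤ 1) → length c ≤ suc r
  entering-length c ent le = injective⇒≤ {f = var} λ {m} {n} eq →
    cnt≤1⇒lookup-≡ top (var m) c (le _) m n (proj₂ (entry m))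
      (subst (λ x → occ (List.lookup c n) top x ≡ true) (sym eq) (proj₂ (entry n)))
    where
    entry : ∀ m → Entering (List.lookup c m)
    entry m = All.lookup ent (∈-lookup m)
    var : Fin (length c) → Fin (suc r)
    var m = proj₁ (entry m)

  parked-next : ∀ {s s′} → Parked s → Next s s′ → ¬ Entering s′ → Parked s′
  parked-next parked (shft , _) ¬ent j x with view j
  ... | ‵fromℕ     = Bool.¬-not λ o → ¬ent (x , o)
  ... | ‵inject₁ j = trans (shft j x) (parked (suc j) x)

  -- Parked values that do not come back can be left out.
  sift : ∀ {e d} → All Parked e → Pointwise Next e d → ∃[ f ] ∃[ d₁ ] ∃[ d₂ ]
    All Parked f × Pointwise Next f d₁ × All Entering d₁ × All Parked d₂ × d₁ ++ d₂ ↭ d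
  sift [] [] = [] , [] , [] , [] , [] , [] , [] , ↭-refl
  sift {s ∷ e} {s′ ∷ d} (p ∷ ps) (n ∷ ns) with f , d₁ , d₂ , pf , nf , ent , pd , perm ← sift ps ns
    with any? (λ x → occ s′ top x Bool.≟ true)
  ... | yes en = s ∷ f , s′ ∷ d₁ , d₂ , p ∷ pf , n ∷ nf , en ∷ ent , pd , prep s′ perm
  ... | no ¬en = f , d₁ , s′ ∷ d₂ , pf , nf , ent , parked-next {s} {s′} p n ¬en ∷ pd ,
    ↭-trans (shift s′ d₁ d₂) (prep s′ perm)

  -- The list `f` holds values not seen so far, described as they are before the step; carrying
  -- nothing in the window, they are parked. In a run taken from a model each of them enters at
  -- `top`, so `suc r` of them suffice, and the bound keeps the branching finite.
  Evolves : List Stat → List Stat → Set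
  Evolves c d = ∃[ f ] length f ≤ suc r × All Parked f × Pointwise Next (c ++ f) d

  Evolves? : ∀ c d → Dec (Evolves c d)
  Evolves? c d = ∃≤? Stat-finite (suc r) proj₁ λ f →
    (length f ≤? suc r) ×-dec (All.all? Parked? f ×-dec Pointwise.decidable Next? (c ++ f) d)

  Evolves-length : ∀ {c d} → Evolves c d → length d ≤ length c + suc r
  Evolves-length {c} (f , le , _ , ns) = ≤-trans
    (≤-reflexive (trans (sym (Pointwise-length ns)) (length-++ c))) (+-monoʳ-≤ (length c) le)

  Pointwise-++⁻ : ∀ c {e w} → Pointwise Next (c ++ e) w →
    ∃[ d ] ∃[ f ] w ≡ d ++ f × Pointwise Next c d × Pointwise Next e f
  Pointwise-++⁻ []      ns       = [] , _ , refl , [] , ns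
  Pointwise-++⁻ (s ∷ c) (n ∷ ns) with d , f , refl , nc , ne ← Pointwise-++⁻ c ns =
    _ ∷ d , f , refl , n ∷ nc , ne

  Pointwise-idle : ∀ {u} → All Parked u → Pointwise Next u u
  Pointwise-idle []       = []
  Pointwise-idle {s ∷ _} (p ∷ ps) = idle s p ∷ Pointwise-idle ps

  reorder : ∀ c d e {f u : List Stat} → c ++ e ↭ d ++ u → (d ++ f) ++ u ↭ c ++ (e ++ f)
  reorder c d e {f} {u} perm = begin
    (d ++ f) ++ u ↭⟨ Perm.++-assoc d f u ⟩
    d ++ (f ++ u) ↭⟨ Perm.++⁺ˡ d (++-comm f u) ⟩
    d ++ (u ++ f) ↭⟨ Perm.++-assoc d u f ⟨
    (d ++ u) ++ f ↭⟨ Perm.++⁺ʳ f perm ⟨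
    (c ++ e) ++ f ↭⟨ Perm.++-assoc c e f ⟩
    c ++ (e ++ f) ∎
    where open PermutationReasoning

  -- Replaying an evolution of d from c, which differs from d by parked values:
  -- those it lacks are replaced by fresh ones, the additional ones stay idle.
  replay : ∀ {s s′ c d d′ e u} → Valid (s ∷ c) → Valid (s ∷ d) → Valid (s′ ∷ d′) → All Parked u →
    c ++ e ↭ d ++ u → Evolves d d′ →
    ∃[ c′ ] ∃[ e′ ] Evolves c c′ × All Parked e′ × c′ ++ e′ ↭ d′ ++ u
  replay {s} {s′} {c} {d} {d′} {e} {u} vc vd vd′ pu perm (f , _ , pf , ns)
    with pe ← extras-parked {s ∷ c} {e} {s ∷ d} {u} vc vd pu (prep s perm)
    with _ , ms , w↭ ← Pointwise-↭ (reorder c d e perm) (Pointwise.++⁺ ns (Pointwise-idle pu))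
    with wc , we , refl , mc , me ← Pointwise-++⁻ c ms
    with f′ , d₁ , d₂ , pf′ , mf′ , ent , pd₂ , perm′ ← sift (All.++⁺ pe pf) me =
    wc ++ d₁ , d₂ ,
    (f′ , ≤-trans (≤-reflexive (Pointwise-length mf′)) (entering-length d₁ ent few) , pf′ , Pointwise.++⁺ mc mf′) ,
    pd₂ , perm″
    where
    perm″ : (wc ++ d₁) ++ d₂ ↭ d′ ++ u
    perm″ = ↭-trans (Perm.++-assoc wc d₁ d₂) (↭-trans (Perm.++⁺ˡ wc perm′) w↭)
    few : ∀ x → cnt top x d₁ ≤ 1
    few x = begin
      cnt top x d₁                          ≤⟨ m≤n+m _ (cnt top x wc) ⟩
      cnt top x wc + cnt top x d₁           ≡⟨ cnt-++ top x wc d₁ ⟨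
      cnt top x (wc ++ d₁)                  ≡⟨ cnt-extras {c = wc ++ d₁} {d₂} {d′} {u} pd₂ pu perm″ top x ⟩
      cnt top x d′                          ≤⟨ m≤n+m _ (bit (occ s′ top x)) ⟩
      cnt top x (s′ ∷ d′)                   ≡⟨ vd′ top x ⟩
      1                                     ∎
      where open ≤-Reasoning

-- The symbolic transition system

module Machine {l r k : ℕ} (φ : LTL (Atom l r k)) where
  open Windows l k
  open Statuses r k

  Holds : OrderType → List Stat → Atom l r k → Set
  Holds M c (loc≈ x j y) = lt M (pos x zero) (pos y j) ≡ false × lt M (pos y j) (pos x zero) ≡ false
  Holds M c (loc< x j y) = lt M (pos x zero) (pos y j) ≡ true
  Holds M c (rem≈ x j y) = Any (λ s → occ s zero x ≡ true × occ s j y ≡ true) c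
  Holds M c (remF x y)   = Any (λ s → occ s zero x ≡ true × Later s y) c

  Holds? : ∀ M c a → Dec (Holds M c a)
  Holds? M c (loc≈ x j y) = (_ Bool.≟ _) ×-dec (_ Bool.≟ _)
  Holds? M c (loc< x j y) = _ Bool.≟ _
  Holds? M c (rem≈ x j y) = Any.any? (λ s → (_ Bool.≟ _) ×-dec (_ Bool.≟ _)) c
  Holds? M c (remF x y)   = Any.any? (λ s → (_ Bool.≟ _) ×-dec Later? s y) c

  -- A remote atom asks for a value that carries `x` now, and a parked value carries nothing; local
  -- atoms do not look at the statuses.
  Holds-extras : ∀ {M c e d u} → All Parked e → All Parked u → c ++ e ↭ d ++ u →
    ∀ a → Holds M c a → Holds M d a
  Holds-extras pe pu perm (loc≈ x j y) h = h
  Holds-extras pe pu perm (loc< x j y) h = h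
  Holds-extras {d = d} pe pu perm (rem≈ x j y) h with Any.++⁻ d (Any-resp-↭ perm (Any.++⁺ˡ h))
  ... | inj₁ h′ = h′
  ... | inj₂ h′ with s , s∈ , o , _ ← find h′ with () ← trans (sym o) (All.lookup pu s∈ zero x)
  Holds-extras {d = d} pe pu perm (remF x y) h with Any.++⁻ d (Any-resp-↭ perm (Any.++⁺ˡ h))
  ... | inj₁ h′ = h′
  ... | inj₂ h′ with s , s∈ , o , _ ← find h′ with () ← trans (sym o) (All.lookup pu s∈ zero x)

  Control : Set
  Control = Bits φ × OrderType

  Control-finite : Finite Control
  Control-finite = ×-finite (Bits-finite φ) (Vec-finite (Vec-finite Bool-finite _) _)

  _≟ᶜ_ : DecidableEquality Control
  _≟ᶜ_ = ≡-dec (Bits-≟ φ) (Vec.≡-dec (Vec.≡-dec Bool._≟_))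

  Ok : Control → List Stat → Set
  Ok (t , M) c = Valid c × StrictWeak M × Atoms (λ a b → b ≡ does (Holds? M c a)) φ t

  Ok? : ∀ q c → Dec (Ok q c)
  Ok? (t , M) c = Valid? c ×-dec (StrictWeak? M ×-dec Atoms? (λ a b → b Bool.≟ does (Holds? M c a)) φ t)

  Ok-extras : ∀ {q c e d u} → All Parked e → All Parked u → c ++ e ↭ d ++ u → Ok q d → Ok q c
  Ok-extras {t , M} {c} {e} {d} {u} pe pu perm (valid , sw , at) =
    (λ j x → trans (cnt-extras pe pu perm j x) (valid j x)) , sw ,
    Atoms-map (λ a eq → trans eq (does-⇔ (mk⇔ (Holds-extras pu pe (↭-sym perm) a) (Holds-extras pe pu perm a))
                                          (Holds? M d a) (Holds? M c a))) φ t at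

  -- The second component is a value singled out to be followed along a run.
  Conf : Set
  Conf = Control × Stat × List Stat

  ControlStep : Control → Control → Set
  ControlStep (t , M) (t′ , M′) = Succ φ t t′ × Shift M M′

  _⟶_ : Conf → Conf → Set
  (q , s , c) ⟶ (q′ , s′ , c′) =
    Ok q (s ∷ c) × Ok q′ (s′ ∷ c′) × ControlStep q q′ × Next s s′ × Evolves c c′

  _⟶?_ : ∀ x y → Dec (x ⟶ y)
  (q , s , c) ⟶? (q′ , s′ , c′) = Ok? q (s ∷ c) ×-dec (Ok? q′ (s′ ∷ c′) ×-dec
    ((Succ? φ _ _ ×-dec Shift? (proj₂ q) (proj₂ q′)) ×-dec (Next? s s′ ×-dec Evolves? c c′)))

  ∃⟶? : ∀ x {P : Conf → Set} → (∀ y → Dec (P y)) → Dec (∃[ y ] x ⟶ y × P y)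
  ∃⟶? x@(q , s , c) {P} P? = map′
    (λ (q′ , s′ , c′ , h) → (q′ , s′ , c′) , h) (λ ((q′ , s′ , c′) , h) → q′ , s′ , c′ , h)
    (∃? Control-finite λ q′ → ∃? Stat-finite λ s′ →
      ∃≤? Stat-finite {P = λ c′ → x ⟶ (q′ , s′ , c′) × P (q′ , s′ , c′)} (length c + suc r)
        (λ ((_ , _ , _ , _ , ev) , _) → Evolves-length {c} ev)
        λ c′ → (x ⟶? (q′ , s′ , c′)) ×-dec P? (q′ , s′ , c′))

  ok? : Conf → Bool
  ok? (q , s , c) = does (Ok? q (s ∷ c))

  -- Inclusion of multisets alone is not enough: dropping a value inside the window destroys
  -- validity, and then no step exists. Comparing one more bit keeps the relation almost full and
  -- forces the difference of two valid configurations to be parked.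
  _≼_ : Conf → Conf → Set
  x@(q , s , c) ≼ y@(q′ , s′ , c′) = (q ≡ q′ × s ≡ s′ × c ⊑ c′) × ok? x ≡ ok? y

  ≼-af : AF _≼_
  ≼-af = af-∩
    (af-∩ (af-comap proj₁ (af-≡ Control-finite _≟ᶜ_))
      (af-∩ (af-comap (proj₁ ∘ proj₂) (af-≡ Stat-finite _≟ˢ_))
        (af-comap (proj₂ ∘ proj₂) (af-⊑ _≟ˢ_ Stat-finite))))
    (af-comap ok? (af-≡ Bool-finite Bool._≟_))

  open Reachability _⟶_ public

  replay-step : ∀ {q s c d e u y} → Ok q (s ∷ c) → All Parked u → c ++ e ↭ d ++ u → (q , s , d) ⟶ y →
    let q′ , s′ , d′ = y in
    ∃[ c′ ] ∃[ e′ ] (q , s , c) ⟶ (q′ , s′ , c′) × All Parked e′ × c′ ++ e′ ↭ d′ ++ u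
  replay-step {s = s} {y = q′ , s′ , d′} okc pu perm (okd , okd′ , cs , ns , ev)
    with c′ , e′ , ev′ , pe′ , perm′ ← replay {s} {s′} (proj₁ okc) (proj₁ okd) (proj₁ okd′) pu perm ev =
    c′ , e′ , (okc , Ok-extras pe′ pu (prep s′ perm′) okd′ , cs , ns , ev′) , pe′ , perm′

  dec-true : ∀ {P Q : Set} (P? : Dec P) (Q? : Dec Q) → does P? ≡ does Q? → Q → P
  dec-true (yes p) _ _ _ = p
  dec-true (no _) (yes _) () _
  dec-true (no _) (no ¬q) _ q = contradiction q ¬q

  simulate : ∀ {x y y′} → x ≼ y → y ⟶ y′ → ∃[ x′ ] x ⟶ x′ × x′ ≼ y′
  simulate {x = q , s , c} {y = _ , _ , d} {y′ = q′ , s′ , d′} ((refl , refl , e , perm) , eq) st@(okd , okd′ , _) =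
    let okc = dec-true (Ok? q (s ∷ c)) (Ok? q (s ∷ d)) eq okd
        c′ , e′ , st′ , _ , perm′ =
          replay-step okc [] (↭-trans perm (↭-reflexive (sym (++-identityʳ d)))) st
        _ , okc′ , _ = st′
    in (q′ , s′ , c′) , st′ , (refl , refl , e′ , ↭-trans perm′ (↭-reflexive (++-identityʳ d′))) ,
       does-⇔ (mk⇔ (const okd′) (const okc′)) (Ok? q′ (s′ ∷ c′)) (Ok? q′ (s′ ∷ d′))

  open Search ∃⟶? _≼_ ≼-af simulate public

  -- A goal speaks of the status of the followed value when the goal is set, of the
  -- current control, and of its current status.
  Goal : Set
  Goal = Stat → Control → Stat → Bool

  fair : (Bits φ → Bool) → Goal
  fair f _ (t , _) _ = f t

  -- A promise concerns times beyond the window, and such a time comes into view at `top`. The goal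
  -- counts as met when no promise was pending.
  see : Fin (suc r) → Goal
  see y s₀ _ s = not (fut s₀ y) ∨ occ s top y

  goals : List Goal
  goals = map fair (fairness φ) ++ map see (allFin (suc r))

  Within : Control → List Stat → Conf → Set
  Within q P (q′ , s , c) = q′ ≡ q × All (_∈ P) (s ∷ c) × Ok q′ (s ∷ c)

  Within? : ∀ q P x → Dec (Within q P x)
  Within? q P (q′ , s , c) =
    (q′ ≟ᶜ q) ×-dec (All.all? (λ s → Any.any? (s ≟ˢ_) P) (s ∷ c) ×-dec Ok? q′ (s ∷ c))

  Within-closed : ∀ q P → Closed (Within q P)
  Within-closed q P {_ , s , c} {_ , _ , d} ((refl , refl , e , perm) , eq) (refl , s∈ ∷ ⊆P , okd) =
    refl , s∈ ∷ All.++⁻ˡ c (All-resp-↭ (↭-sym perm) ⊆P) , dec-true (Ok? q (s ∷ c)) (Ok? q (s ∷ d)) eq okd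

  -- Reachability nested in reachability: the goal has to be met at a place from which the loop can
  -- still be closed. Both layers are closed downwards, so the search applies to each.
  Met : Control → List Stat → Goal → Stat → Conf → Set
  Met q P g s₀ x@(q′ , s , _) = g s₀ q′ s ≡ true × ∃[ n ] Reach (Within q P) n x

  Met? : ∀ q P g s₀ x → Dec (Met q P g s₀ x)
  Met? q P g s₀ x@(q′ , s , _) = (g s₀ q′ s Bool.≟ true) ×-dec reachable? (Within? q P) (Within-closed q P) x

  Met-closed : ∀ q P g s₀ → Closed (Met q P g s₀)
  Met-closed q P g s₀ {_ , s , _} x≼y@((refl , refl , _) , _) (m , n , rch) =
    m , n , Reach-closed (Within? q P) (Within-closed q P) n x≼y rch

  Loop : Control → List Stat → Stat × List Stat → Goal → Set
  Loop q P (s , c) g = ∃[ y ] (q , s , c) ⟶ y × ∃[ n ] Reach (Met q P g s) n y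

  -- The representatives take each entry of `P` once and follow one of them; `Loop-replay` carries
  -- their loops over to the other configurations within `P`.
  Good : Control → List Stat → Set
  Good q P = All (λ pick → All (Loop q P pick) goals) (picks P)

  Good? : ∀ q P → Dec (Good q P)
  Good? q P = All.all? (λ (s , c) → All.all? (λ g →
    ∃⟶? (q , s , c) (reachable? (Met? q P g s) (Met-closed q P g s))) goals) (picks P)

  -- The `P` that arises from a model lists a set of statuses without repetition, so it is no longer
  -- than an enumeration of all statuses. The bound makes the search for `P` finite.
  Target : Conf → Set
  Target x = ∃[ P ] length P ≤ length (Finite.elems Stat-finite) × Within (proj₁ x) P x × Good (proj₁ x) P

  Target? : ∀ x → Dec (Target x)
  Target? x = ∃≤? Stat-finite _ proj₁ λ P → (length P ≤? _) ×-dec (Within? _ P x ×-dec Good? _ P)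

  Target-closed : Closed Target
  Target-closed x≼y@((refl , _) , _) (P , le , within , good) = P , le , Within-closed _ P x≼y within , good

  -- At time 0 only the values of the first window have been seen, and that window has
  -- `suc k * suc r` positions.
  Accepted : Set
  Accepted = ∃[ q ] ∃[ s ] ∃[ c ] length c ≤ suc k * suc r × Initial φ (proj₁ q) × val φ (proj₁ q) ≡ true ×
    ∃[ n ] Reach Target n (q , s , c)

  Accepted? : Dec Accepted
  Accepted? = ∃? Control-finite λ q → ∃? Stat-finite λ s → ∃≤? Stat-finite _ proj₁ λ c →
    (length c ≤? _) ×-dec (Initial? φ (proj₁ q) ×-dec ((val φ (proj₁ q) Bool.≟ true) ×-dec
      reachable? Target? Target-closed (q , s , c)))

-- Numbered values and the queue of promises

upFrom : ℕ → ℕ → List ℕ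
upFrom b zero    = []
upFrom b (suc n) = b ∷ upFrom (suc b) n

length-upFrom : ∀ b n → length (upFrom b n) ≡ n
length-upFrom b zero    = refl
length-upFrom b (suc n) = cong suc (length-upFrom (suc b) n)

upFrom-≥ : ∀ b n → All (b ≤_) (upFrom b n)
upFrom-≥ b zero    = []
upFrom-≥ b (suc n) = ≤-refl ∷ All.map (≤-trans (n≤1+n b)) (upFrom-≥ (suc b) n)

upFrom-< : ∀ b n → All (_< n + b) (upFrom b n)
upFrom-< b zero    = []
upFrom-< b (suc n) = s≤s (m≤n+m b n) ∷ All.map (λ lt → ≤-trans lt (≤-reflexive (+-suc n b))) (upFrom-< (suc b) n)

upFrom-unique : ∀ b n → Unique (upFrom b n)
upFrom-unique b zero    = []
upFrom-unique b (suc n) = All.map <⇒≢ (upFrom-≥ (suc b) n) ∷ upFrom-unique (suc b) n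

module _ {A B : Set} where

  zip-∈ʳ : ∀ {xs : List A} {ys : List B} {y} → length xs ≡ length ys → y ∈ ys → ∃[ x ] (x , y) ∈ zip xs ys
  zip-∈ʳ {x ∷ _} {_ ∷ _} _  (here refl) = x , here refl
  zip-∈ʳ {_ ∷ _} {_ ∷ _} eq (there y∈)  = let x , p = zip-∈ʳ (suc-injective eq) y∈ in x , there p

  zip-∈ˡ : ∀ {xs : List A} {ys : List B} {x} → length xs ≡ length ys → x ∈ xs → ∃[ y ] (x , y) ∈ zip xs ys
  zip-∈ˡ {_ ∷ _} {y ∷ _} _  (here refl) = y , here refl
  zip-∈ˡ {_ ∷ _} {_ ∷ _} eq (there x∈)  = let y , p = zip-∈ˡ (suc-injective eq) x∈ in y , there p

  zip-∈⇒∈ˡ : ∀ (xs : List A) (ys : List B) {x y} → (x , y) ∈ zip xs ys → x ∈ xs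
  zip-∈⇒∈ˡ (x ∷ xs) (y ∷ ys) (here refl) = here refl
  zip-∈⇒∈ˡ (x ∷ xs) (y ∷ ys) (there p)   = there (zip-∈⇒∈ˡ xs ys p)

  zip-∈⇒∈ʳ : ∀ (xs : List A) (ys : List B) {x y} → (x , y) ∈ zip xs ys → y ∈ ys
  zip-∈⇒∈ʳ (x ∷ xs) (y ∷ ys) (here refl) = here refl
  zip-∈⇒∈ʳ (x ∷ xs) (y ∷ ys) (there p)   = there (zip-∈⇒∈ʳ xs ys p)

  zip-unique : ∀ {xs : List A} {ys : List B} {x y y′} → Unique xs →
    (x , y) ∈ zip xs ys → (x , y′) ∈ zip xs ys → y ≡ y′
  zip-unique {_ ∷ _} {_ ∷ _} _ (here refl) (here refl) = refl
  zip-unique {_ ∷ xs} {_ ∷ ys} (x∉ ∷ _) (here refl) (there q) = contradiction refl (All.lookup x∉ (zip-∈⇒∈ˡ xs ys q))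
  zip-unique {_ ∷ xs} {_ ∷ ys} (x∉ ∷ _) (there p) (here refl) = contradiction refl (All.lookup x∉ (zip-∈⇒∈ˡ xs ys p))
  zip-unique {_ ∷ _} {_ ∷ _} (_ ∷ uniq) (there p) (there q) = zip-unique uniq p q

  map-proj₁-zip : ∀ (xs : List A) (ys : List B) → length xs ≡ length ys → map proj₁ (zip xs ys) ≡ xs
  map-proj₁-zip []       []       _  = refl
  map-proj₁-zip (x ∷ xs) (y ∷ ys) eq = cong (x ∷_) (map-proj₁-zip xs ys (suc-injective eq))

  map-proj₂-zip : ∀ (xs : List A) (ys : List B) → length xs ≡ length ys → map proj₂ (zip xs ys) ≡ ys
  map-proj₂-zip []       []       _  = refl
  map-proj₂-zip (x ∷ xs) (y ∷ ys) eq = cong (y ∷_) (map-proj₂-zip xs ys (suc-injective eq))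

  zip-map-proj : (ps : List (A × B)) → zip (map proj₁ ps) (map proj₂ ps) ≡ ps
  zip-map-proj []       = refl
  zip-map-proj (p ∷ ps) = cong (p ∷_) (zip-map-proj ps)

module _ {A : Set} where

  picks-complete : ∀ {x} {xs : List A} → x ∈ xs → ∃[ ys ] (x , ys) ∈ picks xs
  picks-complete (here refl) = _ , here refl
  picks-complete (there x∈) with ys , p ← picks-complete x∈ = _ , there (∈-map⁺ _ p)

  picks-↭ : ∀ {x ys} (xs : List A) → (x , ys) ∈ picks xs → x ∷ ys ↭ xs
  picks-↭ (x ∷ xs) (here refl) = ↭-refl
  picks-↭ (x ∷ xs) (there p) with (y , ys) , q , refl ← ∈-map⁻ _ p =
    ↭-trans (swap y x ↭-refl) (prep x (picks-↭ xs q))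

Unique-↭ : {A : Set} {xs ys : List A} → xs ↭ ys → Unique xs → Unique ys
Unique-↭ Perm.refl uniq = uniq
Unique-↭ (prep x p) (x∉ ∷ uniq) = All-resp-↭ p x∉ ∷ Unique-↭ p uniq
Unique-↭ (swap x y p) ((x≢y ∷ x∉) ∷ y∉ ∷ uniq) =
  (x≢y ∘ sym ∷ All-resp-↭ p y∉) ∷ All-resp-↭ p x∉ ∷ Unique-↭ p uniq
Unique-↭ (Perm.trans p q) uniq = Unique-↭ q (Unique-↭ p uniq)

module Run {l r k : ℕ} (φ : LTL (Atom l r k)) where
  open Windows l k using (OrderType; StrictWeak; Shift)
  open Statuses r k
  open Machine φ

  Active : Stat → Set
  Active s = ∃[ j ] ∃[ x ] occ s j x ≡ true

  active-or-parked : ∀ c → ∃[ a ] ∃[ u ] All Active a × All Parked u × a ++ u ↭ c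
  active-or-parked [] = [] , [] , [] , [] , ↭-refl
  active-or-parked (s ∷ c) with a , u , aa , pu , perm ← active-or-parked c
    with any? (λ j → any? λ x → occ s j x Bool.≟ true)
  ... | yes act = s ∷ a , u , act ∷ aa , pu , prep s perm
  ... | no ¬act = a , s ∷ u , aa , (λ j x → Bool.¬-not λ o → ¬act (j , x , o)) ∷ pu ,
                  ↭-trans (shift s a u) (prep s perm)

  -- Two equal active statuses would fill the same position twice.
  active-unique : ∀ c → (∀ j x → cnt j x c ≤ 1) → All Active c → Unique c
  active-unique [] le _ = []
  active-unique (s ∷ c) le ((j , x , o) ∷ act) =
    All.tabulate (λ u∈ → λ { refl → contradiction (cnt≥1 j x u∈ o)
      (<⇒≱ (subst (λ b → bit b + cnt j x c ≤ 1) o (le j x))) }) ∷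
    active-unique c (λ j x → m+n≤o⇒n≤o (bit (occ s j x)) (le j x)) act

  Reach-replay : ∀ {A A′ : Conf → Set} {u} → All Parked u →
    (∀ {q s c d e} → Ok q (s ∷ c) → c ++ e ↭ d ++ u → A (q , s , d) → A′ (q , s , c)) →
    ∀ n {q s c d e} → Ok q (s ∷ c) → c ++ e ↭ d ++ u → Reach A n (q , s , d) → Reach A′ n (q , s , c)
  Reach-replay pu base zero ok perm a = base ok perm a
  Reach-replay pu base (suc n) ok perm ((q′ , s′ , d′) , st , rch)
    with c′ , e′ , st′ , _ , perm′ ← replay-step ok pu perm st =
    (q′ , s′ , c′) , st′ , Reach-replay pu base n (proj₁ (proj₂ st′)) perm′ rch

  module _ {q P s d c} (s∷d↭P : s ∷ d ↭ P) (ok : Ok q (s ∷ c)) (⊆P : All (_∈ P) c) where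

    -- An active status of `c` lies in `P` but is not `s`, which would then fill the same position a
    -- second time; so it is among `d`, and it occurs in `c` only once. What remains of `c` is
    -- parked.
    parked-difference : ∃[ u ] ∃[ e ] All Parked u × All (_∈ P) u × c ++ e ↭ d ++ u
    parked-difference with a , u , act , pu , a++u↭c ← active-or-parked c =
      let e , a++e↭d = Unique⇒⊑ (active-unique a (few {a} a++u↭c) act) (a⊆d act a++u↭c) in
      u , e , pu , All.++⁻ʳ a (All-resp-↭ (↭-sym a++u↭c) ⊆P) ,
      ↭-trans (Perm.++⁺ʳ e (↭-sym a++u↭c)) (↭-trans (reorder a a e ↭-refl)
        (↭-trans (↭-sym (Perm.++-assoc a e u)) (Perm.++⁺ʳ u a++e↭d)))
      where
      few : ∀ {a u} → a ++ u ↭ c → ∀ j x → cnt j x a ≤ 1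
      few {a} {u} perm j x = begin
        cnt j x a             ≤⟨ m≤m+n _ (cnt j x u) ⟩
        cnt j x a + cnt j x u ≡⟨ cnt-++ j x a u ⟨
        cnt j x (a ++ u)      ≡⟨ cnt-↭ j x perm ⟩
        cnt j x c             ≤⟨ m≤n+m _ (bit (occ s j x)) ⟩
        cnt j x (s ∷ c)       ≡⟨ proj₁ ok j x ⟩
        1                     ∎
        where open ≤-Reasoning
      a⊆d : ∀ {a u} → All Active a → a ++ u ↭ c → ∀ {v} → v ∈ a → v ∈ d
      a⊆d act perm v∈a with v∈c ← ∈-resp-↭ perm (∈-++⁺ˡ v∈a)
        with ∈-resp-↭ (↭-sym s∷d↭P) (All.lookup ⊆P v∈c)
      ... | there v∈d = v∈d
      ... | here refl with j , x , o ← All.lookup act v∈a =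
        contradiction (cnt≥1 j x v∈c o)
          (<⇒≱ (subst (λ b → bit b + cnt j x c ≤ 1) o (≤-reflexive (proj₁ ok j x))))

    -- The surplus `u` of `c` idles during the replay. Its statuses lie in `P`, so the return to
    -- `Within q P` succeeds with it as well.
    Loop-replay : ∀ {g} → Loop q P (s , d) g → Loop q P (s , c) g
    Loop-replay {g} ((q′ , s′ , d′) , st , n , rch)
      with u , e , pu , u⊆P , perm ← parked-difference
      with c′ , e′ , st′ , _ , perm′ ← replay-step ok pu perm st =
      (q′ , s′ , c′) , st′ , n , Reach-replay pu met n (proj₁ (proj₂ st′)) perm′ rch
      where
      within : ∀ {q′ s c d e} → Ok q′ (s ∷ c) → c ++ e ↭ d ++ u → Within q P (q′ , s , d) → Within q P (q′ , s , c)
      within {c = c} ok perm (eq , s∈ ∷ d⊆P , _) =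
        eq , s∈ ∷ All.++⁻ˡ c (All-resp-↭ (↭-sym perm) (All.++⁺ d⊆P u⊆P)) , ok
      met : ∀ {q′ s₁ c d e} → Ok q′ (s₁ ∷ c) → c ++ e ↭ d ++ u → Met q P g s (q′ , s₁ , d) → Met q P g s (q′ , s₁ , c)
      met ok perm (m , n , rch) = m , n , Reach-replay pu within n ok perm rch

  -- The multiset of a configuration with a number for each value; the remote values of the model
  -- are read off from these numbers. The queue always holds every pair of a number and a goal: a
  -- pair that is served moves to the end instead of leaving. Fresh numbers start at `bound`.
  record State : Set where
    field
      control   : Control
      followed  : ℕ
      ids       : List ℕ
      status    : Stat
      others    : List Stat
      bound     : ℕ
      same-size : length ids ≡ length others
      distinct  : Unique (followed ∷ ids)
      bounded   : All (_< bound) (followed ∷ ids)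
      queue     : List (ℕ × Goal)
      queued    : ∀ {m g} → m ∈ followed ∷ ids → g ∈ goals → (m , g) ∈ queue
      sound     : All (λ (m , g) → m ∈ followed ∷ ids × g ∈ goals) queue

    conf : Conf
    conf = control , status , others

    Carries : ℕ → Stat → Set
    Carries m u = (m , u) ∈ zip (followed ∷ ids) (status ∷ others)

  open State

  tracked : ∀ (ids ms : List ℕ) {c f d m u} → length ids ≡ length c → Pointwise Next (c ++ f) d →
    (m , u) ∈ zip ids c → ∃[ u′ ] (m , u′) ∈ zip (ids ++ ms) d × Next u u′
  tracked (_ ∷ _) ms {_ ∷ _} _ (n ∷ _) (here refl) = _ , here refl , n
  tracked (_ ∷ ids) ms {_ ∷ _} eq (_ ∷ ns) (there p)
    with u′ , p′ , n ← tracked ids ms (suc-injective eq) ns p = u′ , there p′ , n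

  forward : ∀ τ {y} → conf τ ⟶ y → State
  forward τ {q , s , c} (_ , _ , _ , _ , f , _ , _ , ns) = record
    { control   = q
    ; followed  = followed τ
    ; ids       = ids τ ++ new
    ; status    = s
    ; others    = c
    ; bound     = length f + bound τ
    ; same-size = trans (length-++ (ids τ)) (trans (cong₂ _+_ (same-size τ) (length-upFrom (bound τ) (length f)))
                    (trans (sym (length-++ (others τ))) (Pointwise-length ns)))
    ; distinct  = Unique.++⁺ (distinct τ) (upFrom-unique (bound τ) (length f)) λ (m∈ , m∈′) →
                    contradiction (All.lookup (upFrom-≥ (bound τ) (length f)) m∈′) (<⇒≱ (All.lookup (bounded τ) m∈))
    ; bounded   = All.++⁺ (All.map (λ lt → ≤-trans lt (m≤n+m (bound τ) (length f))) (bounded τ)) (upFrom-< (bound τ) (length f))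
    -- New pairs go to the end, so what waits ahead of a given pair never increases.
    ; queue     = queue τ ++ cartesianProduct new goals
    ; queued    = λ m∈ g∈ → [ (λ m∈ → ∈-++⁺ˡ (queued τ m∈ g∈)) ,
                              (λ m∈ → ∈-++⁺ʳ (queue τ) (∈-cartesianProduct⁺ m∈ g∈)) ]′ (∈-++⁻ (followed τ ∷ ids τ) m∈)
    ; sound     = All.++⁺ (All.map (λ (m∈ , g∈) → ∈-++⁺ˡ m∈ , g∈) (sound τ))
                    (All.tabulate λ p → let m∈ , g∈ = ∈-cartesianProduct⁻ new goals p in
                      ∈-++⁺ʳ (followed τ ∷ ids τ) m∈ , g∈)
    }
    where
    new : List ℕ
    new = upFrom (bound τ) (length f)

  forward-Carries : ∀ τ {y} (st : conf τ ⟶ y) {m u} → Carries τ m u →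
    ∃[ u′ ] Carries (forward τ st) m u′ × Next u u′
  forward-Carries τ (_ , _ , _ , n , f , _ , _ , ns) p =
    tracked (followed τ ∷ ids τ) (upFrom (bound τ) (length f)) (cong suc (same-size τ)) (n ∷ ns) p

  module _ (τ : State) {m g ps} (eq : queue τ ≡ (m , g) ∷ ps) where

    private
      m∈g∈ : m ∈ followed τ ∷ ids τ × g ∈ goals
      m∈g∈ = All.head (subst (All _) eq (sound τ))

      labels : List (ℕ × Stat)
      labels = zip (followed τ ∷ ids τ) (status τ ∷ others τ)

      found : ∃[ u ] (m , u) ∈ labels
      found = zip-∈ˡ (cong suc (same-size τ)) (proj₁ m∈g∈)

      rest : List (ℕ × Stat)
      rest = proj₁ (∈⇒↭ (proj₂ found))

      rest-↭ : (m , proj₁ found) ∷ rest ↭ labels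
      rest-↭ = proj₂ (∈⇒↭ (proj₂ found))

      ids-↭ : m ∷ map proj₁ rest ↭ followed τ ∷ ids τ
      ids-↭ = ↭-trans (Perm.map⁺ proj₁ rest-↭) (↭-reflexive (map-proj₁-zip (followed τ ∷ ids τ) (status τ ∷ others τ) (cong suc (same-size τ))))

    statuses-↭ : proj₁ found ∷ map proj₂ rest ↭ status τ ∷ others τ
    statuses-↭ = ↭-trans (Perm.map⁺ proj₂ rest-↭) (↭-reflexive (map-proj₂-zip (followed τ ∷ ids τ) (status τ ∷ others τ) (cong suc (same-size τ))))

    goal-∈ : g ∈ goals
    goal-∈ = proj₂ m∈g∈

    refocus : State
    refocus = record
      { control   = control τ
      ; followed  = m
      ; ids       = map proj₁ rest
      ; status    = proj₁ found
      ; others    = map proj₂ rest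
      ; bound     = bound τ
      ; same-size = trans (length-map proj₁ rest) (sym (length-map proj₂ rest))
      ; distinct  = Unique-↭ (↭-sym ids-↭) (distinct τ)
      ; bounded   = All-resp-↭ (↭-sym ids-↭) (bounded τ)
      ; queue     = ps ++ (m , g) ∷ []
      ; queued    = λ m∈ g∈ → ∈-resp-↭ (++-comm ((m , g) ∷ []) ps)
                      (subst (_ ∈_) eq (queued τ (∈-resp-↭ ids-↭ m∈) g∈))
      ; sound     = All-resp-↭ (++-comm ((m , g) ∷ []) ps)
                      (All.map (λ (m∈ , g∈) → ∈-resp-↭ (↭-sym ids-↭) m∈ , g∈) (subst (All _) eq (sound τ)))
      }

    refocus-Carries : ∀ {n u} → Carries τ n u → Carries refocus n u
    refocus-Carries p rewrite zip-map-proj rest = ∈-resp-↭ (↭-sym rest-↭) p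

    refocus-Carries⁻ : ∀ {n u} → Carries refocus n u → Carries τ n u
    refocus-Carries⁻ p rewrite zip-map-proj rest = ∈-resp-↭ rest-↭ p

  Reach-Ok : ∀ {q P} n {q′ s c} → Reach (Within q P) n (q′ , s , c) → Ok q′ (s ∷ c)
  Reach-Ok zero    (_ , _ , ok)       = ok
  Reach-Ok (suc n) (_ , (ok , _) , _) = ok

  see-∈ : ∀ y → see y ∈ goals
  see-∈ y = ∈-++⁺ʳ (map fair (fairness φ)) (∈-map⁺ see (∈-allFin y))

  fair-∈ : ∀ {f} → f ∈ fairness φ → fair f ∈ goals
  fair-∈ f∈ = ∈-++⁺ˡ (∈-map⁺ fair f∈)

  module Scheduler {q : Control} {P : List Stat} (good : Good q P) where

    Running : Set
    Running = Σ State λ τ → ∃[ n ] Reach (Within q P) n (conf τ)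

    flatten : ∀ g s₀ n {x} → Reach (Met q P g s₀) n x → ∃[ n′ ] Reach (Within q P) n′ x
    flatten g s₀ zero    (_ , plan)     = plan
    flatten g s₀ (suc n) (y , st , rch) = let n′ , plan = flatten g s₀ n rch in suc n′ , y , st , plan

    serve : ∀ τ {m g ps} (eq : queue τ ≡ (m , g) ∷ ps) → Within q P (conf τ) →
      ∃[ y ] conf (refocus τ eq) ⟶ y × ∃[ n ] Reach (Met q P g (status (refocus τ eq))) n y
    serve τ {g = g} eq (refl , ⊆P , ok) =
      let ⊆P′ = All-resp-↭ (↭-sym (statuses-↭ τ eq)) ⊆P
          d , pick = picks-complete (All.head ⊆P′)
      in Loop-replay (picks-↭ P pick)
           (Ok-extras [] [] (Perm.++⁺ʳ [] (statuses-↭ τ eq)) ok) (All.tail ⊆P′) {g}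
           (All.lookup (All.lookup good pick) (goal-∈ τ eq))

    -- A loop begins with a transition, which is taken at once; thus every `step` advances time by
    -- exactly one.
    pop : ∀ τ → Within q P (conf τ) → ∀ ps → queue τ ≡ ps → Running
    pop τ w [] eq = contradiction (subst (_ ∈_) eq (queued τ (here refl) (see-∈ zero))) λ ()
    pop τ w ((m , g) ∷ ps) eq = let y , st , n , rch = serve τ eq w in
      forward (refocus τ eq) st , flatten g (status (refocus τ eq)) n rch

    step : Running → Running
    step (τ , suc n , y , st , plan) = forward τ st , n , plan
    step (τ , zero , w) = pop τ w (queue τ) refl

    run : Running → ℕ → Running
    run ρ zero    = ρ
    run ρ (suc i) = step (run ρ i)

    run-step : ∀ ρ i → run (step ρ) i ≡ run ρ (suc i)
    run-step ρ zero    = refl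
    run-step ρ (suc i) = cong step (run-step ρ i)

    run-run : ∀ ρ i j → run (run ρ i) j ≡ run ρ (j + i)
    run-run ρ i zero    = refl
    run-run ρ i (suc j) = cong step (run-run ρ i j)

    _⇝_ : Running → Running → Set
    (τ , _) ⇝ (τ′ , _) = ControlStep (control τ) (control τ′) ×
      (∀ {m u} → Carries τ m u → ∃[ u′ ] Carries τ′ m u′ × Next u u′)

    -- `step` inspects `queue τ`, whereas a proof knows the shape of the queue only through an
    -- equation; this exchanges the two.
    pop-≡ : ∀ τ w {ps} (eq : queue τ ≡ ps) → pop τ w (queue τ) refl ≡ pop τ w ps eq
    pop-≡ τ w refl = refl

    pop-⇝ : ∀ τ w ps eq → (τ , 0 , w) ⇝ pop τ w ps eq
    pop-⇝ τ w [] eq = contradiction (subst (_ ∈_) eq (queued τ (here refl) (see-∈ zero))) λ ()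
    pop-⇝ τ w ((m , g) ∷ ps) eq = let y , st , _ = serve τ eq w ; _ , _ , cs , _ = st in
      cs , λ p → forward-Carries (refocus τ eq) st (refocus-Carries τ eq p)

    step-⇝ : ∀ ρ → ρ ⇝ step ρ
    step-⇝ (τ , suc n , y , st@(_ , _ , cs , _) , plan) = cs , forward-Carries τ st
    step-⇝ (τ , zero , w) = pop-⇝ τ w (queue τ) refl

    Served : Running → ℕ → Goal → Set
    Served ρ m g = ∃[ i ] ∃[ j ] ∃[ u ] ∃[ v ] i < j ×
      Carries (proj₁ (run ρ i)) m u × Carries (proj₁ (run ρ j)) m v ×
      g u (control (proj₁ (run ρ j))) v ≡ true

    Served-step : ∀ {ρ m g} → Served (step ρ) m g → Served ρ m g
    Served-step {ρ} {m} {g} (i , j , u , v , i<j , cu , cv , met) =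
      suc i , suc j , u , v , s≤s i<j ,
      subst (λ ρ → Carries (proj₁ ρ) m u) (run-step ρ i) cu ,
      subst (λ ρ → Carries (proj₁ ρ) m v) (run-step ρ j) cv ,
      subst (λ ρ → g u (control (proj₁ ρ)) v ≡ true) (run-step ρ j) met

    -- `flatten` forgets where the goal is met; following the plan for `n` steps recovers the place.
    visit : ∀ g s₀ n τ (rch : Reach (Met q P g s₀) n (conf τ)) →
      ∃[ i ] ∃[ v ] Carries (proj₁ (run (τ , flatten g s₀ n rch) i)) (followed τ) v ×
        g s₀ (control (proj₁ (run (τ , flatten g s₀ n rch) i))) v ≡ true
    visit g s₀ zero τ (met , _) = 0 , status τ , here refl , met
    visit g s₀ (suc n) τ (y , st , rch) with i , v , cv , met ← visit g s₀ n (forward τ st) rch =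
      suc i , v , subst (λ ρ → Carries (proj₁ ρ) (followed τ) v) (run-step _ i) cv ,
      subst (λ ρ → g s₀ (control (proj₁ ρ)) v ≡ true) (run-step _ i) met

    -- Lexicographic recursion on the pairs `pre` waiting ahead and on the length of the current
    -- plan: a step along the plan leaves `pre` as it is, and the end of a plan removes its first
    -- entry.
    live : ∀ pre {post} n τ plan {m g} → queue τ ≡ pre ++ (m , g) ∷ post → Served (τ , n , plan) m g
    live pre {post} (suc n) τ (y , st , plan) {g = g} eq =
      Served-step {τ , suc n , y , st , plan} {g = g} (live pre n (forward τ st) plan (trans (cong (_++ _) eq) (++-assoc pre _ _)))
    live [] zero τ w {m} {g} eq =
      let y , st , n , rch = serve τ eq w
          i , v , cv , met = visit g (status (refocus τ eq)) n (forward (refocus τ eq) st) rch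
          same = trans (cong (λ ρ → run ρ i) (sym (pop-≡ τ w eq))) (run-step (τ , 0 , w) i)
      in 0 , suc i , _ , v , s≤s z≤n , refocus-Carries⁻ τ eq (here refl) ,
         subst (λ ρ → Carries (proj₁ ρ) m v) same cv ,
         subst (λ ρ → g (status (refocus τ eq)) (control (proj₁ ρ)) v ≡ true) same met
    live ((_ , g′) ∷ pre) {post} zero τ w {m} {g} eq =
      let y , st , n , rch = serve τ eq w
          n′ , plan = flatten g′ (status (refocus τ eq)) n rch
      in Served-step {τ , 0 , w} {g = g} (subst (λ ρ → Served ρ m g) (sym (pop-≡ τ w eq))
           (live pre n′ (forward (refocus τ eq) st) plan
             (trans (++-assoc (pre ++ (m , g) ∷ post) _ _) (++-assoc pre _ _))))

    served : ∀ ρ {m u g} → Carries (proj₁ ρ) m u → g ∈ goals → Served ρ m g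
    served (τ , n , plan) p g∈
      with pre , post , eq ← ∈-∃++ (queued τ (zip-∈⇒∈ˡ (followed τ ∷ ids τ) (status τ ∷ others τ) p) g∈) =
      live pre n τ plan eq

-- Remote values of a scheduled run

module RunModel {l r k : ℕ} (φ : LTL (Atom l r k)) where
  open Windows l k using (OrderType; StrictWeak; Shift)
  open Statuses r k
  open Machine φ
  open Run φ
  open State

  unique-carrier : ∀ j x (ids : List ℕ) c {m m′ u u′} → cnt j x c ≤ 1 →
    (m , u) ∈ zip ids c → (m′ , u′) ∈ zip ids c → occ u j x ≡ true → occ u′ j x ≡ true → m ≡ m′
  unique-carrier j x (_ ∷ _)   (_ ∷ _) le (here refl) (here refl) _ _ = refl
  unique-carrier j x (_ ∷ ids) (s ∷ c) le (here refl) (there q) o o′ rewrite o =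
    contradiction (cnt≥1 j x {c} (zip-∈⇒∈ʳ ids c q) o′) (<⇒≱ le)
  unique-carrier j x (_ ∷ ids) (s ∷ c) le (there p) (here refl) o o′ rewrite o′ =
    contradiction (cnt≥1 j x {c} (zip-∈⇒∈ʳ ids c p) o) (<⇒≱ le)
  unique-carrier j x (_ ∷ ids) (s ∷ c) le (there p) (there q) o o′ =
    unique-carrier j x ids c (m+n≤o⇒n≤o (bit (occ s j x)) le) p q o o′

  module _ {q : Control} {P : List Stat} (good : Good q P) (ρ₀ : Scheduler.Running good) where
    open Scheduler good

    τ : ℕ → State
    τ i = proj₁ (run ρ₀ i)

    ok : ∀ i → Ok (control (τ i)) (status (τ i) ∷ others (τ i))
    ok i = let _ , n , plan = run ρ₀ i in Reach-Ok n plan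

    carried : ∀ i {m u} → Carries (τ i) m u → ∃[ u′ ] Carries (τ (suc i)) m u′ × Next u u′
    carried i = proj₂ (step-⇝ (run ρ₀ i))

    carrier : ∀ i j x → ∃[ m ] ∃[ u ] Carries (τ i) m u × occ u j x ≡ true
    carrier i j x with u , u∈ , o ← cnt≥1⇒∈ j x (status (τ i) ∷ others (τ i)) (≤-reflexive (sym (proj₁ (ok i) j x))) =
      let m , p = zip-∈ʳ (cong suc (same-size (τ i))) u∈ in m , u , p , o

    owner : ℕ → Fin (suc r) → ℕ
    owner i x = proj₁ (carrier i zero x)

    owner-now : ∀ i {m u} x → Carries (τ i) m u → Reflects (owner i x ≡ m) (occ u zero x)
    owner-now i {m} {u} x p = let _ , _ , p′ , o′ = carrier i zero x in same p′ o′
      where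
      same : ∀ {m′ u′} → Carries (τ i) m′ u′ → occ u′ zero x ≡ true → Reflects (m′ ≡ m) (occ u zero x)
      same p′ o′ with occ u zero x in o
      ... | true = ofʸ (unique-carrier zero x (followed (τ i) ∷ ids (τ i)) (status (τ i) ∷ others (τ i))
                          (≤-reflexive (proj₁ (ok i) zero x)) p′ p o′ o)
      ... | false = ofⁿ λ { refl → contradiction (trans (sym o)
                          (trans (cong (λ u → occ u zero x) (zip-unique (distinct (τ i)) p p′)) o′)) λ () }

    -- An occurrence at offset `suc j` is one at offset `inject₁ j` of the next window, for the same
    -- number.
    owner-window : ∀ n i {m u} x (j : Fin (suc k)) → toℕ j ≡ n → Carries (τ i) m u →
      Reflects (owner (i + toℕ j) x ≡ m) (occ u j x)
    owner-window _ i x zero _ p rewrite +-identityʳ i = owner-now i x p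
    owner-window (suc n) i {m} {u} x (suc j) eq p with u′ , p′ , shft , _ ← carried i p =
      subst₂ (λ t b → Reflects (owner t x ≡ m) b)
        (trans (cong (suc i +_) (toℕ-inject₁ j)) (sym (+-suc i _))) (shft j x)
        (owner-window n (suc i) x (inject₁ j) (trans (toℕ-inject₁ j) (suc-injective eq)) p′)

    owner-top : ∀ i {m u} x → Carries (τ i) m u → Reflects (owner (i + k) x ≡ m) (occ u top x)
    owner-top i {m} {u} x p = subst (λ t → Reflects (owner (i + t) x ≡ m) (occ u top x)) (toℕ-fromℕ k)
      (owner-window _ i x top refl p)

    -- By the law for `fut`, a false bit keeps `y` away from `top` after the step and stays false.
    not-later : ∀ n i {m u} y → Carries (τ i) m u → fut u y ≡ false → owner (suc n + i + k) y ≢ m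
    not-later n i {u = u} y p f eq with u′ , p′ , _ , fut-eq ← carried i p
      with occ u′ top y in o | fut u′ y in f′ | trans (sym (fut-eq y)) f
    not-later zero i y p f eq | false | false | _ =
      contradiction (trans (sym (reflects⇒true (owner-top (suc i) y p′) eq)) o) λ ()
    not-later (suc n) i {m} y p f eq | false | false | _ =
      not-later n (suc i) y p′ f′ (subst (λ t → owner (t + k) y ≡ m) (cong suc (sym (+-suc n i))) eq)

    LaterOwner : ℕ → Fin (suc r) → ℕ → Set
    LaterOwner i y m = ∃[ t ] i + k < t × owner t y ≡ m

    -- At each step a promise either turns into an occurrence at `top` or stays pending.
    pending : ∀ n i {m u} y → Carries (τ i) m u → fut u y ≡ true →
      LaterOwner i y m ⊎ ∃[ u′ ] Carries (τ (n + i)) m u′ × fut u′ y ≡ true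
    pending zero i y p f = inj₂ (_ , p , f)
    pending (suc n) i {m} y p f with pending n i y p f
    ... | inj₁ found = inj₁ found
    ... | inj₂ (u , pu , fu) with u′ , p′ , _ , fut-eq ← carried (n + i) pu
      with occ u′ top y in o | trans (sym (fut-eq y)) fu
    ... | true  | _  = inj₁ (suc (n + i) + k , s≤s (+-monoˡ-≤ k (m≤n+m i n)) , reflects-true (owner-top (suc (n + i)) y p′) o)
    ... | false | f′ = inj₂ (u′ , p′ , f′)

    -- The scheduler may begin to serve the promise later than `i`. By then it has been kept or is
    -- still pending, and in the latter case the goal `see y` puts `y` at the `top` of a later
    -- window.
    eventually : ∀ i {m u} y → Carries (τ i) m u → fut u y ≡ true → LaterOwner i y m
    eventually i {m} y p f with i₀ , i₁ , u , v , i₀<i₁ , pu , pv , met ← served (run ρ₀ i) p (see-∈ y)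
      rewrite run-run ρ₀ i i₀ | run-run ρ₀ i i₁ with pending i₀ i y p f
    ... | inj₁ found = found
    ... | inj₂ (u′ , pu′ , fu′) = i₁ + i + k , +-monoˡ-< k (+-monoˡ-≤ i (≤-trans (s≤s z≤n) i₀<i₁)) ,
      reflects-true (owner-top (i₁ + i) y pv)
        (trans (cong (λ b → not b ∨ occ v top y)
                 (sym (trans (cong (λ u → fut u y) (zip-unique (distinct (τ (i₀ + i))) pu pu′)) fu′))) met)

    M : ℕ → OrderType
    M i = proj₂ (control (τ i))

    all : ℕ → List Stat
    all i = status (τ i) ∷ others (τ i)

    carrier-of : ∀ i {s} → s ∈ all i → ∃[ m ] Carries (τ i) m s
    carrier-of i s∈ = zip-∈ʳ (cong suc (same-size (τ i))) s∈

    rem≈-reflects : ∀ i x j y → Reflects (owner i x ≡ owner (i + toℕ j) y) (does (Holds? (M i) (all i) (rem≈ x j y)))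
    rem≈-reflects i x j y = reflects-map to from (proof (Holds? (M i) (all i) (rem≈ x j y)))
      where
      to : Holds (M i) (all i) (rem≈ x j y) → owner i x ≡ owner (i + toℕ j) y
      to h with s , s∈ , o , o′ ← find h with m , p ← carrier-of i s∈ =
        trans (reflects-true (owner-now i x p) o) (sym (reflects-true (owner-window _ i y j refl p) o′))
      from : owner i x ≡ owner (i + toℕ j) y → Holds (M i) (all i) (rem≈ x j y)
      from eq = let m , u , p , o = carrier i zero x in
        lose (zip-∈⇒∈ʳ (followed (τ i) ∷ ids (τ i)) (all i) p)
          (o , reflects⇒true (owner-window _ i y j refl p) (sym eq))

    remF-reflects : ∀ i x y → Reflects (∃[ t ] (i < t × owner i x ≡ owner t y)) (does (Holds? (M i) (all i) (remF x y)))
    remF-reflects i x y = reflects-map to from (proof (Holds? (M i) (all i) (remF x y)))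
      where
      to : Holds (M i) (all i) (remF x y) → ∃[ t ] (i < t × owner i x ≡ owner t y)
      to h with s , s∈ , o , ltr ← find h with m , p ← carrier-of i s∈ with ltr
      ... | inj₁ f = let t , lt , eq = eventually i y p f in
        t , ≤-trans (s≤s (m≤m+n i k)) lt , trans (reflects-true (owner-now i x p) o) (sym eq)
      ... | inj₂ (j , o′) = i + suc (toℕ j) , ≤-trans (s≤s (m≤m+n i (toℕ j))) (≤-reflexive (sym (+-suc i _))) ,
        trans (reflects-true (owner-now i x p) o) (sym (reflects-true (owner-window _ i y (suc j) refl p) o′))
      from : ∃[ t ] (i < t × owner i x ≡ owner t y) → Holds (M i) (all i) (remF x y)
      from (t , i<t , eq) = let m , u , p , o = carrier i zero x in
        lose (zip-∈⇒∈ʳ (followed (τ i) ∷ ids (τ i)) (all i) p) (o , occurs p eq (i + k <? t))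
        where
        occurs : ∀ {m u} → Carries (τ i) m u → m ≡ owner t y → Dec (i + k < t) → Later u y
        occurs {m} {u} p eq (yes far) with fut u y in f
        ... | true  = inj₁ refl
        ... | false = contradiction (trans (cong (λ t → owner t y) shape) (sym eq)) (not-later (t ∸ suc (i + k)) i y p f)
          where
          shape : suc (t ∸ suc (i + k)) + i + k ≡ t
          shape = trans (cong suc (+-assoc (t ∸ suc (i + k)) i k)) (trans (sym (+-suc _ (i + k))) (m∸n+n≡m far))
        occurs p eq (no near) = let j , shape = window-index i<t near in
          inj₂ (j , reflects⇒true (owner-window _ i y (suc j) refl p) (trans (cong (λ t → owner t y) shape) (sym eq)))

    run-fair : FairRun φ (λ i → proj₁ (control (τ i)))
    run-fair = All.tabulate λ {f} f∈ i →
      let i₀ , i₁ , u , v , i₀<i₁ , pu , pv , met = served (run ρ₀ i) {g = fair f} (here refl) (fair-∈ f∈) in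
      i₁ + i , m≤n+m i i₁ , subst (λ ρ → f (proj₁ (control (proj₁ ρ))) ≡ true) (run-run ρ₀ i i₁) met

-- From models to accepting runs

length-cartesianProductWith : ∀ {a b c} {A : Set a} {B : Set b} {C : Set c} (f : A → B → C) xs ys →
  length (cartesianProductWith f xs ys) ≡ length xs * length ys
length-cartesianProductWith f []       ys = refl
length-cartesianProductWith f (x ∷ xs) ys = trans (length-++ (map (f x) ys))
  (cong₂ _+_ (length-map (f x) ys) (length-cartesianProductWith f xs ys))

vec-ext : ∀ {A : Set} {n} {xs ys : Vec A n} → (∀ i → lookup xs i ≡ lookup ys i) → xs ≡ ys
vec-ext {xs = []} {[]} _ = refl
vec-ext {xs = _ ∷ _} {_ ∷ _} eq = cong₂ _∷_ (eq zero) (vec-ext (eq ∘ suc))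

records-unique : ∀ {p x y} {P : Set p} → Records x P → Records y P → x ≡ y
records-unique r r′ = records-≡ r r′ return return

Truth-unique : ∀ {ℓ} {At : Set} {V : ℕ → At → Set ℓ} {i} φ {t t′} → Truth V i φ t → Truth V i φ t′ → t ≡ t′
Truth-unique (atom a)    h h′ = records-unique h h′
Truth-unique (neg φ)     h h′ = Truth-unique φ h h′
Truth-unique (next φ)    (r , h) (r′ , h′) = cong₂ _,_ (records-unique r r′) (Truth-unique φ h h′)
Truth-unique (prev φ)    (r , h) (r′ , h′) = cong₂ _,_ (records-unique r r′) (Truth-unique φ h h′)
Truth-unique (and φ ψ)   (h , k) (h′ , k′) = cong₂ _,_ (Truth-unique φ h h′) (Truth-unique ψ k k′)
Truth-unique (until φ ψ) (r , h , k) (r′ , h′ , k′) =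
  cong₂ _,_ (records-unique r r′) (cong₂ _,_ (Truth-unique φ h h′) (Truth-unique ψ k k′))
Truth-unique (since φ ψ) (r , h , k) (r′ , h′ , k′) =
  cong₂ _,_ (records-unique r r′) (cong₂ _,_ (Truth-unique φ h h′) (Truth-unique ψ k k′))

module Valuation {a ℓ : Level} (𝒟 : ConstraintSystem a ℓ) (l r k : ℕ) where
  open ConstraintSystem 𝒟 renaming (Carrier to D)

  eval : (ℕ → Fin (suc l) → D) → (ℕ → Fin (suc r) → D) → ℕ → Atom l r k → Set ℓ
  eval u v i (loc≈ x j y) = u i x ≈ u (i + toℕ j) y
  eval u v i (loc< x j y) = u i x ≺ u (i + toℕ j) y
  eval u v i (rem≈ x j y) = v i x ≈ v (i + toℕ j) y
  eval u v i (remF x y)   = ∃[ t ] (i < t × v i x ≈ v t y)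

module Completeness {a ℓ : Level} (𝒟 : ConstraintSystem a ℓ) (d₀ : ConstraintSystem.Carrier 𝒟)
  (sto : IsStrictlyTotallyOrdered 𝒟) (dense : IsDense 𝒟) (isOpen : IsOpen 𝒟)
  {l r k : ℕ} (φ : LTL (Atom l r k))
  (u : ℕ → Fin (suc l) → ConstraintSystem.Carrier 𝒟) (v : ℕ → Fin (suc r) → ConstraintSystem.Carrier 𝒟) where
  open ConstraintSystem 𝒟 renaming (Carrier to D)
  open IsStrictlyTotallyOrdered sto
  open IsStrictPartialOrder isStrictPartialOrder using (module Eq)
  open Windows l k
  open Statuses r k
  open Machine φ
  open LocalModel 𝒟 d₀ sto dense isOpen l k using (module Abstraction)
  open Abstraction u
  open Valuation 𝒟 l r k

  V : ℕ → Atom l r k → Set ℓ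
  V = eval u v

  record IsStat (i : ℕ) (d : D) (s : Stat) : Set ℓ where
    constructor isStat
    field
      occ-at : ∀ j x → Records (occ s j x) (v (i + toℕ j) x ≈ d)
      fut-at : ∀ y → Records (fut s y) (∃[ t ] (i + k < t × v t y ≈ d))
  open IsStat

  stat : ∀ i d → ¬¬ ∃ (IsStat i d)
  stat i d = do
    K , hK ← ¬¬-Vec λ j → ¬¬-Vec λ x → record? (v (i + toℕ j) x ≈ d)
    H , hH ← ¬¬-Vec λ y → record? (∃[ t ] (i + k < t × v t y ≈ d))
    return ((K , H) , isStat hK hH)

  stats : ∀ i ds → ¬¬ ∃ (Pointwise (IsStat i) ds)
  stats i []       = return ([] , [])
  stats i (d ∷ ds) = do
    s , h  ← stat i d
    c , hs ← stats i ds
    return (s ∷ c , h ∷ hs)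

  IsStat-unique : ∀ {i d s s′} → IsStat i d s → IsStat i d s′ → s ≡ s′
  IsStat-unique (isStat o f) (isStat o′ f′) = cong₂ _,_
    (vec-ext λ j → vec-ext λ x → records-unique (o j x) (o′ j x))
    (vec-ext λ y → records-unique (f y) (f′ y))

  IsStat-≈ : ∀ {i d e s} → d ≈ e → IsStat i d s → IsStat i e s
  IsStat-≈ d≈e (isStat o f) = isStat
    (λ j x → records-map (o j x) (λ p → return (Eq.trans p d≈e)) (λ p → return (Eq.trans p (Eq.sym d≈e))))
    (λ y → records-map (f y) (λ (t , lt , p) → return (t , lt , Eq.trans p d≈e))
                             (λ (t , lt , p) → return (t , lt , Eq.trans p (Eq.sym d≈e))))

  IsStat-Next : ∀ {i d s s′} → IsStat i d s → IsStat (suc i) d s′ → Next s s′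
  IsStat-Next {i} {d} (isStat o f) (isStat o′ f′) =
    (λ j x → records-≡ (o′ (inject₁ j) x) (o (suc j) x)
      (return ∘ subst (λ t → v t x ≈ d) (same j)) (return ∘ subst (λ t → v t x ≈ d) (sym (same j)))) ,
    (λ y → records-≡ (f y) (records-∨ (o′ top y) (f′ y)) (return ∘ split y) (return ∘ join y))
    where
    same : ∀ (j : Fin k) → suc i + toℕ (inject₁ j) ≡ i + suc (toℕ j)
    same j = trans (cong (suc i +_) (toℕ-inject₁ j)) (sym (+-suc i _))
    split : ∀ y → ∃[ t ] (i + k < t × v t y ≈ d) →
      v (suc i + toℕ top) y ≈ d ⊎ ∃[ t ] (suc i + k < t × v t y ≈ d)
    split y (t , lt , p) with m≤n⇒m<n∨m≡n lt
    ... | inj₁ lt′  = inj₂ (t , lt′ , p)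
    ... | inj₂ refl = inj₁ (subst (λ n → v (suc i + n) y ≈ d) (sym (toℕ-fromℕ k)) p)
    join : ∀ y → v (suc i + toℕ top) y ≈ d ⊎ ∃[ t ] (suc i + k < t × v t y ≈ d) →
      ∃[ t ] (i + k < t × v t y ≈ d)
    join y (inj₁ p) = suc i + k , ≤-refl , subst (λ n → v (suc i + n) y ≈ d) (toℕ-fromℕ k) p
    join y (inj₂ (t , lt , p)) = t , <⇒≤ lt , p

  Distinct : List D → Set _
  Distinct = AllPairs λ d e → ¬ (d ≈ e)

  -- Representatives up to `≈` of the values seen until time `i + k`. Since `≈` need not be
  -- decidable, `covers` and the construction of such lists stay under a double negation.
  record Values (i : ℕ) (ds : List D) : Set (a Level.⊔ ℓ) where
    field
      different : Distinct ds
      covers    : ∀ t x → t ≤ i + k → ¬¬ Any (v t x ≈_) ds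
      occurs    : All (λ d → ∃[ t ] ∃[ x ] t ≤ i + k × v t x ≈ d) ds
  open Values

  absorb : ∀ ws ds → Distinct ds → ¬¬ ∃[ new ] length new ≤ length ws × Distinct (ds ++ new) ×
    All (λ d → All (λ e → ¬ (e ≈ d)) ds) new × All (λ w → Any (w ≈_) (ds ++ new)) ws × All (_∈ ws) new
  absorb [] ds dist = return ([] , z≤n , subst Distinct (sym (++-identityʳ ds)) dist , [] , [] , [])
  absorb (w ∷ ws) ds dist = do
    new , le , dist′ , apart , cover , ⊆ws ← absorb ws ds dist
    no w∉ ← classify (Any (w ≈_) (ds ++ new))
      where yes w∈ → return (new , m≤n⇒m≤1+n le , dist′ , apart , w∈ ∷ cover , All.map there ⊆ws)
    let eq : (ds ++ new) ++ w ∷ [] ≡ ds ++ (new ++ w ∷ [])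
        eq = ++-assoc ds new (w ∷ [])
        w≉ : All (λ e → ¬ (e ≈ w)) (ds ++ new)
        w≉ = All.map (λ w≉e e≈w → w≉e (Eq.sym e≈w)) (All.¬Any⇒All¬ (ds ++ new) w∉)
    return (new ++ w ∷ [] ,
      ≤-trans (≤-reflexive (trans (length-++ new) (+-comm (length new) 1))) (s≤s le) ,
      subst Distinct eq (AllPairs.++⁺ dist′ ([] ∷ []) (All.map (_∷ []) w≉)) ,
      All.++⁺ apart (All.++⁻ˡ ds w≉ ∷ []) ,
      subst (Any (w ≈_)) eq (Any.++⁺ʳ (ds ++ new) (here Eq.refl)) ∷
        All.map (λ {w′} c → subst (Any (w′ ≈_)) eq (Any.++⁺ˡ c)) cover ,
      All.++⁺ (All.map there ⊆ws) (here refl ∷ []))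

  start : ∀ i {t x} → t ≤ i + k → ¬¬ ∃[ ds ] length ds ≤ suc (i + k) * suc r × Values i (v t x ∷ ds)
  start i {t} {x} t≤ = do
    ds , le , dist , _ , cover , ⊆ws ← absorb ws (v t x ∷ []) ([] ∷ [])
    return (ds , ≤-trans le (≤-reflexive length-ws) , record
      { different = dist
      ; covers    = λ t x t≤ → return (All.lookup cover (∈-cartesianProductWith⁺ v (∈-upTo⁺ (s≤s t≤)) (∈-allFin x)))
      ; occurs    = (t , x , t≤ , Eq.refl) ∷ All.map occ-ws ⊆ws })
    where
    ws : List D
    ws = cartesianProductWith v (upTo (suc (i + k))) (allFin (suc r))
    length-ws : length ws ≡ suc (i + k) * suc r
    length-ws = trans (length-cartesianProductWith v (upTo (suc (i + k))) (allFin (suc r)))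
      (cong₂ _*_ (length-upTo (suc (i + k))) (length-tabulate {n = suc r} id))
    occ-ws : ∀ {d} → d ∈ ws → ∃[ t ] ∃[ x ] t ≤ i + k × v t x ≈ d
    occ-ws d∈ with t , x , t∈ , _ , refl ← ∈-cartesianProductWith⁻ v (upTo (suc (i + k))) (allFin (suc r)) d∈ =
      t , x , ≤-pred (∈-upTo⁻ t∈) , Eq.refl

  -- Only the time `suc i + k` is new, with one value for each remote variable. That the added
  -- values differ from all old ones is what makes them parked at time `i`.
  grow : ∀ {i ds} → Values i ds → ¬¬ ∃[ new ] length new ≤ suc r × Values (suc i) (ds ++ new) ×
    All (λ d → All (λ e → ¬ (e ≈ d)) ds) new
  grow {i} {ds} vals = do
    new , le , dist , apart , cover , ⊆ws ← absorb ws ds (different vals)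
    let covers′ : ∀ t x → t ≤ suc i + k → ¬¬ Any (v t x ≈_) (ds ++ new)
        covers′ t x t≤ = [ (λ t< → Any.++⁺ˡ <$> covers vals t x (≤-pred t<)) ,
                           (λ { refl → return (All.lookup cover (∈-map⁺ (v (suc i + k)) (∈-allFin x))) }) ]′ (m≤n⇒m<n∨m≡n t≤)
        occurs′ : ∀ {d} → d ∈ ws → ∃[ t ] ∃[ x ] t ≤ suc i + k × v t x ≈ d
        occurs′ d∈ = let x , _ , eq = ∈-map⁻ (v (suc i + k)) d∈ in suc i + k , x , ≤-refl , Eq.reflexive (sym eq)
    return (new , ≤-trans le (≤-reflexive (trans (length-map _ (allFin (suc r))) (length-tabulate {n = suc r} id))) , record
      { different = dist
      ; covers    = covers′
      ; occurs    = All.++⁺ (All.map (λ (t , x , t≤ , p) → t , x , m≤n⇒m≤1+n t≤ , p) (occurs vals)) (All.map occurs′ ⊆ws) } ,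
      apart)
    where
    ws : List D
    ws = map (v (suc i + k)) (allFin (suc r))

  module _ {i : ℕ} (j : Fin (suc k)) (x : Fin (suc r)) where

    private
      w : D
      w = v (i + toℕ j) x

    cnt≡0 : ∀ {ds c} → All (λ d → ¬ (w ≈ d)) ds → Pointwise (IsStat i) ds c → cnt j x c ≡ 0
    cnt≡0 [] [] = refl
    cnt≡0 (w≉d ∷ w≉) (h ∷ hs) = cong₂ _+_ (cong bit (records⇒false (occ-at h j x) w≉d)) (cnt≡0 w≉ hs)

    cnt≤1 : ∀ {ds c} → Distinct ds → Pointwise (IsStat i) ds c → cnt j x c ≤ 1
    cnt≤1 [] [] = z≤n
    cnt≤1 {c = s ∷ c} (d≉ ∷ dist) (h ∷ hs) with occ s j x | occ-at h j x
    ... | false | _   = cnt≤1 dist hs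
    ... | true  | w≈d = ≤-reflexive (cong suc (cnt≡0 (All.map (λ d≉e w≈e → w≈d λ w≈d → d≉e (Eq.trans (Eq.sym w≈d) w≈e)) d≉) hs))

    cnt>0 : ∀ {ds c} → Any (w ≈_) ds → Pointwise (IsStat i) ds c → 1 ≤ cnt j x c
    cnt>0 (here w≈d) (h ∷ hs) rewrite records⇒true (occ-at h j x) (return w≈d) = s≤s z≤n
    cnt>0 (there p)  (h ∷ hs) = m≤n⇒m≤o+n _ (cnt>0 p hs)

  Values-Valid : ∀ {i ds c} → Values i ds → Pointwise (IsStat i) ds c → Valid c
  Values-Valid {i} vals hs j x = ≤-antisym (cnt≤1 j x (different vals) hs)
    -- Validity compares numbers and is therefore stable: the double negation of `covers` disappears
    -- here.
    (decidable-stable (1 ≤? _) ((λ p → cnt>0 j x p hs) <$> covers vals (i + toℕ j) x (+-monoʳ-≤ i (≤-pred (toℕ<n j)))))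

  record IsControl (i : ℕ) (q : Control) : Set ℓ where
    constructor isControl
    field
      truth-at : Truth V i φ (proj₁ q)
      order-at : IsOrderType i (proj₂ q)

  control-at : ∀ i → ¬¬ ∃ (IsControl i)
  control-at i = do
    t , h ← Truth-exists V i φ
    M , m ← orderType i
    return ((t , M) , isControl h m)

  IsControl-unique : ∀ {i q q′} → IsControl i q → IsControl i q′ → q ≡ q′
  IsControl-unique (isControl h m) (isControl h′ m′) = cong₂ _,_ (Truth-unique φ h h′)
    (vec-ext λ p → vec-ext λ q → records-unique (m p q) (m′ p q))

  pointwise-∈ˡ : ∀ {i ds c} {P : D → Set ℓ} → Any P ds → Pointwise (IsStat i) ds c → ∃[ d ] ∃[ s ] P d × s ∈ c × IsStat i d s
  pointwise-∈ˡ (here p)  (h ∷ hs) = _ , _ , p , here refl , h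
  pointwise-∈ˡ (there p) (h ∷ hs) = let d , s , q , s∈ , h′ = pointwise-∈ˡ p hs in d , s , q , there s∈ , h′

  pointwise-∈ʳ : ∀ {i ds c s} → s ∈ c → Pointwise (IsStat i) ds c → ∃[ d ] d ∈ ds × IsStat i d s
  pointwise-∈ʳ (here refl) (h ∷ hs) = _ , here refl , h
  pointwise-∈ʳ (there p)   (h ∷ hs) = let d , d∈ , h′ = pointwise-∈ʳ p hs in d , there d∈ , h′

  Holds⇔V : ∀ {i M ds c} → IsOrderType i M → Values i ds → Pointwise (IsStat i) ds c →
    ∀ a → (V i a → ¬¬ Holds M c a) × (Holds M c a → ¬¬ V i a)
  Holds⇔V {M = M} om vals hs (loc≈ x j y) = return ∘ ≈⇒equal M om x y j , return ∘ equal⇒≈ M om x y j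
  Holds⇔V {M = M} om vals hs (loc< x j y) =
    (λ p → return (records⇒true (records-≺ M om x y j) (return p))) , records-true (records-≺ M om x y j)
  Holds⇔V {i} om vals hs (rem≈ x j y) =
    (λ x≈y → do
      p ← covers vals i x (m≤m+n i k)
      let d , s , x≈d , s∈ , h = pointwise-∈ˡ p hs
      return (lose s∈ (records⇒true (occ-at h zero x) (return (subst (λ t → v t x ≈ d) (sym (+-identityʳ i)) x≈d)) ,
                       records⇒true (occ-at h j y) (return (Eq.trans (Eq.sym x≈y) x≈d))))) ,
    (λ any → do
      let s , s∈ , o , o′ = find any
          d , d∈ , h = pointwise-∈ʳ s∈ hs
      x≈d ← records-true (occ-at h zero x) o
      y≈d ← records-true (occ-at h j y) o′
      return (Eq.trans (subst (λ t → v t x ≈ d) (+-identityʳ i) x≈d) (Eq.sym y≈d)))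
  Holds⇔V {i} om vals hs (remF x y) =
    (λ (t , i<t , x≈y) → do
      p ← covers vals i x (m≤m+n i k)
      let d , s , x≈d , s∈ , h = pointwise-∈ˡ p hs
      return (lose s∈ (records⇒true (occ-at h zero x) (return (subst (λ t → v t x ≈ d) (sym (+-identityʳ i)) x≈d)) ,
                       later-at h i<t (Eq.trans (Eq.sym x≈y) x≈d) (i + k <? t)))) ,
    (λ any → do
      let s , s∈ , o , o′ = find any
          d , d∈ , h = pointwise-∈ʳ s∈ hs
      x≈d ← records-true (occ-at h zero x) o
      t , i<t , y≈d ← at-later h o′
      return (t , i<t , Eq.trans (subst (λ t → v t x ≈ d) (+-identityʳ i) x≈d) (Eq.sym y≈d)))
    where
    later-at : ∀ {d s t} → IsStat i d s → i < t → v t y ≈ d → Dec (i + k < t) → Later s y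
    later-at h i<t y≈d (yes far) = inj₁ (records⇒true (fut-at h y) (return (_ , far , y≈d)))
    later-at {d} h i<t y≈d (no near) = let j , shape = window-index i<t near in
      inj₂ (j , records⇒true (occ-at h (suc j) y) (return (subst (λ t → v t y ≈ d) (sym shape) y≈d)))
    at-later : ∀ {d s} → IsStat i d s → Later s y → ¬¬ ∃[ t ] (i < t × v t y ≈ d)
    at-later h (inj₁ f) = (λ (t , lt , p) → t , ≤-trans (s≤s (m≤m+n i k)) lt , p) <$> records-true (fut-at h y) f
    at-later h (inj₂ (j , o)) = (λ p → i + suc (toℕ j) , ≤-trans (s≤s (m≤m+n i (toℕ j))) (≤-reflexive (sym (+-suc i _))) , p)
      <$> records-true (occ-at h (suc j) y) o

  Ok-at : ∀ {i q ds c} → IsControl i q → Values i ds → Pointwise (IsStat i) ds c → Ok q c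
  Ok-at {i} {t , M} {ds} {c} (isControl h om) vals hs = Values-Valid vals hs , isStrictWeak {M = M} om ,
    Atoms-map (λ a r → let to , from = Holds⇔V om vals hs a in records-does r (Holds? M c a) to from)
      φ t (Truth-Atoms V φ t h)

  Describes : ℕ → D → Conf → Set _
  Describes i d (q , s , c) = ∃[ ds ] Values i (d ∷ ds) × IsStat i d s × Pointwise (IsStat i) ds c × IsControl i q

  Describes-Ok : ∀ {i d q s c} → Describes i d (q , s , c) → Ok q (s ∷ c)
  Describes-Ok (ds , vals , h , hs , hq) = Ok-at hq vals (h ∷ hs)

  describe : ∀ i {t x q} → t ≤ i + k → IsControl i q →
    ¬¬ ∃[ s ] ∃[ c ] length c ≤ suc (i + k) * suc r × Describes i (v t x) (q , s , c)
  describe i {t} {x} t≤ hq = do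
    ds , le , vals ← start i t≤
    s , h ← stat i (v t x)
    c , hs ← stats i ds
    return (s , c , ≤-trans (≤-reflexive (sym (Pointwise-length hs))) le , ds , vals , h , hs , hq)

  Pointwise-Next : ∀ {i ds c c′} → Pointwise (IsStat i) ds c → Pointwise (IsStat (suc i)) ds c′ → Pointwise Next c c′
  Pointwise-Next []       []         = []
  Pointwise-Next (h ∷ hs) (h′ ∷ hs′) = IsStat-Next h h′ ∷ Pointwise-Next hs hs′

  new-parked : ∀ {i ds new f} → Values i ds → All (λ d → All (λ e → ¬ (e ≈ d)) ds) new →
    Pointwise (IsStat i) new f → All Parked f
  new-parked vals [] [] = []
  new-parked {i} vals (d≉ ∷ apart) (h ∷ hs) = (λ j x → records⇒false (occ-at h j x) λ w≈d →
    covers vals (i + toℕ j) x (+-monoʳ-≤ i (≤-pred (toℕ<n j))) λ any →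
      let e , e∈ , w≈e = find any in All.lookup d≉ e∈ (Eq.trans (Eq.sym w≈e) w≈d)) ∷ new-parked vals apart hs

  describe-step : ∀ {i d x} → Describes i d x → ¬¬ ∃[ y ] x ⟶ y × Describes (suc i) d y
  describe-step {i} {d} {(t , M) , s , c} desc@(ds , vals , h , hs , hq@(isControl ht hM)) = do
    new , le , vals′ , apart ← grow vals
    f , hf ← stats i new
    s′ , h′ ← stat (suc i) d
    c′ , hs′ ← stats (suc i) (ds ++ new)
    (t′ , M′) , hq′@(isControl ht′ hM′) ← control-at (suc i)
    let desc′ = ds ++ new , vals′ , h′ , hs′ , hq′
    return (((t′ , M′) , s′ , c′) ,
      (Describes-Ok desc , Describes-Ok desc′ ,
       (Truth-Succ V φ t t′ ht ht′ , isShift {M = M} {M′ = M′} hM hM′) , IsStat-Next h h′ ,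
       f , ≤-trans (≤-reflexive (sym (Pointwise-length hf))) le , new-parked vals apart hf ,
       Pointwise-Next (Pointwise.++⁺ hs hf) hs′) ,
      desc′)

  -- Only finitely many descriptions are chosen, so their double negations compose.
  walk : ∀ n {i d x} {A : Conf → Set} → Describes i d x → (∀ y → Describes (n + i) d y → ¬¬ A y) → ¬¬ Reach A n x
  walk zero    desc arrive = arrive _ desc
  walk (suc n) {i} {d} desc arrive = do
    y , st , desc′ ← describe-step desc
    rch ← walk n desc′ λ z desc″ → arrive z (subst (λ m → Describes m d z) (+-suc n i) desc″)
    return (y , st , rch)

  walk-to : ∀ {i j d x} {A : Conf → Set} → i ≤ j → Describes i d x → (∀ y → Describes j d y → ¬¬ A y) →
    ¬¬ ∃[ n ] Reach A n x
  walk-to {i} {j} {d} i≤j desc arrive = (j ∸ i ,_) <$>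
    walk (j ∸ i) desc λ y desc′ → arrive y (subst (λ m → Describes m d y) (m∸n+n≡m i≤j) desc′)

  Occurring : ℕ → Stat → Set ℓ
  Occurring i s = ∃[ t ] ∃[ x ] t ≤ i + k × IsStat i (v t x) s

  Describes-occurring : ∀ {i d q s c} → Describes i d (q , s , c) → ∀ {u} → u ∈ s ∷ c → Occurring i u
  Describes-occurring (ds , vals , h , hs , _) u∈ with d , d∈ , h′ ← pointwise-∈ʳ u∈ (h ∷ hs)
    with t , x , t≤ , p ← All.lookup (occurs vals) d∈ = t , x , t≤ , IsStat-≈ (Eq.sym p) h′

  -- Whichever value is followed and whichever representatives are listed, the set of statuses at
  -- time `i` is the same, so a profile can speak of `Occurring` alone. Membership is decidable,
  -- which removes the double negation.
  occurring-∈ : ∀ {i d q s c} → Describes i d (q , s , c) → ∀ {u} → Occurring i u → u ∈ s ∷ c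
  occurring-∈ {s = s} {c} (ds , vals , h , hs , _) {u} (t , x , t≤ , hu) =
    decidable-stable (Any.any? (u ≟ˢ_) (s ∷ c)) do
      p ← covers vals t x t≤
      let e , u′ , t≈e , u′∈ , h′ = pointwise-∈ˡ p (h ∷ hs)
      return (subst (_∈ s ∷ c) (IsStat-unique h′ (IsStat-≈ t≈e hu)) u′∈)

  record Profile (i : ℕ) (qP : Control × List Stat) : Set ℓ where
    private
      q = proj₁ qP
      P = proj₂ qP
    field
      control-ok : IsControl i q
      unique    : Unique P
      small     : length P ≤ length (Finite.elems Stat-finite)
      occurring : ∀ {s} → s ∈ P → Occurring i s
      all-occur : ∀ {s} → Occurring i s → s ∈ P
  open Profile

  collect : ∀ i (es : List Stat) → ¬¬ ∃[ P ] length P ≤ length es × Unique P ×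
    All (Occurring i) P × All (λ s → Occurring i s → s ∈ P) es
  collect i [] = return ([] , z≤n , [] , [] , [])
  collect i (e ∷ es) = do
    P , le , uniq , occ , all ← collect i es
    yes o ← classify (Occurring i e)
      where no ¬o → return (P , m≤n⇒m≤1+n le , uniq , occ , (λ o → contradiction o ¬o) ∷ all)
    no e∉ ← return (Any.any? (e ≟ˢ_) P)
      where yes e∈ → return (P , m≤n⇒m≤1+n le , uniq , occ , const e∈ ∷ all)
    return (e ∷ P , s≤s le , All.¬Any⇒All¬ P e∉ ∷ uniq , o ∷ occ ,
      const (here refl) ∷ All.map (there ∘_) all)

  candidates : List (Control × List Stat)
  candidates = cartesianProduct (Finite.elems Control-finite) (lists≤ Stat-finite (length (Finite.elems Stat-finite)))

  profile : ∀ i → ¬¬ Any (Profile i) candidates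
  profile i = do
    q , hq ← control-at i
    P , le , uniq , occ , all ← collect i (Finite.elems Stat-finite)
    return (lose (∈-cartesianProduct⁺ (Finite.complete Control-finite q) (∈-lists≤ Stat-finite P le)) record
      { control-ok = hq ; unique = uniq ; small = le ; occurring = All.lookup occ
      ; all-occur = λ {s} → All.lookup all (Finite.complete Stat-finite s) })

  -- Fairness conditions recur by `Truth-fair`. A pending promise refers to some `t` beyond `i + k`,
  -- which is the `top` of the window that begins at `t ∸ k`; if none is pending, the next moment
  -- will do.
  goal-time : ∀ {i d s g} → g ∈ goals → IsStat i d s → ¬¬ ∃[ j ] suc i ≤ j ×
    (∀ q′ s′ → IsControl j q′ → IsStat j d s′ → g s q′ s′ ≡ true)
  goal-time {i} {d} {s} g∈ h with ∈-++⁻ (map fair (fairness φ)) g∈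
  ... | inj₁ g∈′ with f , f∈ , refl ← ∈-map⁻ fair g∈′ =
    (λ (j , i≤j , f-true) → j , i≤j , λ (t , _) _ (isControl ht _) _ → f-true t ht) <$> All.lookup (Truth-fair V φ) f∈ (suc i)
  ... | inj₂ g∈′ with y , _ , refl ← ∈-map⁻ see g∈′ with fut s y in eq
  ... | false = return (suc i , ≤-refl , λ _ _ _ _ → refl)
  ... | true = do
    t , lt , p ← records-true (fut-at h y) eq
    let k≤t = ≤-trans (m≤n+m k (suc i)) lt
    return (t ∸ k , m+n≤o⇒m≤o∸n (suc i) lt , λ q′ s′ _ h′ → records⇒true (occ-at h′ top y)
      (return (subst (λ n → v n y ≈ d) (sym (trans (cong (t ∸ k +_) (toℕ-fromℕ k)) (m∸n+n≡m k≤t))) p)))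

  arrive : ∀ {q P i d x} → Describes i d x → Profile i (q , P) → proj₁ x ≡ q × Within q P x
  arrive {q} {x = q′ , _} desc@(_ , _ , _ , _ , hq) pr with refl ← IsControl-unique {q = q′} {q} hq (control-ok pr) =
    refl , refl , All.tabulate (λ u∈ → all-occur pr (Describes-occurring desc u∈)) , Describes-Ok desc

  module _ {q : Control} {P : List Stat} (cofinal : Cofinal λ i → Profile i (q , P)) where

    -- The value is followed in the model until the goal is met, and then on to a moment with the
    -- same profile. The first step is split off because a loop must not be empty.
    loop : ∀ {i d s c g} → g ∈ goals → Describes i d (q , s , c) → ¬¬ Loop q P (s , c) g
    loop {i} {d} {s} {c} {g} g∈ desc@(_ , _ , h , _) = do
      j , i<j , met ← goal-time g∈ h
      y , st , desc′ ← describe-step desc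
      rch ← walk-to i<j desc′ λ where
        z@(q′ , s′ , _) desc″@(_ , _ , h′ , _ , hq′) → do
          i′ , j≤i′ , pr ← cofinal j
          back ← walk-to j≤i′ desc″ λ w desc‴ → return (proj₂ (arrive desc‴ pr))
          return (met q′ s′ hq′ h′ , back)
      return (y , st , rch)

    -- `P` has each status of `s ∷ c` once, so `rest` is a sub-multiset of `c`. Validity survives:
    -- every status that fills a position is in `P`, and dropping copies cannot fill a position
    -- twice.
    pick-≼ : ∀ {i d s rest c} → Profile i (q , P) → s ∷ rest ↭ P → Describes i d (q , s , c) → (q , s , rest) ≼ (q , s , c)
    pick-≼ {i} {d} {s} {rest} {c} pr perm desc with s∉ ∷ uniq ← Unique-↭ (↭-sym perm) (unique pr) =
      (refl , refl , e , rest++e) , does-⇔ (mk⇔ (const okc) (const okr)) (Ok? q (s ∷ rest)) (Ok? q (s ∷ c))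
      where
      okc : Ok q (s ∷ c)
      okc = Describes-Ok desc
      rest⊆ : ∀ {u} → u ∈ rest → u ∈ c
      rest⊆ u∈ with occurring-∈ desc (occurring pr (∈-resp-↭ perm (there u∈)))
      ... | here refl = contradiction refl (All.lookup s∉ u∈)
      ... | there u∈c = u∈c
      e : List Stat
      e = proj₁ (Unique⇒⊑ uniq rest⊆)
      rest++e : rest ++ e ↭ c
      rest++e = proj₂ (Unique⇒⊑ uniq rest⊆)
      perm′ : (s ∷ rest) ++ e ↭ (s ∷ c) ++ []
      perm′ = prep s (↭-trans rest++e (↭-reflexive (sym (++-identityʳ c))))
      valid : Valid (s ∷ rest)
      valid j x = ≤-antisym
        (≤-trans (m≤m+n _ (cnt j x e)) (≤-reflexive (trans (sym (cnt-++ j x (s ∷ rest) e))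
          (trans (cnt-↭ j x (prep s rest++e)) (proj₁ okc j x)))))
        (let w , w∈ , o = cnt≥1⇒∈ j x (s ∷ c) (≤-reflexive (sym (proj₁ okc j x))) in
          cnt≥1 j x (∈-resp-↭ (↭-sym perm) (all-occur pr (Describes-occurring desc w∈))) o)
      okr : Ok q (s ∷ rest)
      okr = Ok-extras (extras-parked valid (proj₁ okc) [] perm′) [] perm′ okc

    -- A status in `P` belongs to some value `v t x` of the model, whose loop starts from a
    -- configuration with all multiplicities; `simulate` brings it down to the representative with
    -- single copies.
    loop-pick : ∀ {pick g} → pick ∈ picks P → g ∈ goals → ¬¬ Loop q P pick g
    loop-pick {s , rest} {g} pick∈ g∈ = do
      let perm = picks-↭ P pick∈
      i , _ , pr ← cofinal 0
      let t , x , t≤ , h = occurring pr (∈-resp-↭ perm (here refl))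
      s′ , c , _ , desc ← describe i t≤ (control-ok pr)
      let desc′ = subst (λ s → Describes i (v t x) (q , s , c)) (IsStat-unique (proj₁ (proj₂ (proj₂ desc))) h) desc
      y , st , n , rch ← loop g∈ desc′
      let y′ , st′ , y′≼y = simulate (pick-≼ pr perm desc′) st
      return (y′ , st′ , n , Reach-closed (Met? q P g s) (Met-closed q P g s) n y′≼y rch)

    isGood : ¬¬ Good q P
    isGood = ¬¬-All (All.tabulate λ pick∈ → ¬¬-All (All.tabulate λ g∈ → loop-pick pick∈ g∈))

  model⇒accepted : Sem V 0 φ → ¬¬ Accepted
  model⇒accepted sem = do
    (q , P) , cofinal ← infinite-pigeonhole candidates profile
    good ← isGood cofinal
    q₀@(t₀ , _) , hq₀@(isControl ht₀ _) ← control-at 0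
    s , c , le , desc ← describe 0 {0} {zero} z≤n hq₀
    i , _ , pr ← cofinal 0
    rch ← walk-to z≤n desc λ y desc′ → return (reached good pr y desc′)
    return (q₀ , s , c , le , Truth-Initial V φ t₀ ht₀ , records⇒true (Truth-val V φ t₀ ht₀) (return sem) , rch)
    where
    reached : ∀ {q P} → Good q P → ∀ {i d} → Profile i (q , P) → ∀ y → Describes i d y → Target y
    reached {P = P} good pr y@(q′ , _) desc with refl , within ← arrive {x = y} desc pr = P , small pr , within , good

-- From accepting runs to models

module Soundness {a ℓ : Level} (𝒟 : ConstraintSystem a ℓ) (d₀ : ConstraintSystem.Carrier 𝒟)
  (sto : IsStrictlyTotallyOrdered 𝒟) (dense : IsDense 𝒟) (isOpen : IsOpen 𝒟)
  {l r k : ℕ} (φ : LTL (Atom l r k)) where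
  open ConstraintSystem 𝒟 renaming (Carrier to D)
  open IsStrictlyTotallyOrdered sto
  open IsStrictPartialOrder isStrictPartialOrder
    using (module Eq) renaming (trans to ≺-trans; irrefl to ≺-irrefl)
  open Windows l k
  open Statuses r k
  open Machine φ
  open Run φ
  open RunModel φ
  open LocalModel 𝒟 d₀ sto dense isOpen l k using (module Realisation)
  open Valuation 𝒟 l r k

  -- Different numbers need different values; climbing by openness supplies them in increasing
  -- order.
  chain : ℕ → D
  chain zero    = d₀
  chain (suc n) = proj₁ (proj₂ (isOpen (chain n)))

  chain-suc : ∀ n → chain n ≺ chain (suc n)
  chain-suc n = proj₂ (proj₂ (proj₂ (isOpen (chain n))))

  chain-mono : ∀ {m n} → m < n → chain m ≺ chain n
  chain-mono {m} {suc n} m<1+n with m<1+n⇒m<n∨m≡n m<1+n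
  ... | inj₁ m<n  = ≺-trans (chain-mono m<n) (chain-suc n)
  ... | inj₂ refl = chain-suc n

  chain-injective : ∀ {m n} → chain m ≈ chain n → m ≡ n
  chain-injective {m} {n} eq with <-cmp m n
  ... | tri< m<n _ _ = contradiction (chain-mono m<n) (≺-irrefl eq)
  ... | tri≈ _ m≡n _ = m≡n
  ... | tri> _ _ n<m = contradiction (chain-mono n<m) (≺-irrefl (Eq.sym eq))

  chain-cong : ∀ {m n} → m ≡ n → chain m ≈ chain n
  chain-cong refl = Eq.refl

  Reach-Target : ∀ n {x} → Reach Target n x → ∃[ q ] ∃[ P ] Good q P × Reach (Within q P) n x
  Reach-Target zero    (P , _ , within , good) = _ , P , good , within
  Reach-Target (suc n) (y , st , rch) = let q , P , good , rch′ = Reach-Target n rch in q , P , good , y , st , rch′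

  initialState : Conf → State
  initialState (q , s , c) = record
    { control   = q
    ; followed  = 0
    ; ids       = upFrom 1 (length c)
    ; status    = s
    ; others    = c
    ; bound     = suc (length c) + 0
    ; same-size = length-upFrom 1 (length c)
    ; distinct  = upFrom-unique 0 (suc (length c))
    ; bounded   = upFrom-< 0 (suc (length c))
    ; queue     = cartesianProduct (upFrom 0 (suc (length c))) goals
    ; queued    = ∈-cartesianProduct⁺
    ; sound     = All.tabulate (∈-cartesianProduct⁻ _ goals)
    }

  sound : Accepted → ∃[ u ] ∃[ v ] Sem (eval u v) 0 φ
  sound (q₀ , s₀ , c₀ , _ , initial , accepting , n , rch) with q , P , good , plan ← Reach-Target n rch =
    u , v , reflects-true (truth (eval u v) φ bits initial succ atoms (run-fair good ρ₀) 0) accepting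
    where
    open Scheduler good using (Running; run; step-⇝)
    ρ₀ : Running
    ρ₀ = initialState (q₀ , s₀ , c₀) , n , plan
    control : ℕ → Control
    control i = State.control (τ good ρ₀ i)
    bits : ℕ → Bits φ
    bits i = proj₁ (control i)
    succ : ∀ i → Succ φ (bits i) (bits (suc i))
    succ i = proj₁ (proj₁ (step-⇝ (run ρ₀ i)))
    open Realisation (proj₂ ∘ control) (λ i → proj₁ (proj₂ (ok good ρ₀ i))) (λ i → proj₂ (proj₁ (step-⇝ (run ρ₀ i))))
    u : ℕ → Fin (suc l) → D
    u = value
    v : ℕ → Fin (suc r) → D
    v i x = chain (owner good ρ₀ i x)
    atom-reflects : ∀ i a → Reflects (eval u v i a) (does (Holds? (M good ρ₀ i) (all good ρ₀ i) a))
    atom-reflects i at@(loc≈ x j y) = reflects-map (value-≈ i x y j) (value-≈⁻ i x y j)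
      (proof (Holds? (M good ρ₀ i) (all good ρ₀ i) at))
    atom-reflects i at@(loc< x j y) = reflects-map (reflects-true (value-≺ i x y j)) (reflects⇒true (value-≺ i x y j))
      (proof (Holds? (M good ρ₀ i) (all good ρ₀ i) at))
    atom-reflects i (rem≈ x j y) = reflects-map chain-cong chain-injective (rem≈-reflects good ρ₀ i x j y)
    atom-reflects i (remF x y) = reflects-map
      (λ (t , i<t , eq) → t , i<t , chain-cong eq) (λ (t , i<t , eq) → t , i<t , chain-injective eq)
      (remF-reflects good ρ₀ i x y)
    atoms : ∀ i → Atoms (λ a b → Reflects (eval u v i a) b) φ (bits i)
    atoms i = Atoms-map (λ a eq → subst (Reflects (eval u v i a)) (sym eq) (atom-reflects i a)) φ (bits i)
      (proj₂ (proj₂ (ok good ρ₀ i)))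

-- Translation into formulas with finitely many variables and bounded offsets

module _ {X : Set} (_≟ˣ_ : DecidableEquality X) where

  -- The index zero is reserved for the variables that do not occur in xs.
  index : (xs : List X) → X → Fin (suc (length xs))
  index xs x with Any.any? (x ≟ˣ_) xs
  ... | yes x∈ = suc (Any.index x∈)
  ... | no _   = zero

  extend : ∀ {d} {D : Set d} (xs : List X) → D → (X → D) → Fin (suc (length xs)) → D
  extend xs d f zero    = d
  extend xs d f (suc n) = f (List.lookup xs n)

  extend-index : ∀ {d} {D : Set d} {xs x} {d₀ : D} {f : X → D} → x ∈ xs → extend xs d₀ f (index xs x) ≡ f x
  extend-index {xs = xs} {x} {f = f} x∈ with Any.any? (x ≟ˣ_) xs
  ... | yes x∈′ = cong f (sym (Any.lookup-index x∈′))
  ... | no x∉   = contradiction x∈ x∉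

-- The default `zero` is harmless, as `k` will be the largest offset in the formula.
clamp : ∀ k → ℕ → Fin (suc k)
clamp k j with j ≤? k
... | yes j≤k = fromℕ< (s≤s j≤k)
... | no _    = zero

toℕ-clamp : ∀ {k j} → j ≤ k → toℕ (clamp k j) ≡ j
toℕ-clamp {k} {j} j≤k with j ≤? k
... | yes p = toℕ-fromℕ< (s≤s p)
... | no ¬p = contradiction j≤k ¬p

module _ {L R : Set} where

  locals : Formula L R → List L
  locals (x ≈loc𝐗^[ j ] y) = x ∷ y ∷ []
  locals (x <loc𝐗^[ j ] y) = x ∷ y ∷ []
  locals (x ≈rem𝐗^[ j ] y) = []
  locals (x ≈rem𝐗𝐅 y)      = []
  locals (φ ∧ᶠ ψ)          = locals φ ++ locals ψ
  locals (¬ᶠ φ)            = locals φ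
  locals (𝐗 φ)             = locals φ
  locals (φ 𝐔 ψ)           = locals φ ++ locals ψ
  locals (𝐗⁻¹ φ)           = locals φ
  locals (φ 𝐒 ψ)           = locals φ ++ locals ψ

  remotes : Formula L R → List R
  remotes (x ≈loc𝐗^[ j ] y) = []
  remotes (x <loc𝐗^[ j ] y) = []
  remotes (x ≈rem𝐗^[ j ] y) = x ∷ y ∷ []
  remotes (x ≈rem𝐗𝐅 y)      = x ∷ y ∷ []
  remotes (φ ∧ᶠ ψ)          = remotes φ ++ remotes ψ
  remotes (¬ᶠ φ)            = remotes φ
  remotes (𝐗 φ)             = remotes φ
  remotes (φ 𝐔 ψ)           = remotes φ ++ remotes ψ
  remotes (𝐗⁻¹ φ)           = remotes φ
  remotes (φ 𝐒 ψ)           = remotes φ ++ remotes ψ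

  offset : Formula L R → ℕ
  offset (x ≈loc𝐗^[ j ] y) = j
  offset (x <loc𝐗^[ j ] y) = j
  offset (x ≈rem𝐗^[ j ] y) = j
  offset (x ≈rem𝐗𝐅 y)      = 0
  offset (φ ∧ᶠ ψ)          = offset φ ⊔ offset ψ
  offset (¬ᶠ φ)            = offset φ
  offset (𝐗 φ)             = offset φ
  offset (φ 𝐔 ψ)           = offset φ ⊔ offset ψ
  offset (𝐗⁻¹ φ)           = offset φ
  offset (φ 𝐒 ψ)           = offset φ ⊔ offset ψ

  module Translation {l r : ℕ} (k : ℕ) (loc : L → Fin (suc l)) (rem : R → Fin (suc r)) where

    translate : Formula L R → LTL (Atom l r k)
    translate (x ≈loc𝐗^[ j ] y) = atom (loc≈ (loc x) (clamp k j) (loc y))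
    translate (x <loc𝐗^[ j ] y) = atom (loc< (loc x) (clamp k j) (loc y))
    translate (x ≈rem𝐗^[ j ] y) = atom (rem≈ (rem x) (clamp k j) (rem y))
    translate (x ≈rem𝐗𝐅 y)      = atom (remF (rem x) (rem y))
    translate (φ ∧ᶠ ψ)          = and (translate φ) (translate ψ)
    translate (¬ᶠ φ)            = neg (translate φ)
    translate (𝐗 φ)             = next (translate φ)
    translate (φ 𝐔 ψ)           = until (translate φ) (translate ψ)
    translate (𝐗⁻¹ φ)           = prev (translate φ)
    translate (φ 𝐒 ψ)           = since (translate φ) (translate ψ)

    module _ {a ℓ : Level} (𝒟 : ConstraintSystem a ℓ) where
      open ConstraintSystem 𝒟 renaming (Carrier to D)
      open Valuation 𝒟 l r k

      module _ (σ : Model 𝒟 {L} {R}) (u : ℕ → Fin (suc l) → D) (v : ℕ → Fin (suc r) → D) where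

        -- Agreement is asked only for variables of the formula, because all others share the index
        -- zero.
        record Agree (xs : List L) (ys : List R) (n : ℕ) : Set a where
          field
            local-agree  : ∀ {x} → x ∈ xs → ∀ i → u i (loc x) ≡ σ i (inj₁ x)
            remote-agree : ∀ {y} → y ∈ ys → ∀ i → v i (rem y) ≡ σ i (inj₂ y)
            bounded      : n ≤ k
        open Agree

        agreeˡ : ∀ {xs xs′ ys ys′ n n′} → Agree (xs ++ xs′) (ys ++ ys′) (n ⊔ n′) → Agree xs ys n
        agreeˡ {n = n} {n′} ag = record
          { local-agree  = λ x∈ → local-agree ag (∈-++⁺ˡ x∈)
          ; remote-agree = λ x∈ → remote-agree ag (∈-++⁺ˡ x∈)
          ; bounded      = m⊔n≤o⇒m≤o n n′ (bounded ag) }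

        agreeʳ : ∀ xs {xs′} ys {ys′ n n′} → Agree (xs ++ xs′) (ys ++ ys′) (n ⊔ n′) → Agree xs′ ys′ n′
        agreeʳ xs ys {n = n} {n′} ag = record
          { local-agree  = λ x∈ → local-agree ag (∈-++⁺ʳ xs x∈)
          ; remote-agree = λ x∈ → remote-agree ag (∈-++⁺ʳ ys x∈)
          ; bounded      = m⊔n≤o⇒n≤o n n′ (bounded ag) }

        Sem⇔⊨ : ∀ φ → Agree (locals φ) (remotes φ) (offset φ) → ∀ i →
          (_,_⊨_ 𝒟 σ i φ → Sem (eval u v) i (translate φ)) × (Sem (eval u v) i (translate φ) → _,_⊨_ 𝒟 σ i φ)
        Sem⇔⊨ (x ≈loc𝐗^[ j ] y) ag i
          rewrite toℕ-clamp (bounded ag) | local-agree ag (here refl) i | local-agree ag (there (here refl)) (i + j) = id , id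
        Sem⇔⊨ (x <loc𝐗^[ j ] y) ag i
          rewrite toℕ-clamp (bounded ag) | local-agree ag (here refl) i | local-agree ag (there (here refl)) (i + j) = id , id
        Sem⇔⊨ (x ≈rem𝐗^[ j ] y) ag i
          rewrite toℕ-clamp (bounded ag) | remote-agree ag (here refl) i | remote-agree ag (there (here refl)) (i + j) = id , id
        Sem⇔⊨ (x ≈rem𝐗𝐅 y) ag i rewrite remote-agree ag (here refl) i =
          (λ (t , lt , p) → t , lt , subst (σ i (inj₂ x) ≈_) (sym (remote-agree ag (there (here refl)) t)) p) ,
          (λ (t , lt , p) → t , lt , subst (σ i (inj₂ x) ≈_) (remote-agree ag (there (here refl)) t) p)
        Sem⇔⊨ (φ ∧ᶠ ψ) ag i =
          let to , from = Sem⇔⊨ φ (agreeˡ ag) i ; to′ , from′ = Sem⇔⊨ ψ (agreeʳ (locals φ) (remotes φ) ag) i in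
          (λ (p , q) → to p , to′ q) , (λ (p , q) → from p , from′ q)
        Sem⇔⊨ (¬ᶠ φ) ag i = let to , from = Sem⇔⊨ φ ag i in
          (λ ¬p → ¬p ∘ from) , (λ ¬p → ¬p ∘ to)
        Sem⇔⊨ (𝐗 φ) ag i rewrite +-comm i 1 = Sem⇔⊨ φ ag (suc i)
        Sem⇔⊨ (φ 𝐔 ψ) ag i =
          let agree = Sem⇔⊨ φ (agreeˡ ag) ; agree′ = Sem⇔⊨ ψ (agreeʳ (locals φ) (remotes φ) ag) in
          (λ (j , le , p , q) → j , le , proj₁ (agree′ j) p , λ l le lt → proj₁ (agree l) (q l le lt)) ,
          (λ (j , le , p , q) → j , le , proj₂ (agree′ j) p , λ l le lt → proj₂ (agree l) (q l le lt))
        Sem⇔⊨ (𝐗⁻¹ φ) ag i = let to , from = Sem⇔⊨ φ ag (i ∸ 1) in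
          (λ (le , p) → le , to p) , (λ (le , p) → le , from p)
        Sem⇔⊨ (φ 𝐒 ψ) ag i =
          let agree = Sem⇔⊨ φ (agreeˡ ag) ; agree′ = Sem⇔⊨ ψ (agreeʳ (locals φ) (remotes φ) ag) in
          (λ (j , le , p , q) → j , le , proj₁ (agree′ j) p , λ l le lt → proj₁ (agree l) (q l le lt)) ,
          (λ (j , le , p , q) → j , le , proj₂ (agree′ j) p , λ l le lt → proj₂ (agree l) (q l le lt))

-- The decision procedure

module _ {a ℓ : Level} {L R : Set} (_≟ˡ_ : DecidableEquality L) (_≟ʳ_ : DecidableEquality R)
  (𝒟 : ConstraintSystem a ℓ) (d₀ : ConstraintSystem.Carrier 𝒟)
  (sto : IsStrictlyTotallyOrdered 𝒟) (dense : IsDense 𝒟) (isOpen : IsOpen 𝒟) where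
  open ConstraintSystem 𝒟 using () renaming (Carrier to D)

  satisfiable? : Decidable (Satisfiable 𝒟 {L} {R})
  satisfiable? φ = decide (Machine.Accepted? ψ)
    where
    loc = index _≟ˡ_ (locals φ)
    rem = index _≟ʳ_ (remotes φ)
    open Translation (offset φ) loc rem
    ψ : LTL (Atom (length (locals φ)) (length (remotes φ)) (offset φ))
    ψ = translate φ
    decide : Dec (Machine.Accepted ψ) → Dec (Satisfiable 𝒟 φ)
    decide (yes acc) =
      let u , v , sem = Soundness.sound 𝒟 d₀ sto dense isOpen ψ acc
          σ = λ i → [ u i ∘ loc , v i ∘ rem ]′
      in yes (σ , proj₂ (Sem⇔⊨ 𝒟 σ u v φ record
           { local-agree = λ _ _ → refl ; remote-agree = λ _ _ → refl ; bounded = ≤-refl } 0) sem)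
    -- A model gives acceptance doubly negated, which is enough to contradict `¬acc`.
    decide (no ¬acc) = no λ (σ , sat) →
      let u = λ i → extend _≟ˡ_ (locals φ) d₀ (σ i ∘ inj₁)
          v = λ i → extend _≟ʳ_ (remotes φ) d₀ (σ i ∘ inj₂)
      in Completeness.model⇒accepted 𝒟 d₀ sto dense isOpen ψ u v (proj₁ (Sem⇔⊨ 𝒟 σ u v φ record
           { local-agree = λ x∈ i → extend-index _≟ˡ_ x∈ ; remote-agree = λ x∈ i → extend-index _≟ʳ_ x∈
           ; bounded = ≤-refl } 0) sat) ¬acc

-- The real numbers

open ℝ
open Equivalence using (to; from)

lower-upper-< : ∀ x {q r} → Lower x q → Upper x r → q <ℚ r
lower-upper-< x {q} {r} lo up with ℚ.<-cmp q r
... | tri< q<r _ _  = q<r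
... | tri≈ _ refl _ = contradiction (lo , up) (disjoint x q)
... | tri> _ _ r<q  = contradiction (from (lowerRounded x r) (q , r<q , lo) , up) (disjoint x r)

<ℝ-trans : ∀ {x y z} → x <ℝ y → y <ℝ z → x <ℝ z
<ℝ-trans {x} {y} {z} (q , xq , yq) (r , yr , zr) =
  q , xq , from (lowerRounded z q) (r , lower-upper-< y yq yr , zr)

ℝ-isStrictlyTotallyOrdered : IsStrictlyTotallyOrdered ℝ-constraintSystem
ℝ-isStrictlyTotallyOrdered = record
  { isStrictPartialOrder = record
    { isEquivalence = record
      { refl  = λ q → ⇔-id _ , ⇔-id _
      ; sym   = λ e q → ⇔-sym (proj₁ (e q)) , ⇔-sym (proj₂ (e q))
      ; trans = λ e f q → (proj₁ (f q) ⇔-∘ proj₁ (e q)) , (proj₂ (f q) ⇔-∘ proj₂ (e q)) }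
    ; irrefl = λ {x} e (q , xq , yq) → disjoint x q (from (proj₁ (e q)) yq , xq)
    ; trans  = λ {x} {y} {z} → <ℝ-trans {x} {y} {z}
    ; <-resp-≈ = (λ e (q , xq , yq) → q , xq , to (proj₁ (e q)) yq) ,
                 (λ e (q , xq , yq) → q , to (proj₂ (e q)) xq , yq) }
  ; connected = λ {x} {y} x≮y y≮x q →
      mk⇔ (lower {x} {y} y≮x) (lower {y} {x} x≮y) , mk⇔ (upper {x} {y} x≮y) (upper {y} {x} y≮x) }
  where
  -- Locatedness of `y` at `q` and `r` leaves two cases: `q` is below `y`, or `r` is above `y` and
  -- below `x`, a witness of y < x.
  lower : ∀ {x y q} → ¬ (y <ℝ x) → Lower x q → Lower y q
  lower {x} {y} {q} y≮x xq with r , q<r , xr ← to (lowerRounded x q) xq with located y q r q<r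
  ... | inj₁ yq = yq
  ... | inj₂ yr = contradiction (r , yr , xr) y≮x
  upper : ∀ {x y q} → ¬ (x <ℝ y) → Upper x q → Upper y q
  upper {x} {y} {q} x≮y xq with r , r<q , xr ← to (upperRounded x q) xq with located y r q r<q
  ... | inj₁ yr = contradiction (r , xr , yr) x≮y
  ... | inj₂ yq = yq

fromℚ : ℚ → ℝ
fromℚ p = record
  { Lower = _<ℚ p
  ; Upper = p <ℚ_
  ; lowerInhabited = p +ℚ - 1ℚ , subst (p +ℚ - 1ℚ <ℚ_) (ℚ.+-identityʳ p) (ℚ.+-monoʳ-< p (ℚ.negative⁻¹ (- 1ℚ)))
  ; upperInhabited = p +ℚ 1ℚ , subst (_<ℚ p +ℚ 1ℚ) (ℚ.+-identityʳ p) (ℚ.+-monoʳ-< p (ℚ.positive⁻¹ 1ℚ))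
  ; lowerRounded = λ q → mk⇔ ℚ.<-dense (λ (r , q<r , r<p) → ℚ.<-trans q<r r<p)
  ; upperRounded = λ q → mk⇔ (λ p<q → let r , p<r , r<q = ℚ.<-dense p<q in r , r<q , p<r)
                             (λ (r , r<q , p<r) → ℚ.<-trans p<r r<q)
  ; disjoint = λ q (q<p , p<q) → ℚ.<-asym q<p p<q
  ; located = located-at }
  where
  located-at : ∀ q r → q <ℚ r → _
  located-at q r q<r with ℚ.<-cmp q p
  ... | tri< q<p _ _  = inj₁ q<p
  ... | tri≈ _ refl _ = inj₂ q<r
  ... | tri> _ _ p<q  = inj₂ (ℚ.<-trans p<q q<r)

-- The rational that witnesses x < y lies strictly between them, by roundedness on both sides.
ℝ-isDense : IsDense ℝ-constraintSystem
ℝ-isDense {x} {y} (q , xq , yq) =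
  let r , r<q , xr = to (upperRounded x q) xq
      s , q<s , ys = to (lowerRounded y q) yq
  in fromℚ q , (r , xr , r<q) , (s , q<s , ys)

ℝ-isOpen : IsOpen ℝ-constraintSystem
ℝ-isOpen x =
  let q , xq = lowerInhabited x
      r , q<r , xr = to (lowerRounded x q) xq
      p , xp = upperInhabited x
      s , s<p , xs = to (upperRounded x p) xp
  in fromℚ q , fromℚ p , (r , q<r , xr) , (s , xs , s<p)

theorem2p2p9 : (a ℓ : Level) (L R : Set) → DecidableEquality L → DecidableEquality R →
    ((𝒟 : ConstraintSystem a ℓ) → IsInfinite 𝒟 → IsStrictlyTotallyOrdered 𝒟 → IsDense 𝒟 → IsOpen 𝒟 →
    Decidable (Satisfiable 𝒟 {L} {R}))
    × Decidable (Satisfiable ℝ-constraintSystem {L} {R})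
theorem2p2p9 a ℓ L R _≟ˡ_ _≟ʳ_ =
  -- The empty list does not exhaust the carrier, which yields the starting element `d₀`.
  (λ 𝒟 infinite sto dense isOpen → satisfiable? _≟ˡ_ _≟ʳ_ 𝒟 (proj₁ (infinite [])) sto dense isOpen) ,
  satisfiable? _≟ˡ_ _≟ʳ_ ℝ-constraintSystem (fromℚ 0ℚ) ℝ-isStrictlyTotallyOrdered
    (λ {x} {y} → ℝ-isDense {x} {y}) ℝ-isOpen
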